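{- The logic $\exists^{\log^{\omega}}\mathrm{IFP}$ captures the complexity class $\beta\mathrm{P}$ on the class STRING of all strings.
   Context: Throughout, $\log(n)=\lceil \log_2 n\rceil$ and $\log^k(n)=(\log(n))^k$. A string is viewed as a finite structure $u=(U,<,P_0,P_1,P_\#,P_\langle,P_\rangle)$ over the signature $\tau_{\mathrm{str}}=\{<,P_0,P_1,P_\#,P_\langle,P_\rangle\}$, where $U=\{0,\dots,|u|-1\}$, $<$ is the natural order and $P_c i$ holds iff the $i$-th symbol of $u$ is $c$; STRING is the class of all such structures. A language $L$ is in $\beta_k$ if there are a language $L'\in\mathrm{P}$ and an integer $c>0$ such that for every string $u$: $u\in L$ iff there exists $v\in\{0,1\}^*$ with $|v|\le c\cdot\log^k(|u|)$ and $u\#v\in L'$. $\beta\mathrm{P}=\bigcup_{k\in\mathbb N}\beta_k$. IFP is first-order logic extended by the inflationary fixed-point operator. For $k>0$ the log-quantifier $\exists^{\log^k}$ is a second-order quantifier with semantics: $\mathscr A\models\exists^{\log^k}X\phi$ iff there is $S\subseteq A^{\mathrm{arity}(X)}$ with $|S|\le\log^k(|A|)$ such that $\mathscr A\models\phi[X/S]$ (any nonzero arity of $X$ allowed). A formula of $\exists^{\log^\omega}\mathrm{IFP}$ has the form $\exists^{\log^{k_1}}X_1\cdots\exists^{\log^{k_m}}X_m\,\psi$ with $m\ge 0$, $k_1,\dots,k_m>0$ and $\psi$ an IFP-formula. A logic $\mathscr L$ captures a complexity class $\mathcal C$ on a class $\mathcal K$ of structures (closed under isomorphism) if: (1) $\mathscr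 L[\tau]$ is decidable for every signature $\tau$; (2) there is an effective procedure associating with each $\mathscr L$-sentence $\phi$ a $\mathcal C$-bounded Turing machine $M$ which decides, for every $\mathscr A\in\mathcal K$ (given by its encoding), whether $\mathscr A\models\phi$; (3) for every Boolean query $\mathcal Q$ in $\mathcal C$ there is an $\mathscr L$-sentence $\phi$ such that for all $\mathscr A\in\mathcal K$, $\mathscr A\models\phi$ iff $\mathscr A\in\mathcal Q$. -}

module Defs where

open import Data.Nat using (ℕ; zero; suc; _+_; _*_; _^_; _≤_; _<_)
open import Data.Nat.Logarithm using (⌈log₂_⌉)
open import Data.Fin using (Fin; toℕ) renaming (_≟_ to _≟ᶠ_)
open import Data.Bool using (Bool; true; false)
open import Data.List using (List; []; _∷_; length; map; _++_)
import Data.List as List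
open import Data.List.Membership.Propositional using (_∈_)
open import Data.List.Relation.Unary.All using (All; []; _∷_)
import Data.List.Relation.Unary.All as All
open import Data.Vec using (Vec; []; _∷_)
import Data.Vec as Vec
open import Data.Product using (Σ; _×_; _,_)
open import Data.Sum using (_⊎_)
open import Data.Empty using (⊥)
open import Relation.Nullary using (¬_; yes; no)
open import Relation.Binary.PropositionalEquality using (_≡_; _≢_)
open import Function.Bundles using (_⇔_)

data Sym : Set where
  s0 s1 s# s⟨ s⟩ : Sym

Str : Set
Str = List Sym

-- Boolean queries on STRING = languages (strings are their own encodings)
Language : Set₁
Language = Str → Set

logᵏ : ℕ → ℕ → ℕ
logᵏ k n = ⌈log₂ n ⌉ ^ k

bitSym : Bool → Sym
bitSym false = s0
bitSym true  = s1

_#_ : Str → List Bool → Str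
u # v = u ++ (s# ∷ map bitSym v)

data Move : Set where
  mL mR mS : Move

record TM : Set where
  field
    nQ nG   : ℕ
    start   : Fin nQ
    acc rej : Fin nQ
    acc≢rej : acc ≢ rej
    blank   : Fin nG
    inp     : Sym → Fin nG
    δ       : Fin nQ → Fin nG → Fin nQ × Fin nG × Move

record Config (M : TM) : Set where
  constructor cfg
  open TM M
  field
    state : Fin nQ
    left  : List (Fin nG)   -- cells to the left of the head, nearest first
    head  : Fin nG
    right : List (Fin nG)   -- cells to the right of the head, nearest first

module _ (M : TM) where
  open TM M

  initConfig : Str → Config M
  initConfig u with map inp u
  ... | []     = cfg start [] blank []
  ... | x ∷ xs = cfg start [] x xs

  moveHead : Fin nQ → List (Fin nG) → Fin nG → List (Fin nG) → Move → Config M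
  moveHead q ls w rs mS = cfg q ls w rs
  moveHead q [] w rs mL = cfg q [] w rs
  moveHead q (x ∷ ls) w rs mL = cfg q ls x (w ∷ rs)
  moveHead q ls w [] mR = cfg q (w ∷ ls) blank []
  moveHead q ls w (x ∷ rs) mR = cfg q (w ∷ ls) x rs

  step : Config M → Config M
  step (cfg q ls h rs) with q ≟ᶠ acc | q ≟ᶠ rej
  ... | yes _ | _ = cfg q ls h rs
  ... | no _ | yes _ = cfg q ls h rs
  ... | no _ | no _ with δ q h
  ...   | q' , w , m = moveHead q' ls w rs m

  run : ℕ → Config M → Config M
  run zero c = c
  run (suc t) c = run t (step c)

  stateAfter : ℕ → Str → Fin nQ
  stateAfter t w = Config.state (run t (initConfig w))

  Halted : Fin nQ → Set
  Halted q = (q ≡ acc) ⊎ (q ≡ rej)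

poly : ℕ → ℕ → ℕ → ℕ
poly c d n = c * n ^ d + c

DecidesInTime : TM → (ℕ → ℕ) → Language → Set
DecidesInTime M T L = ∀ u →
  Halted M (stateAfter M (T (length u)) u) ×
  ((stateAfter M (T (length u)) u ≡ TM.acc M) ⇔ L u)

InP : Language → Set
InP L = Σ TM λ M → Σ ℕ λ c → Σ ℕ λ d → DecidesInTime M (poly c d) L

Inβ : ℕ → Language → Set₁
Inβ k L = Σ Language λ L' → InP L' × Σ ℕ λ c → (0 < c) ×
  (∀ u → L u ⇔ (Σ (List Bool) λ v → (length v ≤ c * logᵏ k (length u)) × L' (u # v)))

InβP : Language → Set₁
InβP L = Σ ℕ λ k → Inβ k L

record βPMachine : Set where
  field
    verifier : TM
    k c      : ℕ
    pc pd    : ℕ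
    halts    : ∀ w → Halted verifier (stateAfter verifier (poly pc pd (length w)) w)

  Accepts : Str → Set
  Accepts u = Σ (List Bool) λ v → (length v ≤ c * logᵏ k (length u)) ×
    (stateAfter verifier (poly pc pd (length (u # v))) (u # v) ≡ TM.acc verifier)

-- IFP over the string signature {<, P0, P1, P#, P⟨, P⟩}
-- Formula n Γ : n free first-order variables, relation variables of arities Γ

data Formula : ℕ → List ℕ → Set where
  eq   : ∀ {n Γ} → Fin n → Fin n → Formula n Γ
  lt   : ∀ {n Γ} → Fin n → Fin n → Formula n Γ
  P    : ∀ {n Γ} → Sym → Fin n → Formula n Γ
  rel  : ∀ {n Γ r} → r ∈ Γ → Vec (Fin n) r → Formula n Γ
  neg  : ∀ {n Γ} → Formula n Γ → Formula n Γ
  conj : ∀ {n Γ} → Formula n Γ → Formula n Γ → Formula n Γ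
  ex   : ∀ {n Γ} → Formula (suc n) Γ → Formula n Γ
  -- [ifp_{R,x̄} φ](t̄) : x̄ are the first r variables of φ, R the new relation variable
  ifp  : ∀ {n Γ} (r : ℕ) → Formula (r + n) (r ∷ Γ) → Vec (Fin n) r → Formula n Γ

Env : ℕ → List ℕ → Set₁
Env N Γ = All (λ r → Vec (Fin N) r → Set) Γ

module Sem (u : Str) where
  N : ℕ
  N = length u

  mutual
    sat : ∀ {n Γ} → Formula n Γ → Vec (Fin N) n → Env N Γ → Set
    sat (eq i j)   ρ e = Vec.lookup ρ i ≡ Vec.lookup ρ j
    sat (lt i j)   ρ e = toℕ (Vec.lookup ρ i) < toℕ (Vec.lookup ρ j)
    sat (P c i)    ρ e = List.lookup u (Vec.lookup ρ i) ≡ c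
    sat (rel p ts) ρ e = All.lookup e p (Vec.map (Vec.lookup ρ) ts)
    sat (neg φ)    ρ e = ¬ sat φ ρ e
    sat (conj φ ψ) ρ e = sat φ ρ e × sat ψ ρ e
    sat (ex φ)     ρ e = Σ (Fin N) λ a → sat φ (a ∷ ρ) e
    sat (ifp r φ ts) ρ e = stage r φ ρ e (N ^ r) (Vec.map (Vec.lookup ρ) ts)

    -- inflationary stages: R⁰ = ∅, Rⁱ⁺¹ = Rⁱ ∪ φ[Rⁱ]; stage N^r is the fixed point
    stage : ∀ {n Γ} (r : ℕ) → Formula (r + n) (r ∷ Γ) → Vec (Fin N) n → Env N Γ →
            ℕ → Vec (Fin N) r → Set
    stage r φ ρ e zero    ā = ⊥
    stage r φ ρ e (suc i) ā = stage r φ ρ e i ā ⊎ sat φ (ā Vec.++ ρ) (stage r φ ρ e i ∷ e)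

data LogFormula : List ℕ → Set where
  body  : ∀ {Γ} → Formula 0 Γ → LogFormula Γ
  logEx : ∀ {Γ} (k r : ℕ) → 0 < k → 0 < r → LogFormula (r ∷ Γ) → LogFormula Γ

Sentence : Set
Sentence = LogFormula []

satL : (u : Str) → ∀ {Γ} → LogFormula Γ → Env (length u) Γ → Set
satL u (body ψ) e = Sem.sat u ψ [] e
satL u (logEx k r _ _ φ) e =
  Σ (List (Vec (Fin (length u)) r)) λ S →
    (length S ≤ logᵏ k (length u)) × satL u φ ((λ ā → ā ∈ S) ∷ e)

_⊨_ : Str → Sentence → Set
u ⊨ φ = satL u φ []

{-# OPTIONS --safe #-}
module Submission where

-- From sentences to machines: a relation on an N-element universe is stored as a bit track of
-- the tape, at the positions given by N-ary numerals, and a variable as a track with a single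
-- mark.  An IFP formula is then evaluated by nested loops of polynomial length, an inflationary
-- fixed point by N ^ r rounds of filling a table.  The certificate lists, for every quantifier
-- ∃^{log^k}, exactly ⌈log₂ N⌉ ^ k records of r numbers of ⌈log₂ N⌉ bits with a validity bit, so
-- that the bound on the cardinality of the guessed set holds by construction.
--
-- From machines to sentences: times and tape positions are r-tuples.  One inflationary fixed
-- point builds up the relation "at time t, position p has state or symbol s", whose i-th stage
-- describes the run before time i.  The certificate v is guessed through c sets of at most
-- log^k N pairs of a position and a bit; v ends where the pairs stop, so |v| ≤ c · log^k N.
-- Strings of length at most 1 are treated separately, as tuples cannot code anything there.

open import Defs
open import Data.Nat
open import Data.Nat.Properties
open import Data.Nat.Logarithm using (⌈log₂_⌉; ⌈log₂⌉-mono-≤; ⌈log₂2^n⌉≡n; ⌈log₂⌈n/2⌉⌉≡⌈log₂n⌉∸1)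
open import Data.Nat.Induction using (<-wellFounded; Acc; acc)
open import Data.Nat.Tactic.RingSolver using (solve-∀)
open import Data.Fin using (Fin; zero; suc; toℕ; fromℕ<; combine; remQuot; splitAt; join; _↑ˡ_; _↑ʳ_)
import Data.Fin as Fin
import Data.Fin.Properties as Finₚ
open import Data.Bool using (Bool; true; false; _∧_; _∨_; not; if_then_else_)
import Data.Bool.Properties as Boolₚ
open import Data.Maybe using (Maybe; just; nothing; is-just)
import Data.Maybe.Properties as Maybeₚ
open import Data.List using (List; []; _∷_; length; map; _++_; replicate)
import Data.List as List
import Data.List.Properties as Listₚ
open import Data.List.Membership.Propositional using (_∈_; find)
import Data.List.Membership.Propositional.Properties as ∈ₚ
open import Data.List.Relation.Unary.Any using (here; there)
import Data.List.Relation.Unary.Any as Any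
import Data.List.Relation.Unary.Any.Properties as Anyₚ
open import Data.List.Relation.Unary.All using (All; []; _∷_)
import Data.List.Relation.Unary.All as All
open import Data.Vec using (Vec; []; _∷_)
import Data.Vec as Vec
import Data.Vec.Properties as Vecₚ
open import Data.Product using (Σ; _×_; _,_; proj₁; proj₂)
open import Data.Sum using (_⊎_; inj₁; inj₂; [_,_])
import Data.Sum as Sum
open import Data.Empty using (⊥)
open import Data.Unit using (⊤; tt)
open import Relation.Nullary using (¬_; Dec; yes; no; does; proof; contradiction)
open import Relation.Nullary.Decidable using (map′; _×-dec_; _⊎-dec_; decidable-stable)
open import Relation.Nullary.Reflects using (Reflects; ofʸ; ofⁿ; det; fromEquivalence; ¬-reflects; _×-reflects_; _⊎-reflects_)
open import Relation.Binary.PropositionalEquality using (_≡_; _≢_; refl; sym; trans; cong; cong₂; subst; subst₂; _≗_; module ≡-Reasoning)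
open import Relation.Binary.Definitions using (DecidableEquality; tri<; tri≈; tri>)
open import Function using (_∘_; id)
open import Function.Bundles using (_⇔_; mk⇔; module Equivalence)

-- Boolean evaluation of formulas

-- The semantics is `Set`-valued and excluded middle is not assumed, while disjunctions and
-- universal statements have to be recovered from formulas built with `neg`, `conj` and `ex`.
-- Finiteness of the universe is the way round: `ev` computes every formula to a Boolean, and the
-- meaning of a formula is always stated as `Reflects A (ev φ ρ e)`, which can be used in both
-- directions.
--
-- The machines come from a small language of register programs by compilation. One number B,
-- polynomial in the length of the input, bounds the registers and the passes of loops, so the
-- polynomial running time can be read off the shape of the program.
--
-- A verifier has to halt on every string and not only on strings of the form `u # v`. Each string
-- is therefore split at its last separator, and bits that are missing or malformed still decode to
-- admissible sets.
--
-- Tuples count only up to pure powers of N. The exponent has to exceed both the running time on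
-- `u # v` and the length of this string, for all N from 2 on.

_≟ˢ_ : DecidableEquality Sym
s0 ≟ˢ s0 = yes refl
s0 ≟ˢ s1 = no λ ()
s0 ≟ˢ s# = no λ ()
s0 ≟ˢ s⟨ = no λ ()
s0 ≟ˢ s⟩ = no λ ()
s1 ≟ˢ s0 = no λ ()
s1 ≟ˢ s1 = yes refl
s1 ≟ˢ s# = no λ ()
s1 ≟ˢ s⟨ = no λ ()
s1 ≟ˢ s⟩ = no λ ()
s# ≟ˢ s0 = no λ ()
s# ≟ˢ s1 = no λ ()
s# ≟ˢ s# = yes refl
s# ≟ˢ s⟨ = no λ ()
s# ≟ˢ s⟩ = no λ ()
s⟨ ≟ˢ s0 = no λ ()
s⟨ ≟ˢ s1 = no λ ()
s⟨ ≟ˢ s# = no λ ()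
s⟨ ≟ˢ s⟨ = yes refl
s⟨ ≟ˢ s⟩ = no λ ()
s⟩ ≟ˢ s0 = no λ ()
s⟩ ≟ˢ s1 = no λ ()
s⟩ ≟ˢ s# = no λ ()
s⟩ ≟ˢ s⟨ = no λ ()
s⟩ ≟ˢ s⟩ = yes refl

anyᶠ : ∀ {n} → (Fin n → Bool) → Bool
anyᶠ {zero}  f = false
anyᶠ {suc n} f = f zero ∨ anyᶠ (f ∘ suc)

reflects-⇔ : ∀ {A B : Set} {b} → (A → B) → (B → A) → Reflects A b → Reflects B b
reflects-⇔ f g (ofʸ a)  = ofʸ (f a)
reflects-⇔ f g (ofⁿ ¬a) = ofⁿ (¬a ∘ g)

reflects-true : ∀ {A : Set} {b} → Reflects A b → b ≡ true → A
reflects-true (ofʸ a) refl = a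

reflects-intro : ∀ {A : Set} {b} → Reflects A b → A → b ≡ true
reflects-intro (ofʸ _)  a = refl
reflects-intro (ofⁿ ¬a) a = contradiction a ¬a

anyᶠ-reflects : ∀ {n} {A : Fin n → Set} {f : Fin n → Bool} →
                (∀ i → Reflects (A i) (f i)) → Reflects (Σ (Fin n) A) (anyᶠ f)
anyᶠ-reflects {zero}  r = ofⁿ λ ()
anyᶠ-reflects {suc n} {A} r =
  reflects-⇔ [ (zero ,_) , (λ (i , a) → suc i , a) ]
             (λ { (zero , a) → inj₁ a ; (suc i , a) → inj₂ (i , a) })
             (r zero ⊎-reflects anyᶠ-reflects {A = A ∘ suc} (r ∘ suc))

<ᵇ-reflects : ∀ m n → Reflects (m < n) (m <ᵇ n)
<ᵇ-reflects m n = fromEquivalence (<ᵇ⇒< m n) <⇒<ᵇ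

≡ᵇ-reflects : ∀ m n → Reflects (m ≡ n) (m ≡ᵇ n)
≡ᵇ-reflects m n = fromEquivalence (≡ᵇ⇒≡ m n) (≡⇒≡ᵇ m n)

EnvB : ℕ → List ℕ → Set
EnvB N Γ = All (λ r → Vec (Fin N) r → Bool) Γ

ReflectsEnv : ∀ {N Γ} → Env N Γ → EnvB N Γ → Set
ReflectsEnv {N} {Γ} e b =
  ∀ {r} (p : r ∈ Γ) (ā : Vec (Fin N) r) → Reflects (All.lookup e p ā) (All.lookup b p ā)

reflectsEnv-∷ : ∀ {N Γ r} {R : Vec (Fin N) r → Set} {Rᵇ : Vec (Fin N) r → Bool}
                {e : Env N Γ} {b : EnvB N Γ} →
                (∀ ā → Reflects (R ā) (Rᵇ ā)) → ReflectsEnv e b →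
                ReflectsEnv {Γ = r ∷ Γ} (R ∷ e) (Rᵇ ∷ b)
reflectsEnv-∷ h hs (here refl) = h
reflectsEnv-∷ h hs (there p)   = hs p

module Eval (u : Str) where
  open Sem u

  mutual
    ev : ∀ {n Γ} → Formula n Γ → Vec (Fin N) n → EnvB N Γ → Bool
    ev (eq i j)     ρ e = does (Vec.lookup ρ i Fin.≟ Vec.lookup ρ j)
    ev (lt i j)     ρ e = toℕ (Vec.lookup ρ i) <ᵇ toℕ (Vec.lookup ρ j)
    ev (P c i)      ρ e = does (List.lookup u (Vec.lookup ρ i) ≟ˢ c)
    ev (rel p ts)   ρ e = All.lookup e p (Vec.map (Vec.lookup ρ) ts)
    ev (neg φ)      ρ e = not (ev φ ρ e)
    ev (conj φ ψ)   ρ e = ev φ ρ e ∧ ev ψ ρ e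
    ev (ex φ)       ρ e = anyᶠ λ a → ev φ (a ∷ ρ) e
    ev (ifp r φ ts) ρ e = stageᵇ r φ ρ e (N ^ r) (Vec.map (Vec.lookup ρ) ts)

    stageᵇ : ∀ {n Γ} (r : ℕ) → Formula (r + n) (r ∷ Γ) → Vec (Fin N) n → EnvB N Γ →
             ℕ → Vec (Fin N) r → Bool
    stageᵇ r φ ρ e zero    ā = false
    stageᵇ r φ ρ e (suc i) ā =
      stageᵇ r φ ρ e i ā ∨ ev φ (ā Vec.++ ρ) (stageᵇ r φ ρ e i ∷ e)

  mutual
    ev-reflects : ∀ {n Γ} (φ : Formula n Γ) ρ {e b} → ReflectsEnv e b →
                  Reflects (sat φ ρ e) (ev φ ρ b)
    ev-reflects (eq i j)     ρ h = proof (Vec.lookup ρ i Fin.≟ Vec.lookup ρ j)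
    ev-reflects (lt i j)     ρ h = <ᵇ-reflects _ _
    ev-reflects (P c i)      ρ h = proof (List.lookup u (Vec.lookup ρ i) ≟ˢ c)
    ev-reflects (rel p ts)   ρ h = h p _
    ev-reflects (neg φ)      ρ h = ¬-reflects (ev-reflects φ ρ h)
    ev-reflects (conj φ ψ)   ρ h = ev-reflects φ ρ h ×-reflects ev-reflects ψ ρ h
    ev-reflects (ex φ)       ρ h = anyᶠ-reflects λ a → ev-reflects φ (a ∷ ρ) h
    ev-reflects (ifp r φ ts) ρ h = stage-reflects r φ ρ h (N ^ r) _

    stage-reflects : ∀ {n Γ} r (φ : Formula (r + n) (r ∷ Γ)) ρ {e b} → ReflectsEnv e b →
                     ∀ i ā → Reflects (stage r φ ρ e i ā) (stageᵇ r φ ρ b i ā)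
    stage-reflects r φ ρ h zero    ā = ofⁿ λ ()
    stage-reflects r φ ρ h (suc i) ā =
      stage-reflects r φ ρ h i ā ⊎-reflects
      ev-reflects φ (ā Vec.++ ρ) (reflectsEnv-∷ (stage-reflects r φ ρ h i) h)

-- Tuples over Fin N as N-ary numerals, least significant digit first

enc : ∀ {N r} → Vec (Fin N) r → ℕ
enc []           = 0
enc {N} (a ∷ as) = toℕ a + N * enc as

m+n*o≤n*[1+o] : ∀ {m n} o → m ≤ n → m + n * o ≤ n * suc o
m+n*o≤n*[1+o] {m} {n} o m≤n = ≤-trans (+-monoˡ-≤ (n * o) m≤n) (≤-reflexive (sym (*-suc n o)))

enc<N^r : ∀ {N r} (as : Vec (Fin N) r) → enc as < N ^ r
enc<N^r []           = s≤s z≤n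
enc<N^r {N} (a ∷ as) =
  ≤-trans (m+n*o≤n*[1+o] {suc (toℕ a)} (enc as) (Finₚ.toℕ<n a)) (*-monoʳ-≤ N (enc<N^r as))

digits-injective : ∀ {N} (a b : Fin N) x y → toℕ a + N * x ≡ toℕ b + N * y → toℕ a ≡ toℕ b × x ≡ y
digits-injective {N} a b x y p with <-cmp x y
... | tri≈ _ refl _ = +-cancelʳ-≡ (N * x) _ _ p , refl
... | tri< x<y _ _ = contradiction (≤-trans (m+n*o≤n*[1+o] {suc (toℕ a)} x (Finₚ.toℕ<n a))
                      (≤-trans (*-monoʳ-≤ N x<y) (≤-trans (m≤n+m (N * y) (toℕ b)) (≤-reflexive (sym p))))) (n≮n _)
... | tri> _ _ y<x = contradiction (≤-trans (m+n*o≤n*[1+o] {suc (toℕ b)} y (Finₚ.toℕ<n b))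
                      (≤-trans (*-monoʳ-≤ N y<x) (≤-trans (m≤n+m (N * x) (toℕ a)) (≤-reflexive p)))) (n≮n _)

enc-injective : ∀ {N r} (as bs : Vec (Fin N) r) → enc as ≡ enc bs → as ≡ bs
enc-injective []       []       p = refl
enc-injective (a ∷ as) (b ∷ bs) p with digits-injective a b (enc as) (enc bs) p
... | a≡b , q = cong₂ _∷_ (Finₚ.toℕ-injective a≡b) (enc-injective as bs q)

enc-surjective : ∀ {N} r {x} → x < N ^ r → Σ (Vec (Fin N) r) λ as → enc as ≡ x
enc-surjective zero    {zero}  p = [] , refl
enc-surjective zero    {suc x} (s≤s ())
enc-surjective {N} (suc r) {x} p with remQuot {N ^ r} N (fromℕ< (subst (x <_) (*-comm N (N ^ r)) p)) in eq₁
... | q , a with enc-surjective r (Finₚ.toℕ<n q)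
... | as , h = a ∷ as , (begin
  toℕ a + N * enc as            ≡⟨ cong (λ z → toℕ a + N * z) h ⟩
  toℕ a + N * toℕ q             ≡⟨ +-comm (toℕ a) _ ⟩
  N * toℕ q + toℕ a             ≡⟨ Finₚ.toℕ-combine q a ⟨
  toℕ (combine q a)             ≡⟨ cong (λ (q , a) → toℕ (combine q a)) eq₁ ⟨
  toℕ (combine (proj₁ rq) (proj₂ rq)) ≡⟨ cong toℕ (Finₚ.combine-remQuot {N ^ r} N _) ⟩
  toℕ (fromℕ< p′)               ≡⟨ Finₚ.toℕ-fromℕ< p′ ⟩
  x                             ∎)
  where
    open ≡-Reasoning
    p′ = subst (x <_) (*-comm N (N ^ r)) p
    rq = remQuot {N ^ r} N (fromℕ< p′)

-- Machines on functional tapes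

upd : ∀ {A : Set} → (ℕ → A) → ℕ → A → ℕ → A
upd f i x j = if j ≡ᵇ i then x else f j

upd-same : ∀ {A : Set} (f : ℕ → A) i x → upd f i x i ≡ x
upd-same f i x with i ≡ᵇ i | ≡ᵇ-reflects i i
... | _ | ofʸ _    = refl
... | _ | ofⁿ i≢i = contradiction refl i≢i

upd-other : ∀ {A : Set} (f : ℕ → A) i x {j} → j ≢ i → upd f i x j ≡ f j
upd-other f i x {j} j≢i with j ≡ᵇ i | ≡ᵇ-reflects j i
... | _ | ofʸ j≡i = contradiction j≡i j≢i
... | _ | ofⁿ _    = refl

upd-cong : ∀ {A B : Set} (f : ℕ → A) (g : ℕ → B) (d : A → B) i x y →
           d ∘ f ≗ g → d x ≡ y → d ∘ upd f i x ≗ upd g i y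
upd-cong f g d i x y h k j with j ≡ᵇ i
... | true  = k
... | false = h j

moveTo : Move → ℕ → ℕ
moveTo mL p = pred p
moveTo mR p = suc p
moveTo mS p = p

module Functional {S G : Set} (δ : S → G → S × G × Move) where

  FConf : Set
  FConf = S × ℕ × (ℕ → G)

  fstep : FConf → FConf
  fstep (s , p , τ) with δ s (τ p)
  ... | s′ , g , m = s′ , moveTo m p , upd τ p g

  frun : ℕ → FConf → FConf
  frun zero    c = c
  frun (suc t) c = frun t (fstep c)

  frun-+ : ∀ a b c → frun (a + b) c ≡ frun b (frun a c)
  frun-+ zero    b c = refl
  frun-+ (suc a) b c = frun-+ a b (fstep c)

  frun-suc : ∀ t c → frun (suc t) c ≡ fstep (frun t c)
  frun-suc t c = trans (cong (λ n → frun n c) (+-comm 1 t)) (frun-+ t 1 c)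

  fstep-state : ∀ c → proj₁ (fstep c) ≡ proj₁ (δ (proj₁ c) (proj₂ (proj₂ c) (proj₁ (proj₂ c))))
  fstep-state (s , p , τ) with δ s (τ p)
  ... | _ = refl

  fstep-pos : ∀ c → proj₁ (proj₂ (fstep c)) ≡ moveTo (proj₂ (proj₂ (δ (proj₁ c) (proj₂ (proj₂ c) (proj₁ (proj₂ c)))))) (proj₁ (proj₂ c))
  fstep-pos (s , p , τ) with δ s (τ p)
  ... | _ = refl

  fstep-tape : ∀ c j → proj₂ (proj₂ (fstep c)) j ≡
               upd (proj₂ (proj₂ c)) (proj₁ (proj₂ c)) (proj₁ (proj₂ (δ (proj₁ c) (proj₂ (proj₂ c) (proj₁ (proj₂ c)))))) j
  fstep-tape (s , p , τ) j with δ s (τ p)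
  ... | _ = refl

  frun-stuck : ∀ {s} → (∀ g → δ s g ≡ (s , g , mS)) → ∀ t p τ → proj₁ (frun t (s , p , τ)) ≡ s
  frun-stuck h zero    p τ = refl
  frun-stuck h (suc t) p τ rewrite h (τ p) = frun-stuck h t p (upd τ p (τ p))

module Transfer {S G S′ G′ : Set}
                (δ : S → G → S × G × Move) (δ′ : S′ → G′ → S′ × G′ × Move)
                (e : S → S′) (d : G′ → G)
                (sim : ∀ s g → proj₁ (δ′ (e s) g) ≡ e (proj₁ (δ s (d g))) ×
                               d (proj₁ (proj₂ (δ′ (e s) g))) ≡ proj₁ (proj₂ (δ s (d g))) ×
                               proj₂ (proj₂ (δ′ (e s) g)) ≡ proj₂ (proj₂ (δ s (d g)))) where
  private
    module F  = Functional δ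
    module F′ = Functional δ′

  -- `Finite` only guarantees that decoding undoes encoding. Tape symbols are therefore compared
  -- after decoding, while states are compared as codes, because the halting states of the machine
  -- are codes.
  transfer : ∀ t s p {τ τ′} → d ∘ τ′ ≗ τ →
             proj₁ (F′.frun t (e s , p , τ′)) ≡ e (proj₁ (F.frun t (s , p , τ)))
  transfer zero    s p h = refl
  transfer (suc t) s p {τ} {τ′} h
    with δ s (d (τ′ p)) | δ s (τ p) | cong (δ s) (h p) | δ′ (e s) (τ′ p) | sim s (τ′ p)
  ... | s₁ , g₁ , m | _ | refl | _ , g₁′ , _ | refl , k , refl =
    transfer t s₁ (moveTo m p) (upd-cong τ′ τ d p g₁′ g₁ h k)

nth : ∀ {A : Set} → A → List A → ℕ → A
nth b []       i       = b
nth b (x ∷ xs) zero    = x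
nth b (x ∷ xs) (suc i) = nth b xs i

module TapeOf (M : TM) where
  open TM M renaming (acc to qacc; rej to qrej)

  -- Halting is built into the table as a step that changes nothing, so runs need no case
  -- distinction on halted configurations.
  δ̂ : Fin nQ → Fin nG → Fin nQ × Fin nG × Move
  δ̂ q g with q Fin.≟ qacc | q Fin.≟ qrej
  ... | yes _ | _     = q , g , mS
  ... | no _  | yes _ = q , g , mS
  ... | no _  | no _  = δ q g

  open Functional δ̂ public

  -- The index p is forced to be the length of the list: the list is empty exactly at position 0,
  -- where both kinds of tape stay put on a move to the left.
  data Left (τ : ℕ → Fin nG) : List (Fin nG) → ℕ → Set where
    []  : Left τ [] 0
    _∷_ : ∀ {x ls p} → τ p ≡ x → Left τ ls p → Left τ (x ∷ ls) (suc p)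

  record Rep (c : Config M) (f : FConf) : Set where
    constructor rep
    open Config c renaming (left to ls; head to h; right to rs)
    private
      p = proj₁ (proj₂ f)
      τ = proj₂ (proj₂ f)
    field
      st : state ≡ proj₁ f
      lf : Left τ ls p
      hd : τ p ≡ h
      rt : ∀ i → τ (suc p + i) ≡ nth blank rs i

  left-upd : ∀ {τ ls p} k w → p ≤ k → Left τ ls p → Left (upd τ k w) ls p
  left-upd k w p≤k []       = []
  left-upd {τ} k w p≤k (e ∷ l) =
    trans (upd-other τ k w (<⇒≢ p≤k)) e ∷ left-upd k w (≤-trans (n≤1+n _) p≤k) l

  right-upd : ∀ {f : ℕ → Fin nG} τ p w → (∀ i → τ (suc p + i) ≡ f i) →
              ∀ i → upd τ p w (suc p + i) ≡ f i
  right-upd τ p w h i = trans (upd-other τ p w (λ e → <⇒≢ (s≤s (m≤m+n p i)) (sym e))) (h i)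

  rep-move : ∀ {q ls h rs q₀ p τ} q′ w m → Rep (cfg q ls h rs) (q₀ , p , τ) →
             Rep (moveHead M q′ ls w rs m) (q′ , moveTo m p , upd τ p w)
  rep-move {p = p} {τ} q′ w mS (rep _ lf _ rt) =
    rep refl (left-upd p w ≤-refl lf) (upd-same τ p w) (right-upd τ p w rt)
  rep-move {τ = τ} q′ w mL (rep _ [] _ rt) =
    rep refl [] (upd-same τ 0 w) (right-upd τ 0 w rt)
  rep-move {p = suc p} {τ} q′ w mL (rep _ (e ∷ lf) _ rt) =
    rep refl (left-upd (suc p) w (n≤1+n _) lf) (trans (upd-other τ (suc p) w (<⇒≢ ≤-refl)) e)
      λ { zero    → trans (cong (upd τ (suc p) w) (cong suc (+-identityʳ p))) (upd-same τ (suc p) w)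
        ; (suc i) → trans (cong (upd τ (suc p) w) (cong suc (+-suc p i))) (right-upd τ (suc p) w rt i) }
  rep-move {rs = []} {p = p} {τ} q′ w mR (rep _ lf _ rt) =
    rep refl (upd-same τ p w ∷ left-upd p w ≤-refl lf)
      (trans (cong (upd τ p w) (cong suc (sym (+-identityʳ p)))) (right-upd τ p w rt 0))
      λ i → trans (cong (upd τ p w) (cong suc (sym (+-suc p i)))) (right-upd τ p w rt (suc i))
  rep-move {rs = x ∷ rs} {p = p} {τ} q′ w mR (rep _ lf _ rt) =
    rep refl (upd-same τ p w ∷ left-upd p w ≤-refl lf)
      (trans (cong (upd τ p w) (cong suc (sym (+-identityʳ p)))) (right-upd τ p w rt 0))
      λ i → trans (cong (upd τ p w) (cong suc (sym (+-suc p i)))) (right-upd τ p w rt (suc i))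

  rep-step : ∀ {c f} → Rep c f → Rep (step M c) (fstep f)
  rep-step {cfg q ls h rs} {.q , p , τ} r@(rep refl lf refl rt) with q Fin.≟ qacc | q Fin.≟ qrej
  ... | yes _ | _     = rep-move {q = q} q (τ p) mS r
  ... | no _  | yes _ = rep-move {q = q} q (τ p) mS r
  ... | no _  | no _  with δ q (τ p)
  ...   | q′ , w , m = rep-move {q = q} q′ w m r

  rep-run : ∀ t {c f} → Rep c f → Rep (run M t c) (frun t f)
  rep-run zero    r = r
  rep-run (suc t) r = rep-run t (rep-step r)

  finit : Str → FConf
  finit w = start , 0 , nth blank (map inp w)

  rep-init : ∀ w → Rep (initConfig M w) (finit w)
  rep-init w with map inp w
  ... | []     = rep refl [] refl λ i → refl
  ... | x ∷ xs = rep refl [] refl λ i → refl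

  stateAfter-frun : ∀ t w → stateAfter M t w ≡ proj₁ (frun t (finit w))
  stateAfter-frun t w = Rep.st (rep-run t (rep-init w))

  δ̂-halted : ∀ {q} → Halted M q → ∀ g → δ̂ q g ≡ (q , g , mS)
  δ̂-halted {q} h g with q Fin.≟ qacc | q Fin.≟ qrej | h
  ... | yes _ | _     | _      = refl
  ... | no _  | yes _ | _      = refl
  ... | no ¬a | no _  | inj₁ a = contradiction a ¬a
  ... | no _  | no ¬r | inj₂ r = contradiction r ¬r

  -- A halting state is fixed by `δ̂`, so it is still there at any later time. This allows a run of
  -- some length to be compared with the fixed polynomial time bound.
  stateAfter-mono : ∀ {t t′} w → t ≤ t′ → Halted M (proj₁ (frun t (finit w))) →
                    stateAfter M t′ w ≡ proj₁ (frun t (finit w))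
  stateAfter-mono {t} {t′} w t≤t′ h = trans (stateAfter-frun t′ w)
    (trans (cong (λ n → proj₁ (frun n (finit w))) (sym (m+[n∸m]≡n t≤t′)))
    (trans (cong proj₁ (frun-+ t (t′ ∸ t) (finit w)))
           (frun-stuck (δ̂-halted h) (t′ ∸ t) _ _)))

-- Finite types as retracts of Fin n

record Finite (A : Set) : Set where
  field
    size        : ℕ
    code        : A → Fin size
    decode      : Fin size → A
    decode-code : ∀ a → decode (code a) ≡ a

  code-injective : ∀ {a b} → code a ≡ code b → a ≡ b
  code-injective {a} {b} p = trans (sym (decode-code a)) (trans (cong decode p) (decode-code b))

finite-retract : ∀ {A B : Set} → Finite B → (f : A → B) (g : B → A) → (∀ a → g (f a) ≡ a) → Finite A
finite-retract F f g h = record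
  { size = size ; code = code ∘ f ; decode = g ∘ decode
  ; decode-code = λ a → trans (cong g (decode-code (f a))) (h a) }
  where open Finite F

finite-⊤ : Finite ⊤
finite-⊤ = record { size = 1 ; code = λ _ → zero ; decode = λ _ → tt ; decode-code = λ _ → refl }

finite-⊎ : ∀ {A B : Set} → Finite A → Finite B → Finite (A ⊎ B)
finite-⊎ F G = record
  { size = F.size + G.size
  ; code = λ { (inj₁ a) → F.code a ↑ˡ G.size ; (inj₂ b) → F.size ↑ʳ G.code b }
  ; decode = λ i → [ inj₁ ∘ F.decode , inj₂ ∘ G.decode ] (splitAt F.size i)
  ; decode-code = λ
      { (inj₁ a) → trans (cong [ inj₁ ∘ F.decode , inj₂ ∘ G.decode ] (Finₚ.splitAt-↑ˡ F.size (F.code a) G.size))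
                         (cong inj₁ (F.decode-code a))
      ; (inj₂ b) → trans (cong [ inj₁ ∘ F.decode , inj₂ ∘ G.decode ] (Finₚ.splitAt-↑ʳ F.size G.size (G.code b)))
                         (cong inj₂ (G.decode-code b)) } }
  where
    module F = Finite F
    module G = Finite G

finite-× : ∀ {A B : Set} → Finite A → Finite B → Finite (A × B)
finite-× F G = record
  { size = F.size * G.size
  ; code = λ (a , b) → combine (F.code a) (G.code b)
  ; decode = λ i → F.decode (proj₁ (remQuot {F.size} G.size i)) , G.decode (proj₂ (remQuot {F.size} G.size i))
  ; decode-code = λ (a , b) → trans
      (cong (λ (i , j) → F.decode i , G.decode j) (Finₚ.remQuot-combine (F.code a) (G.code b)))
      (cong₂ _,_ (F.decode-code a) (G.decode-code b)) }
  where
    module F = Finite F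
    module G = Finite G

finite-Bool : Finite Bool
finite-Bool = finite-retract (finite-⊎ finite-⊤ finite-⊤)
  (λ { true → inj₁ tt ; false → inj₂ tt }) [ (λ _ → true) , (λ _ → false) ] (λ { true → refl ; false → refl })

finite-Vec : ∀ {A : Set} → Finite A → ∀ n → Finite (Vec A n)
finite-Vec F zero    = finite-retract finite-⊤ (λ _ → tt) (λ _ → []) (λ { [] → refl })
finite-Vec F (suc n) = finite-retract (finite-× F (finite-Vec F n))
  (λ { (x ∷ xs) → x , xs }) (λ (x , xs) → x ∷ xs) (λ { (x ∷ xs) → refl })

finite-Maybe : ∀ {A : Set} → Finite A → Finite (Maybe A)
finite-Maybe F = finite-retract (finite-⊎ finite-⊤ F)
  (λ { nothing → inj₁ tt ; (just x) → inj₂ x }) [ (λ _ → nothing) , just ] (λ { nothing → refl ; (just x) → refl })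

finite-Sym : Finite Sym
finite-Sym = record
  { size = 5
  ; code = λ { s0 → zero ; s1 → suc zero ; s# → suc (suc zero) ; s⟨ → suc (suc (suc zero)) ; s⟩ → suc (suc (suc (suc zero))) }
  ; decode = λ { zero → s0 ; (suc zero) → s1 ; (suc (suc zero)) → s# ; (suc (suc (suc zero))) → s⟨ ; (suc (suc (suc (suc zero)))) → s⟩ }
  ; decode-code = λ { s0 → refl ; s1 → refl ; s# → refl ; s⟨ → refl ; s⟩ → refl } }

-- Register programs

-- A program works on registers holding natural numbers and on Boolean arrays indexed by
-- natural numbers; every program returns a Boolean.  The action of at i α is performed on
-- register i and on the array entries and input symbols at the position given by register i.
data Act : Set where
  say   : Bool → Act
  inc   : Act
  dec   : Act
  same  : ℕ → Act
  symb  : Maybe Sym → Act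
  get   : ℕ → Act
  put   : ℕ → Bool → Act

data Prog : Set where
  at    : ℕ → Act → Prog
  ite   : Prog → Prog → Prog → Prog
  while : Prog → Prog → Prog

record Mem : Set where
  constructor mem
  field
    reg : ℕ → ℕ
    arr : ℕ → ℕ → Bool
open Mem public

setR : Mem → ℕ → ℕ → Mem
setR s i v = mem (upd (reg s) i v) (arr s)

setA : Mem → ℕ → ℕ → Bool → Mem
setA s a j b = mem (reg s) (upd (arr s) a (upd (arr s a) j b))

_≟ᵐ_ : DecidableEquality (Maybe Sym)
_≟ᵐ_ = Maybeₚ.≡-dec _≟ˢ_

decR : ℕ → ℕ → Mem → Bool × Mem
decR zero    i s = false , s
decR (suc n) i s = true , setR s i n

module Semantics (input : ℕ → Maybe Sym) (B : ℕ) where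

  actSem : Act → ℕ → Mem → Bool × Mem
  actSem (say b)   i s = b , s
  actSem inc       i s = true , setR s i (suc (reg s i))
  actSem dec       i s = decR (reg s i) i s
  actSem (same j)  i s = (reg s j ≡ᵇ reg s i) , s
  actSem (symb m)  i s = does (input (reg s i) ≟ᵐ m) , s
  actSem (get a)   i s = arr s a (reg s i) , s
  actSem (put a b) i s = true , setA s a (reg s i) b

  mutual
    -- One bound B serves for the registers that actions visit, hence for the walks of the head, and
    -- for the passes of every loop. The running time is then at most `cost`, a function of the
    -- program and B alone.
    data Exec : Prog → Mem → Bool → Mem → Set where
      exAt    : ∀ {i α s} → reg s i ≤ B → Exec (at i α) s (proj₁ (actSem α i s)) (proj₂ (actSem α i s))
      exTrue  : ∀ {Pr Q R s s₁ b s₂} → Exec Pr s true s₁ → Exec Q s₁ b s₂ → Exec (ite Pr Q R) s b s₂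
      exFalse : ∀ {Pr Q R s s₁ b s₂} → Exec Pr s false s₁ → Exec R s₁ b s₂ → Exec (ite Pr Q R) s b s₂
      exWhile : ∀ {C D s s′ n} → n ≤ B → ExecW C D n s s′ → Exec (while C D) s true s′

    data ExecW (C D : Prog) : ℕ → Mem → Mem → Set where
      stop : ∀ {s s′} → Exec C s false s′ → ExecW C D 0 s s′
      more : ∀ {s s₁ b s₂ s₃ n} → Exec C s true s₁ → Exec D s₁ b s₂ → ExecW C D n s₂ s₃ → ExecW C D (suc n) s s₃

actIndex : Act → ℕ
actIndex (same j)  = suc j
actIndex (get a)   = suc a
actIndex (put a b) = suc a
actIndex _         = 0

indices : Prog → ℕ
indices (at i α)    = suc i ⊔ actIndex α
indices (ite Pr Q R) = indices Pr ⊔ (indices Q ⊔ indices R)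
indices (while C D) = indices C ⊔ indices D

-- Seeking position x takes x steps. The longest action, `inc`, then spends one step on lifting the
-- mark, one on setting it at x + 1, x + 1 on going home and one on leaving. A loop of at most B
-- passes tests its condition once more, which gives `suc B`.
cost : Prog → ℕ → ℕ
cost (at i α)    B = B + B + 4
cost (ite Pr Q R) B = cost Pr B + (cost Q B + cost R B)
cost (while C D) B = suc B * (cost C B + cost D B)

-- Compilation of programs to tape machines

bit : ∀ {K} → Vec Bool K → ℕ → Bool
bit []      i       = false
bit (b ∷ v) zero    = b
bit (b ∷ v) (suc i) = bit v i

setBit : ∀ {K} → Vec Bool K → ℕ → Bool → Vec Bool K
setBit []      i       c = []
setBit (b ∷ v) zero    c = c ∷ v
setBit (b ∷ v) (suc i) c = b ∷ setBit v i c

bit-set-same : ∀ {K} (v : Vec Bool K) {i} c → i < K → bit (setBit v i c) i ≡ c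
bit-set-same (b ∷ v) {zero}  c _       = refl
bit-set-same (b ∷ v) {suc i} c (s≤s p) = bit-set-same v c p

bit-set-other : ∀ {K} (v : Vec Bool K) {i j} c → j ≢ i → bit (setBit v i c) j ≡ bit v j
bit-set-other []      c h = refl
bit-set-other (b ∷ v) {zero}  {zero}  c h = contradiction refl h
bit-set-other (b ∷ v) {zero}  {suc j} c h = refl
bit-set-other (b ∷ v) {suc i} {zero}  c h = refl
bit-set-other (b ∷ v) {suc i} {suc j} c h = bit-set-other v c (h ∘ cong suc)

bit-set : ∀ {K} (v : Vec Bool K) {i} c j → i < K → bit (setBit v i c) j ≡ upd (bit v) i c j
bit-set v {i} c j i<K with j ≡ᵇ i | ≡ᵇ-reflects j i
... | _ | ofʸ refl = bit-set-same v c i<K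
... | _ | ofⁿ j≢i = bit-set-other v c j≢i

if-true : ∀ {A : Set} {x y : A} {c} → c ≡ true → (if c then x else y) ≡ x
if-true refl = refl

if-false : ∀ {A : Set} {x y : A} {c} → c ≡ false → (if c then x else y) ≡ y
if-false refl = refl

-- Register i is the track marks i, with a single mark at the position that is its value.
record Cell (K : ℕ) : Set where
  constructor cell
  field
    home   : Bool
    symbol : Maybe Sym
    marks  : Vec Bool K
    arrs   : Vec Bool K
open Cell

finite-Cell : ∀ K → Finite (Cell K)
finite-Cell K = finite-retract
  (finite-× finite-Bool (finite-× (finite-Maybe finite-Sym) (finite-× (finite-Vec finite-Bool K) (finite-Vec finite-Bool K))))
  (λ (cell h s m a) → h , s , m , a) (λ (h , s , m , a) → cell h s m a) (λ _ → refl)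

-- Every action starts and ends on the home cell: the head runs right to the mark (`seek`), may set
-- the mark on a neighbouring cell (`drop`), and returns with the result (`back`). Programs can
-- therefore be chained by gluing states.
data Phase : Set where
  seek drop : Phase
  back      : Bool → Phase

finite-Phase : Finite Phase
finite-Phase = finite-retract (finite-⊎ finite-Bool finite-Bool)
  (λ { seek → inj₁ true ; drop → inj₁ false ; (back b) → inj₂ b })
  [ (λ { true → seek ; false → drop }) , back ]
  (λ { seek → refl ; drop → refl ; (back b) → refl })

St : Prog → Set
St (at i α)    = Phase
St (ite Pr Q R) = St Pr ⊎ (St Q ⊎ St R)
St (while C D) = St C ⊎ St D

finite-St : ∀ Pr → Finite (St Pr)
finite-St (at i α)    = finite-Phase
finite-St (ite Pr Q R) = finite-⊎ (finite-St Pr) (finite-⊎ (finite-St Q) (finite-St R))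
finite-St (while C D) = finite-⊎ (finite-St C) (finite-St D)

entry : ∀ Pr → St Pr
entry (at i α)    = seek
entry (ite Pr Q R) = inj₁ (entry Pr)
entry (while C D) = inj₁ (entry C)

module Compile (K : ℕ) where

  mark : ℕ → Bool → Cell K → Cell K
  mark i b g = cell (home g) (symbol g) (setBit (marks g) i b) (arrs g)

  arrive : Act → ℕ → Cell K → Phase × Cell K × Move
  arrive (say b)   i g = back b , g , mS
  arrive inc       i g = drop , mark i false g , mR
  arrive dec       i g = if home g then (back false , g , mS) else (drop , mark i false g , mL)
  arrive (same j)  i g = back (bit (marks g) j) , g , mS
  arrive (symb m)  i g = back (does (symbol g ≟ᵐ m)) , g , mS
  arrive (get a)   i g = back (bit (arrs g) a) , g , mS
  arrive (put a b) i g = back true , cell (home g) (symbol g) (marks g) (setBit (arrs g) a b) , mS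

  -- e embeds the states of Pr into those of the whole machine, k gives the states after Pr.
  delta : ∀ Pr {S : Set} → (St Pr → S) → (Bool → S) → St Pr → Cell K → S × Cell K × Move
  delta (at i α) e k seek     g =
    if bit (marks g) i then (e (proj₁ (arrive α i g)) , proj₂ (arrive α i g)) else (e seek , g , mR)
  delta (at i α) e k drop     g = e (back true) , mark i true g , mS
  delta (at i α) e k (back b) g = if home g then (k b , g , mS) else (e (back b) , g , mL)
  delta (ite Pr Q R) e k (inj₁ s) g =
    delta Pr (e ∘ inj₁) (λ b → if b then e (inj₂ (inj₁ (entry Q))) else e (inj₂ (inj₂ (entry R)))) s g
  delta (ite Pr Q R) e k (inj₂ (inj₁ s)) g = delta Q (e ∘ inj₂ ∘ inj₁) k s g
  delta (ite Pr Q R) e k (inj₂ (inj₂ s)) g = delta R (e ∘ inj₂ ∘ inj₂) k s g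
  delta (while C D) e k (inj₁ s) g =
    delta C (e ∘ inj₁) (λ b → if b then e (inj₂ (entry D)) else k true) s g
  delta (while C D) e k (inj₂ s) g = delta D (e ∘ inj₂) (λ _ → e (inj₁ (entry C))) s g

  -- Correctness and running time of the compiled programs

  module Correct (input : ℕ → Maybe Sym) (B : ℕ) {S : Set} (δ : S → Cell K → S × Cell K × Move) where
    open Semantics input B
    open Functional δ

    -- The marks are described by an arbitrary function rather than by a memory: between lifting and
    -- setting its mark, a register has no value.
    record CellIs (g : Cell K) (j : ℕ) (mf af : ℕ → ℕ → Bool) : Set where
      constructor cellIs
      field
        isHome   : home g ≡ (j ≡ᵇ 0)
        isSymbol : symbol g ≡ input j
        isMarks  : ∀ i → i < K → bit (marks g) i ≡ mf i j
        isArrs   : ∀ a → a < K → bit (arrs g) a ≡ af a j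
    open CellIs

    Tape : (ℕ → Cell K) → (mf af : ℕ → ℕ → Bool) → Set
    Tape τ mf af = ∀ j → CellIs (τ j) j mf af

    marksOf : (ℕ → ℕ) → ℕ → ℕ → Bool
    marksOf r i j = r i ≡ᵇ j

    TapeOfMem : (ℕ → Cell K) → Mem → Set
    TapeOfMem τ s = Tape τ (marksOf (reg s)) (arr s)

    tape-upd : ∀ {τ mf af mf′ af′ p g} → Tape τ mf af → CellIs g p mf′ af′ →
               (∀ i j → j ≢ p → mf′ i j ≡ mf i j) →
               (∀ a j → j ≢ p → af′ a j ≡ af a j) →
               Tape (upd τ p g) mf′ af′
    tape-upd {p = p} T c hm ha j with j ≡ᵇ p | ≡ᵇ-reflects j p
    ... | _ | ofʸ refl = c
    ... | _ | ofⁿ j≢p = cellIs (isHome (T j)) (isSymbol (T j))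
      (λ i i<K → trans (isMarks (T j) i i<K) (sym (hm i j j≢p)))
      (λ a a<K → trans (isArrs (T j) a a<K) (sym (ha a j j≢p)))

    tape-same : ∀ {τ mf af} p → Tape τ mf af → Tape (upd τ p (τ p)) mf af
    tape-same p T = tape-upd T (T p) (λ _ _ _ → refl) (λ _ _ _ → refl)

    fstep-≡ : ∀ {s p τ s′ g m} → δ s (τ p) ≡ (s′ , g , m) → fstep (s , p , τ) ≡ (s′ , moveTo m p , upd τ p g)
    fstep-≡ {s} {p} {τ} h with δ s (τ p) | h
    ... | _ | refl = refl

    Reach : FConf → ℕ → S → ℕ → ((ℕ → Cell K) → Set) → Set
    Reach c n s p Q = Σ ℕ λ t → Σ (ℕ → Cell K) λ τ → t ≤ n × frun t c ≡ (s , p , τ) × Q τ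

    reach-refl : ∀ {s p τ Q} → Q τ → Reach (s , p , τ) 0 s p Q
    reach-refl q = 0 , _ , z≤n , refl , q

    reach-step : ∀ {s p τ s′ g m n s″ p″ Q} → δ s (τ p) ≡ (s′ , g , m) →
                 Reach (s′ , moveTo m p , upd τ p g) n s″ p″ Q → Reach (s , p , τ) (suc n) s″ p″ Q
    reach-step {s} {p} {τ} h (t , τ′ , t≤n , r , q) =
      suc t , τ′ , s≤s t≤n , trans (cong (frun t) (fstep-≡ {s} {p} {τ} h)) r , q

    reach-trans : ∀ {c n₁ n₂ s p s′ p′ Q Q′} → Reach c n₁ s p Q →
                  (∀ τ → Q τ → Reach (s , p , τ) n₂ s′ p′ Q′) → Reach c (n₁ + n₂) s′ p′ Q′
    reach-trans {c} (t₁ , τ₁ , l₁ , r₁ , q₁) k with k τ₁ q₁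
    ... | t₂ , τ₂ , l₂ , r₂ , q₂ =
      t₁ + t₂ , τ₂ , +-mono-≤ l₁ l₂ , trans (frun-+ t₁ t₂ c) (trans (cong (frun t₂) r₁) r₂) , q₂

    reach-≤ : ∀ {c n n′ s p Q} → n ≤ n′ → Reach c n s p Q → Reach c n′ s p Q
    reach-≤ n≤n′ (t , τ , l , r) = t , τ , ≤-trans l n≤n′ , r

    -- The program is treated as part of an arbitrary machine with transition function `δ`, so that
    -- the induction reaches subprograms whose exits `k` lead into other parts of the same machine.
    Contains : ∀ Pr → (St Pr → S) → (Bool → S) → Set
    Contains Pr e k = ∀ s g → δ (e s) g ≡ delta Pr e k s g

    ≡ᵇ-false : ∀ {m n} → m ≢ n → (m ≡ᵇ n) ≡ false
    ≡ᵇ-false {m} {n} h with m ≡ᵇ n | ≡ᵇ-reflects m n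
    ... | _ | ofʸ p = contradiction p h
    ... | _ | ofⁿ _ = refl

    ≡ᵇ-refl : ∀ m → (m ≡ᵇ m) ≡ true
    ≡ᵇ-refl m = reflects-intro (≡ᵇ-reflects m m) refl

    module _ {i α} {e : Phase → S} {k : Bool → S} (i<K : i < K) (con : Contains (at i α) e k) where

      back-run : ∀ b p {τ mf af} → Tape τ mf af →
                 Reach (e (back b) , p , τ) (suc p) (k b) 0 (λ τ′ → Tape τ′ mf af)
      back-run b zero {τ} T = reach-step
        (trans (con (back b) (τ 0)) (if-true (isHome (T 0))))
        (reach-refl (tape-same 0 T))
      back-run b (suc p) {τ} T = reach-step
        (trans (con (back b) (τ (suc p))) (if-false (isHome (T (suc p)))))
        (back-run b p (tape-same (suc p) T))

      seek-run : ∀ d p {x τ mf af} → Tape τ mf af → (∀ j → mf i j ≡ (x ≡ᵇ j)) → p + d ≡ x →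
                 Reach (e seek , p , τ) d (e seek) x (λ τ′ → Tape τ′ mf af)
      seek-run zero p T h q = subst (λ x → Reach _ 0 _ x _) (trans (sym (+-identityʳ p)) q) (reach-refl T)
      seek-run (suc d) p {x} {τ} T h q = reach-step
        (trans (con seek (τ p)) (if-false
          (trans (isMarks (T p) i i<K) (trans (h p) (≡ᵇ-false λ x≡p →
            <⇒≢ (≤-trans (m<m+n p (s≤s z≤n)) (≤-reflexive q)) (sym x≡p))))))
        (seek-run d (suc p) (tape-same p T) h (trans (sym (+-suc p d)) q))

      marksOff : (ℕ → ℕ) → ℕ → ℕ → Bool
      marksOff r i′ j = if i′ ≡ᵇ i then false else marksOf r i′ j

      off-tape : ∀ s {τ} p → reg s i ≡ p → TapeOfMem τ s →
                 Tape (upd τ p (mark i false (τ p))) (marksOff (reg s)) (arr s)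
      off-tape s {τ} p r T = tape-upd T
        (cellIs (isHome (T p)) (isSymbol (T p))
          (λ i′ l → trans (bit-set (marks (τ p)) false i′ i<K) (cong (λ b → if i′ ≡ᵇ i then false else b) (isMarks (T p) i′ l)))
          (isArrs (T p)))
        (λ i′ j j≢p → lem i′ j j≢p)
        (λ _ _ _ → refl)
        where
          lem : ∀ i′ j → j ≢ p → marksOff (reg s) i′ j ≡ marksOf (reg s) i′ j
          lem i′ j j≢p with i′ ≡ᵇ i | ≡ᵇ-reflects i′ i
          ... | _ | ofʸ refl = sym (≡ᵇ-false λ q → j≢p (trans (sym q) r))
          ... | _ | ofⁿ _    = refl

      drop-run : ∀ s {τ} p → Tape τ (marksOff (reg s)) (arr s) →
                 Reach (e drop , p , τ) (suc (suc p)) (k true) 0 (λ τ′ → TapeOfMem τ′ (setR s i p))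
      drop-run s {τ} p T = reach-step (con drop (τ p)) (back-run true p (tape-upd T
        (cellIs (isHome (T p)) (isSymbol (T p))
          (λ i′ l → trans (bit-set (marks (τ p)) true i′ i<K) (here-lem i′ l))
          (isArrs (T p)))
        off-lem
        (λ _ _ _ → refl)))
        where
          here-lem : ∀ i′ → i′ < K → upd (bit (marks (τ p))) i true i′ ≡ (upd (reg s) i p i′ ≡ᵇ p)
          here-lem i′ l with i′ ≡ᵇ i in eq₁
          ... | true  = sym (≡ᵇ-refl p)
          ... | false = trans (isMarks (T p) i′ l) (cong (λ b → if b then false else marksOf (reg s) i′ p) eq₁)
          off-lem : ∀ i′ j → j ≢ p → marksOf (upd (reg s) i p) i′ j ≡ marksOff (reg s) i′ j
          off-lem i′ j j≢p with i′ ≡ᵇ i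
          ... | true  = ≡ᵇ-false (j≢p ∘ sym)
          ... | false = refl

      seek-cost : ∀ {x} → x ≤ B → x + suc (suc (suc (suc x))) ≤ B + B + 4
      seek-cost {x} x≤B = ≤-trans (≤-reflexive (solve x))
        (+-monoˡ-≤ 4 (+-mono-≤ x≤B x≤B))
        where
          solve : ∀ x → x + suc (suc (suc (suc x))) ≡ x + x + 4
          solve = solve-∀

      arrive-run : actIndex α ≤ K → ∀ s {τ} → TapeOfMem τ s →
                   Reach (e seek , reg s i , τ) (suc (suc (suc (suc (reg s i))))) (k (proj₁ (actSem α i s))) 0
                         (λ τ′ → TapeOfMem τ′ (proj₂ (actSem α i s)))
      arrive-run a≤K s {τ} T = go α a≤K refl
        where
          x = reg s i
          arrived : ∀ α′ → α′ ≡ α → δ (e seek) (τ x) ≡ (e (proj₁ (arrive α′ i (τ x))) , proj₂ (arrive α′ i (τ x)))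
          arrived α′ refl = trans (con seek (τ x)) (if-true
            (trans (isMarks (T x) i i<K) (≡ᵇ-refl x)))
          quiet : ∀ {b b′} → δ (e seek) (τ x) ≡ (e (back b) , τ x , mS) → b ≡ b′ →
                  Reach (e seek , x , τ) (suc (suc (suc (suc x)))) (k b′) 0 (λ τ′ → TapeOfMem τ′ s)
          quiet {b} h refl = reach-≤ (s≤s (s≤s (≤-trans (n≤1+n x) (n≤1+n _)))) (reach-step h (back-run b x (tape-same x T)))
          stepDec : Bool → S × Cell K × Move
          stepDec h = let a = if h then (back false , τ x , mS) else (drop , mark i false (τ x) , mL) in e (proj₁ a) , proj₂ a
          go-dec : dec ≡ α → ∀ y → x ≡ y →
                   Reach (e seek , x , τ) (suc (suc (suc (suc x)))) (k (proj₁ (decR y i s))) 0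
                         (λ τ′ → TapeOfMem τ′ (proj₂ (decR y i s)))
          go-dec q zero r = quiet (trans (arrived dec q) (cong stepDec (trans (isHome (T x)) (cong (_≡ᵇ 0) r)))) refl
          go-dec q (suc y) r = reach-≤ (s≤s (s≤s (s≤s (≤-trans (≤-trans (n≤1+n y) (≤-reflexive (sym r))) (n≤1+n x)))))
            (reach-step (trans (arrived dec q) (cong stepDec (trans (isHome (T x)) (cong (_≡ᵇ 0) r))))
              (subst (λ z → Reach (e drop , pred z , upd τ x (mark i false (τ x))) (suc (suc y)) (k true) 0 (λ τ′ → TapeOfMem τ′ (setR s i y)))
                (sym r) (drop-run s y (off-tape s x refl T))))
          go : ∀ α′ → actIndex α′ ≤ K → α′ ≡ α →
               Reach (e seek , x , τ) (suc (suc (suc (suc x)))) (k (proj₁ (actSem α′ i s))) 0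
                     (λ τ′ → TapeOfMem τ′ (proj₂ (actSem α′ i s)))
          go (say b)  l q = quiet (arrived (say b) q) refl
          go inc      l q = reach-step (arrived inc q) (drop-run s (suc x) (off-tape s x refl T))
          go dec      l q = go-dec q x refl
          go (same j)  l q = quiet (arrived (same j) q) (isMarks (T x) j l)
          go (symb m)  l q = quiet (arrived (symb m) q) (cong (λ c → does (c ≟ᵐ m)) (isSymbol (T x)))
          go (get a)   l q = quiet (arrived (get a) q) (isArrs (T x) a l)
          go (put a b) l q = reach-≤ (s≤s (s≤s (≤-trans (n≤1+n x) (n≤1+n _))))
            (reach-step (arrived (put a b) q) (back-run true x (tape-upd T
              (cellIs (isHome (T x)) (isSymbol (T x)) (isMarks (T x))
                (λ a′ l′ → trans (bit-set (arrs (τ x)) b a′ l) (here-lem a′ l′)))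
              (λ _ _ _ → refl)
              off-lem)))
            where
              here-lem : ∀ a′ → a′ < K → upd (bit (arrs (τ x))) a b a′ ≡ upd (arr s) a (upd (arr s a) x b) a′ x
              here-lem a′ l′ with a′ ≡ᵇ a
              ... | true  = sym (upd-same (arr s a) x b)
              ... | false = isArrs (T x) a′ l′
              off-lem : ∀ a′ j → j ≢ x → upd (arr s) a (upd (arr s a) x b) a′ j ≡ arr s a′ j
              off-lem a′ j j≢x with a′ ≡ᵇ a | ≡ᵇ-reflects a′ a
              ... | _ | ofʸ refl = upd-other (arr s a) x b j≢x
              ... | _ | ofⁿ _    = refl

    mutual
      exec-run : ∀ {Pr s b s′} (e : St Pr → S) (k : Bool → S) → Contains Pr e k → indices Pr ≤ K → Exec Pr s b s′ →
                 ∀ {τ} → TapeOfMem τ s → Reach (e (entry Pr) , 0 , τ) (cost Pr B) (k b) 0 (λ τ′ → TapeOfMem τ′ s′)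
      exec-run e k con l (exAt {i} {α} {s} r≤B) T =
        reach-≤ (seek-cost {i} {α} {e} {k} i<K con r≤B)
          (reach-trans (seek-run {α = α} {k = k} i<K con (reg s i) 0 T (λ j → refl) refl)
            λ τ T′ → arrive-run {α = α} i<K con (≤-trans (m≤n⊔m (suc i) (actIndex α)) l) s T′)
        where i<K = ≤-trans (m≤m⊔n (suc i) (actIndex α)) l
      exec-run e k con l (exTrue {Pr} {Q} {R} x y) T =
        reach-≤ (+-monoʳ-≤ (cost Pr B) (m≤m+n (cost Q B) (cost R B)))
          (reach-trans (exec-run (e ∘ inj₁) _ (λ s g → con (inj₁ s) g) (m⊔n≤o⇒m≤o (indices Pr) _ l) x T)
            λ τ T′ → exec-run (e ∘ inj₂ ∘ inj₁) k (λ s g → con (inj₂ (inj₁ s)) g)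
              (m⊔n≤o⇒m≤o (indices Q) _ (m⊔n≤o⇒n≤o (indices Pr) _ l)) y T′)
      exec-run e k con l (exFalse {Pr} {Q} {R} x y) T =
        reach-≤ (+-monoʳ-≤ (cost Pr B) (m≤n+m (cost R B) (cost Q B)))
          (reach-trans (exec-run (e ∘ inj₁) _ (λ s g → con (inj₁ s) g) (m⊔n≤o⇒m≤o (indices Pr) _ l) x T)
            λ τ T′ → exec-run (e ∘ inj₂ ∘ inj₂) k (λ s g → con (inj₂ (inj₂ s)) g)
              (m⊔n≤o⇒n≤o (indices Q) _ (m⊔n≤o⇒n≤o (indices Pr) _ l)) y T′)
      exec-run e k con l (exWhile {C} {D} n≤B w) T =
        reach-≤ (*-monoˡ-≤ (cost C B + cost D B) (s≤s n≤B)) (execW-run e k con l w T)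

      execW-run : ∀ {C D n s s′} (e : St (while C D) → S) (k : Bool → S) → Contains (while C D) e k →
                  indices (while C D) ≤ K → ExecW C D n s s′ → ∀ {τ} → TapeOfMem τ s →
                  Reach (e (inj₁ (entry C)) , 0 , τ) (suc n * (cost C B + cost D B)) (k true) 0 (λ τ′ → TapeOfMem τ′ s′)
      execW-run {C} {D} e k con l (stop x) T =
        reach-≤ (≤-trans (m≤m+n (cost C B) (cost D B)) (m≤m+n _ 0))
          (exec-run (e ∘ inj₁) _ (λ s g → con (inj₁ s) g) (m⊔n≤o⇒m≤o (indices C) _ l) x T)
      execW-run {C} {D} e k con l (more {n = n} x y z) T =
        reach-≤ (≤-reflexive (sym (+-assoc (cost C B) (cost D B) (suc n * (cost C B + cost D B)))))
          (reach-trans (exec-run (e ∘ inj₁) _ (λ s g → con (inj₁ s) g) (m⊔n≤o⇒m≤o (indices C) _ l) x T)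
            λ τ₁ T₁ → reach-trans (exec-run (e ∘ inj₂) _ (λ s g → con (inj₂ s) g) (m⊔n≤o⇒n≤o (indices C) _ l) y T₁)
              λ τ₂ T₂ → execW-run e k con l z T₂)

-- Polynomial bounds

-- A single power with base at least 2: products add exponents, and a sum costs one more factor of
-- the base, which absorbs the 2. The base is positive even at n = 0, so powers grow with the
-- exponent.
PolyBounded : (ℕ → ℕ) → Set
PolyBounded f = Σ ℕ λ c → Σ ℕ λ d → ∀ n → f n ≤ (n + suc (suc c)) ^ d

^-mono : ∀ {m n} .{{_ : NonZero n}} {a b} → m ≤ n → a ≤ b → m ^ a ≤ n ^ b
^-mono {m} {n} {a} m≤n a≤b = ≤-trans (^-monoˡ-≤ a m≤n) (^-monoʳ-≤ n a≤b)

^-distribʳ-* : ∀ d m n → (m * n) ^ d ≡ m ^ d * n ^ d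
^-distribʳ-* zero    m n = refl
^-distribʳ-* (suc d) m n = trans (cong (m * n *_) (^-distribʳ-* d m n)) ([m*n]*[o*p]≡[m*o]*[n*p] m n (m ^ d) (n ^ d))

private
  nonZero-+suc : ∀ n c → NonZero (n + suc c)
  nonZero-+suc n c = >-nonZero (≤-trans (s≤s z≤n) (m≤n+m (suc c) n))

  weaken : ∀ n c c′ {a b} → c ≤ c′ → a ≤ b → (n + suc (suc c)) ^ a ≤ (n + suc (suc c′)) ^ b
  weaken n c c′ c≤c′ a≤b = ^-mono {{nonZero-+suc n (suc c′)}} (+-monoʳ-≤ n (s≤s (s≤s c≤c′))) a≤b

polyBounded-≤ : ∀ {f g} → (∀ n → f n ≤ g n) → PolyBounded g → PolyBounded f
polyBounded-≤ f≤g (c , d , h) = c , d , λ n → ≤-trans (f≤g n) (h n)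

polyBounded-* : ∀ {f g} → PolyBounded f → PolyBounded g → PolyBounded (λ n → f n * g n)
polyBounded-* (c₁ , d₁ , h₁) (c₂ , d₂ , h₂) = c₁ + c₂ , d₁ + d₂ , λ n →
  ≤-trans (*-mono-≤ (≤-trans (h₁ n) (weaken n c₁ _ (m≤m+n c₁ c₂) (≤-refl {d₁})))
                    (≤-trans (h₂ n) (weaken n c₂ _ (m≤n+m c₂ c₁) (≤-refl {d₂}))))
          (≤-reflexive (sym (^-distribˡ-+-* (n + suc (suc (c₁ + c₂))) d₁ d₂)))

polyBounded-+ : ∀ {f g} → PolyBounded f → PolyBounded g → PolyBounded (λ n → f n + g n)
polyBounded-+ {f} {g} (c₁ , d₁ , h₁) (c₂ , d₂ , h₂) = c₁ + c₂ , suc (d₁ + d₂) , λ n →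
  let X = n + suc (suc (c₁ + c₂)) in begin
  f n + g n                           ≤⟨ +-mono-≤ (≤-trans (h₁ n) (weaken n c₁ _ (m≤m+n c₁ c₂) (m≤m+n d₁ d₂)))
                                                  (≤-trans (h₂ n) (weaken n c₂ _ (m≤n+m c₂ c₁) (m≤n+m d₂ d₁))) ⟩
  X ^ (d₁ + d₂) + X ^ (d₁ + d₂)       ≡⟨ cong (X ^ (d₁ + d₂) +_) (+-identityʳ _) ⟨
  2 * X ^ (d₁ + d₂)                   ≤⟨ *-monoˡ-≤ (X ^ (d₁ + d₂)) (≤-trans (s≤s (s≤s z≤n)) (m≤n+m (suc (suc (c₁ + c₂))) n)) ⟩
  X * X ^ (d₁ + d₂)                   ∎
  where open ≤-Reasoning

polyBounded-const : ∀ k → PolyBounded (λ _ → k)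
polyBounded-const k = k , 1 , λ n → ≤-trans (≤-trans (n≤1+n k) (≤-trans (n≤1+n _) (m≤n+m _ n)))
                                           (≤-reflexive (sym (*-identityʳ _)))

polyBounded-cost : ∀ Pr {B} → PolyBounded B → PolyBounded (λ n → cost Pr (B n))
polyBounded-cost (at i α)    h = polyBounded-+ (polyBounded-+ h h) (polyBounded-const 4)
polyBounded-cost (ite p q r) h = polyBounded-+ (polyBounded-cost p h) (polyBounded-+ (polyBounded-cost q h) (polyBounded-cost r h))
polyBounded-cost (while c d) h = polyBounded-* (polyBounded-+ (polyBounded-const 1) h)
                                   (polyBounded-+ (polyBounded-cost c h) (polyBounded-cost d h))

-- For positive n the base n + c + 2 is at most (c + 3) n; the value at n = 0 is covered by the
-- additive constant of `poly`.
polyBounded⇒poly : ∀ {f} → PolyBounded f → Σ ℕ λ c → Σ ℕ λ d → ∀ n → f n ≤ poly c d n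
polyBounded⇒poly {f} (c , d , h) = c′ ^ d , d , λ n → ≤-trans (h n) (bound n)
  where
    c′ = suc (suc (suc c))
    bound : ∀ n → (n + suc (suc c)) ^ d ≤ poly (c′ ^ d) d n
    bound zero    = ≤-trans (^-monoˡ-≤ d (n≤1+n (suc (suc c)))) (m≤n+m (c′ ^ d) _)
    bound (suc n) = ≤-trans (^-monoˡ-≤ d(+-monoʳ-≤ (suc n) (m≤m*n (suc (suc c)) (suc n))))
      (≤-trans (≤-reflexive (^-distribʳ-* d c′ (suc n))) (m≤m+n _ _))

-- From programs to Turing machines

inputOf : Str → ℕ → Maybe Sym
inputOf w = nth nothing (map just w)

initMem : Mem
initMem = mem (λ _ → 0) (λ _ _ → false)

Ctl : Prog → Set
Ctl Pr = ⊤ ⊎ (Bool ⊎ St Pr)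

finite-Ctl : ∀ Pr → Finite (Ctl Pr)
finite-Ctl Pr = finite-⊎ finite-⊤ (finite-⊎ finite-Bool (finite-St Pr))

module MachineFor (Pr : Prog) (FQ : Finite (Ctl Pr)) (FG : Finite (Cell (indices Pr))) where
  K = indices Pr
  open Compile K

  pattern boot     = inj₁ tt
  pattern halt b   = inj₂ (inj₁ b)
  pattern inside s = inj₂ (inj₂ s)

  inPr : St Pr → Ctl Pr
  inPr s = inside s

  halted : Bool → Ctl Pr
  halted b = halt b

  blankCell : Cell K
  blankCell = cell false nothing (Vec.replicate K false) (Vec.replicate K false)

  inputCell : Sym → Cell K
  inputCell s = cell false (just s) (Vec.replicate K false) (Vec.replicate K false)

  -- The input symbols carry neither a home flag nor marks, so the boot step writes them: cell 0
  -- becomes home and receives the mark of every register, which is the memory `initMem`.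
  δC : Ctl Pr → Cell K → Ctl Pr × Cell K × Move
  δC boot       g = inPr (entry Pr) , cell true (Cell.symbol g) (Vec.replicate K true) (Cell.arrs g) , mS
  δC (halt b)   g = halted b , g , mS
  δC (inside s) g = delta Pr inPr halted s g

  private
    module Q = Finite FQ
    module G = Finite FG

  recode : Ctl Pr × Cell K × Move → Fin Q.size × Fin G.size × Move
  recode (s , g , m) = Q.code s , G.code g , m

  machine : TM
  machine = record
    { nQ = Q.size ; nG = G.size
    ; start = Q.code boot ; acc = Q.code (halted true) ; rej = Q.code (halted false)
    ; acc≢rej = λ p → contradiction (Q.code-injective p) λ ()
    ; blank = G.code blankCell ; inp = G.code ∘ inputCell
    ; δ = λ q g → recode (δC (Q.decode q) (G.decode g)) }

  open TapeOf machine

  private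
    δ̂-sim : ∀ s g → proj₁ (δ̂ (Q.code s) g) ≡ Q.code (proj₁ (δC s (G.decode g))) ×
                    G.decode (proj₁ (proj₂ (δ̂ (Q.code s) g))) ≡ proj₁ (proj₂ (δC s (G.decode g))) ×
                    proj₂ (proj₂ (δ̂ (Q.code s) g)) ≡ proj₂ (proj₂ (δC s (G.decode g)))
    δ̂-sim s g with Q.code s Fin.≟ Q.code (halted true) | Q.code s Fin.≟ Q.code (halted false)
    ... | yes p | _     rewrite Q.code-injective p = refl , refl , refl
    ... | no _  | yes p rewrite Q.code-injective p = refl , refl , refl
    ... | no _  | no _  rewrite Q.decode-code s = refl , G.decode-code _ , refl

    bit-true : ∀ {n} i → i < n → bit (Vec.replicate n true) i ≡ true
    bit-true {suc n} zero    _       = refl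
    bit-true {suc n} (suc i) (s≤s p) = bit-true i p

    bit-false : ∀ n i → bit (Vec.replicate n false) i ≡ false
    bit-false zero    i       = refl
    bit-false (suc n) zero    = refl
    bit-false (suc n) (suc i) = bit-false n i

    τ₀ : Str → ℕ → Cell K
    τ₀ w = nth blankCell (map inputCell w)

    decode-τ₀ : ∀ w → G.decode ∘ nth (G.code blankCell) (map (G.code ∘ inputCell) w) ≗ τ₀ w
    decode-τ₀ []      i       = G.decode-code _
    decode-τ₀ (x ∷ w) zero    = G.decode-code _
    decode-τ₀ (x ∷ w) (suc i) = decode-τ₀ w i

    symbol-τ₀ : ∀ w i → Cell.symbol (τ₀ w i) ≡ inputOf w i
    symbol-τ₀ []      i       = refl
    symbol-τ₀ (x ∷ w) zero    = refl
    symbol-τ₀ (x ∷ w) (suc i) = symbol-τ₀ w i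

    home-τ₀ : ∀ w i → Cell.home (τ₀ w i) ≡ false
    home-τ₀ []      i       = refl
    home-τ₀ (x ∷ w) zero    = refl
    home-τ₀ (x ∷ w) (suc i) = home-τ₀ w i

    marks-τ₀ : ∀ w i → Cell.marks (τ₀ w i) ≡ Vec.replicate K false
    marks-τ₀ []      i       = refl
    marks-τ₀ (x ∷ w) zero    = refl
    marks-τ₀ (x ∷ w) (suc i) = marks-τ₀ w i

    arrs-τ₀ : ∀ w i → Cell.arrs (τ₀ w i) ≡ Vec.replicate K false
    arrs-τ₀ []      i       = refl
    arrs-τ₀ (x ∷ w) zero    = refl
    arrs-τ₀ (x ∷ w) (suc i) = arrs-τ₀ w i

  module _ (w : Str) (B : ℕ) where
    open Semantics (inputOf w) B
    private
      module R = Functional δC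
      module C = Correct (inputOf w) B δC
      module X = Transfer δC δ̂ Q.code G.decode δ̂-sim

    booted : C.TapeOfMem (upd (τ₀ w) 0 (proj₁ (proj₂ (δC boot (τ₀ w 0))))) initMem
    booted zero    = C.cellIs refl (symbol-τ₀ w 0) (λ i l → bit-true i l)
      (λ a l → trans (cong (λ v → bit v a) (arrs-τ₀ w 0)) (bit-false K a))
    booted (suc j) = C.cellIs (home-τ₀ w (suc j)) (symbol-τ₀ w (suc j))
      (λ i l → trans (cong (λ v → bit v i) (marks-τ₀ w (suc j))) (bit-false K i))
      (λ a l → trans (cong (λ v → bit v a) (arrs-τ₀ w (suc j))) (bit-false K a))

    machine-correct : ∀ {b s′} → Exec Pr initMem b s′ → ∀ {T} → suc (cost Pr B) ≤ T →
                      stateAfter machine T w ≡ (if b then TM.acc machine else TM.rej machine)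
    machine-correct {b} run₀ {T} l with C.exec-run inPr halted (λ s g → refl) ≤-refl run₀ booted
    ... | t , τ , t≤ , r , _ = trans (stateAfter-mono {suc t} w (≤-trans (s≤s t≤) l) (subst (Halted machine) (sym final) (isHalted b))) (trans final (byCases b))
      where
        final : proj₁ (frun (suc t) (finit w)) ≡ Q.code (halted b)
        final = trans (X.transfer (suc t) boot 0 (decode-τ₀ w)) (cong (Q.code ∘ proj₁) r)
        isHalted : ∀ b → Halted machine (Q.code (halted b))
        isHalted true  = inj₁ refl
        isHalted false = inj₂ refl
        byCases : ∀ b → Q.code (halted b) ≡ (if b then TM.acc machine else TM.rej machine)
        byCases true  = refl
        byCases false = refl

turingMachine : ∀ Pr {bound} → PolyBounded bound →
  Σ TM λ M → Σ ℕ λ pc → Σ ℕ λ pd → ∀ w {b s′} → Semantics.Exec (inputOf w) (bound (length w)) Pr initMem b s′ →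
    stateAfter M (poly pc pd (length w)) w ≡ (if b then TM.acc M else TM.rej M)
turingMachine Pr {bound} h with polyBounded⇒poly (polyBounded-+ (polyBounded-const 1) (polyBounded-cost Pr h))
... | pc , pd , le = machine , pc , pd , λ w run₀ → machine-correct w (bound (length w)) run₀ (le (length w))
  where open MachineFor Pr (finite-Ctl Pr) (finite-Cell (indices Pr))

-- A program logic

seq : Prog → Prog → Prog
seq p q = ite p q q

notP : Prog → Prog
notP p = ite p (at 0 (say false)) (at 0 (say true))

zeroP : ℕ → Prog
zeroP x = while (at x dec) (at 0 (say true))

-- z is a scratch register
addP : (d e z : ℕ) → Prog
addP d e z = seq (zeroP z) (while (notP (at z (same e))) (seq (at z inc) (at d inc)))

-- Horner's scheme: the code of the tail is built in register `suc f`, multiplied by N through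
-- repeated addition of register 0, and the first digit is added; `suc (suc f)` is scratch.
encP : ∀ {r} → ℕ → Vec ℕ r → Prog
encP f []       = zeroP f
encP f (t ∷ ts) = seq (encP (suc f) ts) (seq (zeroP f)
  (seq (while (at (suc f) dec) (addP f 0 (suc (suc f)))) (addP f t (suc (suc f)))))

-- Counting up until one of the two values is hit turns register f into their minimum; the first
-- value is the smaller one exactly if this minimum differs from the second.
ltP : (f i j : ℕ) → Prog
ltP f i j = seq (zeroP f)
  (seq (while (ite (at f (same i)) (at 0 (say false)) (notP (at f (same j)))) (at f inc))
       (notP (at f (same j))))

forP : (x lim : ℕ) → Prog → Prog
forP x lim p = seq (zeroP x) (while (notP (at x (same lim))) (seq p (at x inc)))

-- The order is descending, so that the outer loops of `forAllP`, which run over the more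
-- significant digits, own the lower registers.
regsFrom : ℕ → (r : ℕ) → Vec ℕ r
regsFrom f zero    = []
regsFrom f (suc r) = f + r ∷ regsFrom f r

-- The first entry is the innermost loop. Tuples are thus visited in the order of `enc`, and the
-- code of the current tuple is the number of those already treated.
forAllP : ∀ {r} → Vec ℕ r → ℕ → Prog → Prog
forAllP []       lim p = p
forAllP (y ∷ ys) lim p = forAllP ys lim (forP y lim p)

-- Frame conditions and total correctness of the basic programs

SameArr : Mem → Mem → Set
SameArr s s′ = ∀ a j → arr s′ a j ≡ arr s a j

KeepR : ℕ → Mem → Mem → Set
KeepR f s s′ = ∀ i → i < f → reg s′ i ≡ reg s i

-- `Keep f` suits programs that treat all registers from f on as scratch; `Only₂` suits the loops
-- inside them, whose invariants need to know exactly which registers change.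
record Keep (f : ℕ) (s s′ : Mem) : Set where
  constructor keep
  field
    keepR : KeepR f s s′
    keepA : SameArr s s′
open Keep public

record Only₂ (x y : ℕ) (s s′ : Mem) : Set where
  constructor only
  field
    otherR : ∀ {i} → i ≢ x → i ≢ y → reg s′ i ≡ reg s i
    sameA  : SameArr s s′
open Only₂ public

Only : ℕ → Mem → Mem → Set
Only x = Only₂ x x

off : ∀ {x s s′} → Only x s s′ → ∀ {i} → i ≢ x → reg s′ i ≡ reg s i
off o i≢x = otherR o i≢x i≢x

keep-refl : ∀ {f s} → Keep f s s
keep-refl = keep (λ _ _ → refl) (λ _ _ → refl)

keep-trans : ∀ {f s₁ s₂ s₃} → Keep f s₁ s₂ → Keep f s₂ s₃ → Keep f s₁ s₃
keep-trans h k = keep (λ i l → trans (keepR k i l) (keepR h i l)) (λ a j → trans (keepA k a j) (keepA h a j))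

keep-≤ : ∀ {f g s s′} → f ≤ g → Keep g s s′ → Keep f s s′
keep-≤ f≤g h = keep (λ i l → keepR h i (≤-trans l f≤g)) (keepA h)

only-refl : ∀ {x y s} → Only₂ x y s s
only-refl = only (λ _ _ → refl) (λ _ _ → refl)

only-trans : ∀ {x y s₁ s₂ s₃} → Only₂ x y s₁ s₂ → Only₂ x y s₂ s₃ → Only₂ x y s₁ s₃
only-trans h k = only (λ p q → trans (otherR k p q) (otherR h p q)) (λ a j → trans (sameA k a j) (sameA h a j))

only-setR : ∀ {x y} s v → Only₂ x y s (setR s x v)
only-setR {x} s v = only (λ i≢x _ → upd-other (reg s) x v i≢x) (λ _ _ → refl)

only-setR₂ : ∀ {x y} s v → Only₂ x y s (setR s y v)
only-setR₂ {x} {y} s v = only (λ _ i≢y → upd-other (reg s) y v i≢y) (λ _ _ → refl)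

only-widenʳ : ∀ {x y s s′} → Only y s s′ → Only₂ x y s s′
only-widenʳ h = only (λ _ q → otherR h q q) (sameA h)

only⇒keep : ∀ {f x y s s′} → f ≤ x → f ≤ y → Only₂ x y s s′ → Keep f s s′
only⇒keep f≤x f≤y h = keep (λ i l → otherR h (<⇒≢ (≤-trans l f≤x)) (<⇒≢ (≤-trans l f≤y))) (sameA h)

if-intro : ∀ {A C : Set} {b} → b ≡ true → A → if b then A else C
if-intro refl a = a

module Hoare (input : ℕ → Maybe Sym) (B : ℕ) where
  open Semantics input B

  Bounded : Mem → Set
  Bounded s = ∀ i → reg s i ≤ B

  -- Total correctness; the invariant that every register is at most B is passed along implicitly.
  Tri : Prog → Mem → (Bool → Mem → Set) → Set
  Tri p s Φ = Bounded s → Σ Bool λ b → Σ Mem λ s′ → Exec p s b s′ × Bounded s′ × Φ b s′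

  tri-map : ∀ {p s Φ Ψ} → (∀ {b s′} → Φ b s′ → Ψ b s′) → Tri p s Φ → Tri p s Ψ
  tri-map f t bd with t bd
  ... | b , s′ , x , bd′ , φ = b , s′ , x , bd′ , f φ

  tri-ite : ∀ {p q r s Φ Ψ} → Tri p s Φ → (∀ s′ → Φ true s′ → Tri q s′ Ψ) →
            (∀ s′ → Φ false s′ → Tri r s′ Ψ) → Tri (ite p q r) s Ψ
  tri-ite t f g bd with t bd
  ... | true  , s₁ , x , bd₁ , φ with f s₁ φ bd₁
  ...   | b , s₂ , y , bd₂ , ψ = b , s₂ , exTrue x y , bd₂ , ψ
  tri-ite t f g bd | false , s₁ , x , bd₁ , φ with g s₁ φ bd₁
  ...   | b , s₂ , y , bd₂ , ψ = b , s₂ , exFalse x y , bd₂ , ψ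

  tri-seq : ∀ {p q s Φ Ψ} → Tri p s Φ → (∀ b s′ → Φ b s′ → Tri q s′ Ψ) → Tri (seq p q) s Ψ
  tri-seq t f = tri-ite t (f true) (f false)

  -- The index n bounds the passes still to come. A test that succeeds must exhibit a predecessor of
  -- n, so termination and the bound on passes demanded by `exWhile` come from the same argument.
  tri-while : ∀ {c d} (I : ℕ → Mem → Set) {J : Mem → Set} →
    (∀ n s → I n s → Tri c s (λ b s₁ → if b then (Σ ℕ λ m → n ≡ suc m × Tri d s₁ (λ _ → I m)) else J s₁)) →
    ∀ {n s} → n ≤ B → I n s → Tri (while c d) s (λ _ → J)
  tri-while {c} {d} I {J} h n≤B i bd with loop _ _ i bd
    where
      loop : ∀ n s → I n s → Bounded s → Σ ℕ λ m → m ≤ n × Σ Mem λ s′ → ExecW c d m s s′ × Bounded s′ × J s′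
      loop n s i bd with h n s i bd
      ... | false , s₁ , x , bd₁ , j = 0 , z≤n , s₁ , stop x , bd₁ , j
      loop zero    s i bd | true , s₁ , x , bd₁ , _ , () , _
      loop (suc n) s i bd | true , s₁ , x , bd₁ , .n , refl , t with t bd₁
      ... | b , s₂ , y , bd₂ , i₂ with loop n s₂ i₂ bd₂
      ... | m , m≤n , s₃ , z , bd₃ , j = suc m , s≤s m≤n , s₃ , more x y z , bd₃ , j
  ... | m , m≤n , s′ , z , bd′ , j = true , s′ , exWhile (≤-trans m≤n n≤B) z , bd′ , j

  tri-say : ∀ {b s Φ} → Φ b s → Tri (at 0 (say b)) s Φ
  tri-say φ bd = _ , _ , exAt (bd 0) , bd , φ

  tri-same : ∀ {i j s Φ} → Φ (reg s j ≡ᵇ reg s i) s → Tri (at i (same j)) s Φ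
  tri-same {i} φ bd = _ , _ , exAt (bd i) , bd , φ

  tri-symb : ∀ {i m s Φ} → Φ (does (input (reg s i) ≟ᵐ m)) s → Tri (at i (symb m)) s Φ
  tri-symb {i} φ bd = _ , _ , exAt (bd i) , bd , φ

  tri-get : ∀ {i a s Φ} → Φ (arr s a (reg s i)) s → Tri (at i (get a)) s Φ
  tri-get {i} φ bd = _ , _ , exAt (bd i) , bd , φ

  tri-put : ∀ {i a b s Φ} → Φ true (setA s a (reg s i) b) → Tri (at i (put a b)) s Φ
  tri-put {i} φ bd = _ , _ , exAt (bd i) , bd , φ

  bounded-setR : ∀ s {v} i → Bounded s → v ≤ B → Bounded (setR s i v)
  bounded-setR s i bd v≤B j with j ≡ᵇ i
  ... | true  = v≤B
  ... | false = bd j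

  tri-inc : ∀ {i s Φ} → suc (reg s i) ≤ B → Φ true (setR s i (suc (reg s i))) → Tri (at i inc) s Φ
  tri-inc {i} {s} l φ bd = _ , _ , exAt (bd i) , bounded-setR s i bd l , φ

  tri-dec : ∀ {i s Φ} → (reg s i ≡ 0 → Φ false s) → (∀ n → reg s i ≡ suc n → Φ true (setR s i n)) → Tri (at i dec) s Φ
  tri-dec {i} {s} {Φ} h k bd with lem (reg s i) refl
    where
      lem : ∀ n → reg s i ≡ n → Bounded (proj₂ (decR n i s)) × Φ (proj₁ (decR n i s)) (proj₂ (decR n i s))
      lem zero    q = bd , h q
      lem (suc n) q = bounded-setR s i bd (≤-trans (≤-trans (n≤1+n n) (≤-reflexive (sym q))) (bd i)) , k n q
  ... | bd′ , φ = _ , _ , exAt (bd i) , bd′ , φ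

  tri-not : ∀ {p s Φ} → Tri p s (λ b → Φ (not b)) → Tri (notP p) s Φ
  tri-not t = tri-ite t (λ _ → tri-say) (λ _ → tri-say)

  tri-bounded : ∀ {p s Φ} → (Bounded s → Tri p s Φ) → Tri p s Φ
  tri-bounded f bd = f bd bd

  tri-zero : ∀ x {s} → Tri (zeroP x) s (λ _ s′ → reg s′ x ≡ 0 × Only x s s′)
  tri-zero x {s} = tri-bounded λ bd → tri-while (λ n s₁ → reg s₁ x ≡ n × Only x s s₁)
    (λ n s₁ (r , o) → tri-dec (λ q → q , o)
      λ m q → m , trans (sym r) q , tri-say (upd-same (reg s₁) x m , only-trans o (only-setR s₁ m)))
    (bd x) (refl , only-refl)

  -- With n passes to come, z + n stays equal to the value of e and d + n to the final sum; at n = 0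
  -- the second equation is the result.
  tri-add : ∀ {d e z s} → d ≢ e → d ≢ z → e ≢ z → reg s d + reg s e ≤ B →
            Tri (addP d e z) s (λ _ s′ → reg s′ d ≡ reg s d + reg s e × Only₂ d z s s′)
  tri-add {d} {e} {z} {s} d≢e d≢z e≢z l = tri-seq (tri-zero z) λ _ s₀ (z0 , o₀) → tri-bounded λ bd →
    tri-while (λ n s₁ → reg s₁ z + n ≡ reg s e × reg s₁ d + n ≡ reg s d + reg s e × Only₂ d z s s₁)
      (λ n s₁ (pz , pd , o) → tri-not (tri-same (pass n s₁ pz pd o)))
      (subst (_≤ B) (off o₀ e≢z) (bd e))
      (cong (_+ reg s e) z0 , cong (_+ reg s e) (off o₀ d≢z) , only-widenʳ o₀)
    where
      pass : ∀ n s₁ → reg s₁ z + n ≡ reg s e → reg s₁ d + n ≡ reg s d + reg s e → Only₂ d z s s₁ →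
        if not (reg s₁ e ≡ᵇ reg s₁ z)
        then (Σ ℕ λ m → n ≡ suc m × Tri (seq (at z inc) (at d inc)) s₁
               (λ _ s₂ → reg s₂ z + m ≡ reg s e × reg s₂ d + m ≡ reg s d + reg s e × Only₂ d z s s₂))
        else (reg s₁ d ≡ reg s d + reg s e × Only₂ d z s s₁)
      pass n s₁ pz pd o with reg s₁ e ≡ᵇ reg s₁ z | ≡ᵇ-reflects (reg s₁ e) (reg s₁ z)
      pass zero    s₁ pz pd o | _ | ofʸ q = trans (sym (+-identityʳ _)) pd , o
      pass (suc n) s₁ pz pd o | _ | ofʸ q = contradiction
        (trans (sym (otherR o (d≢e ∘ sym) e≢z)) q) (λ h → <⇒≢ (≤-trans (m<m+n (reg s₁ z) (s≤s z≤n)) (≤-reflexive pz)) (sym h))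
      pass zero    s₁ pz pd o | _ | ofⁿ ¬q = contradiction
        (trans (otherR o (d≢e ∘ sym) e≢z) (trans (sym pz) (+-identityʳ _))) ¬q
      pass (suc n) s₁ pz pd o | _ | ofⁿ ¬q = n , refl ,
        tri-bounded λ bd → tri-seq (tri-inc {s = s₁} {Φ = λ b s₂ → b ≡ true × s₂ ≡ setR s₁ z (suc (reg s₁ z))} (≤-trans (≤-trans (s≤s (m≤m+n _ n)) (≤-reflexive (trans (sym (+-suc _ n)) pz)))
                                (subst (_≤ B) (otherR o (d≢e ∘ sym) e≢z) (bd e))) (refl , refl))
        λ { _ _ (refl , refl) → tri-inc
              (subst (λ v → suc v ≤ B) (sym (upd-other (reg s₁) z _ d≢z)) (≤-trans (≤-trans (s≤s (m≤m+n _ n)) (≤-reflexive (trans (sym (+-suc _ n)) pd))) l))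
              ( trans (cong (_+ n) (trans (upd-other (upd (reg s₁) z (suc (reg s₁ z))) d _ (d≢z ∘ sym)) (upd-same (reg s₁) z _))) (trans (sym (+-suc _ n)) pz)
              , trans (cong (_+ n) (trans (upd-same (upd (reg s₁) z (suc (reg s₁ z))) d _) (cong suc (upd-other (reg s₁) z _ d≢z)))) (trans (sym (+-suc _ n)) pd)
              , only-trans o (only-trans (only-setR₂ s₁ _) (only-setR _ _))) }

  tri-lt : ∀ {f i j s} → i < f → j < f → Tri (ltP f i j) s (λ b s′ → b ≡ (reg s i <ᵇ reg s j) × Keep f s s′)
  tri-lt {f} {i} {j} {s} i<f j<f = tri-seq (tri-zero f) λ _ s₀ (z0 , o₀) → tri-bounded λ bd →
    tri-seq (tri-while (λ n s₁ → reg s₁ f + n ≡ m × Only f s s₁) loop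
              (≤-trans (m⊓n≤m (reg s i) (reg s j)) (subst (_≤ B) (off o₀ (<⇒≢ i<f)) (bd i)))
              (cong (_+ m) z0 , o₀))
      λ _ s₁ (q , o) → tri-not (tri-same (final s₁ q o , only⇒keep ≤-refl ≤-refl o))
    where
      m = reg s i ⊓ reg s j
      regi : ∀ {s₁} → Only f s s₁ → reg s₁ i ≡ reg s i
      regi o = off o (<⇒≢ i<f)
      regj : ∀ {s₁} → Only f s s₁ → reg s₁ j ≡ reg s j
      regj o = off o (<⇒≢ j<f)
      final : ∀ s₁ → reg s₁ f ≡ m → Only f s s₁ → not (reg s₁ j ≡ᵇ reg s₁ f) ≡ (reg s i <ᵇ reg s j)
      final s₁ q o = det (reflects-⇔ (λ ¬e → ≰⇒> λ j≤i → ¬e (trans (regj o) (sym (trans q (m≥n⇒m⊓n≡n j≤i)))))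
                            (λ i<j e → <⇒≢ i<j (trans (sym (m≤n⇒m⊓n≡m (<⇒≤ i<j))) (trans (sym q) (trans (sym e) (regj o)))))
                            (¬-reflects (≡ᵇ-reflects (reg s₁ j) (reg s₁ f))))
                         (<ᵇ-reflects (reg s i) (reg s j))
      loop : ∀ n s₁ → reg s₁ f + n ≡ m × Only f s s₁ →
             Tri (ite (at f (same i)) (at 0 (say false)) (notP (at f (same j)))) s₁
               (λ b s₂ → if b then (Σ ℕ λ k → n ≡ suc k × Tri (at f inc) s₂ (λ _ s₃ → reg s₃ f + k ≡ m × Only f s s₃))
                         else (reg s₂ f ≡ m × Only f s s₂))
      loop zero s₁ (q , o) with reg s₁ i ≡ᵇ reg s₁ f in e₁
      ... | true = tri-ite (tri-same {Φ = λ b s₂ → b ≡ true × s₂ ≡ s₁} (e₁ , refl))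
                     (λ { _ (_ , refl) → tri-say (trans (sym (+-identityʳ _)) q , o) }) (λ { _ (() , _) })
      ... | false = tri-ite (tri-same {Φ = λ b s₂ → b ≡ false × s₂ ≡ s₁} (e₁ , refl)) (λ { _ (() , _) })
                     (λ { _ (_ , refl) → tri-not (tri-same (sameJ refl)) })
        where
          q′ = trans (sym (+-identityʳ _)) q
          sameJ : ∀ {b} → b ≡ (reg s₁ j ≡ᵇ reg s₁ f) → if not b
                  then (Σ ℕ λ k → 0 ≡ suc k × Tri (at f inc) s₁ (λ _ s₃ → reg s₃ f + k ≡ m × Only f s s₃))
                  else (reg s₁ f ≡ m × Only f s s₁)
          sameJ {true}  _  = q′ , o
          sameJ {false} e₂ with ⊓-sel (reg s i) (reg s j)
          ... | inj₁ h = contradiction (trans (sym e₁) (reflects-intro (≡ᵇ-reflects _ _) (trans (regi o) (sym (trans q′ h))))) λ ()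
          ... | inj₂ h = contradiction (trans e₂ (reflects-intro (≡ᵇ-reflects _ _) (trans (regj o) (sym (trans q′ h))))) λ ()
      loop (suc n) s₁ (q , o) = tri-ite (tri-same {Φ = λ b s₂ → b ≡ false × s₂ ≡ s₁} (ne (m⊓n≤m _ _) (regi o) , refl)) (λ { _ (() , _) })
                     (λ { _ (_ , refl) → tri-not (tri-same (if-intro (cong not (ne (m⊓n≤n _ _) (regj o)))
                       (n , refl , tri-bounded λ bd → tri-inc (≤-trans f<m (≤-trans (m⊓n≤m _ _) (subst (_≤ B) (regi o) (bd i))))
                          (trans (cong (_+ n) (upd-same (reg s₁) f _)) (trans (sym (+-suc _ n)) q) , only-trans o (only-setR s₁ _))))) })
        where
          f<m : reg s₁ f < m
          f<m = ≤-trans (m<m+n (reg s₁ f) (s≤s z≤n)) (≤-reflexive q)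
          ne : ∀ {x y} → m ≤ y → x ≡ y → (x ≡ᵇ reg s₁ f) ≡ false
          ne {x} {y} m≤y x≡y with x ≡ᵇ reg s₁ f | ≡ᵇ-reflects x (reg s₁ f)
          ... | _ | ofʸ h = contradiction (≤-trans f<m m≤y) (λ l → <⇒≢ l (trans (sym h) x≡y))
          ... | _ | ofⁿ _ = refl

  tri-for : ∀ {x lim p s L} (I : ℕ → Mem → Set) → x ≢ lim →
            (∀ {j s s′} → Only x s s′ → I j s → I j s′) → reg s lim ≡ L → I 0 s →
            (∀ j s → j < L → I j s → reg s x ≡ j → reg s lim ≡ L →
               Tri p s (λ _ s′ → I (suc j) s′ × reg s′ x ≡ j × reg s′ lim ≡ L)) →
            Tri (forP x lim p) s (λ _ → I L)
  tri-for {x} {lim} {p} {s} {L} I x≢lim stable rl i₀ h =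
    tri-seq (tri-zero x) λ _ s₀ (z0 , o₀) → tri-bounded λ bd →
    tri-while (λ n s₁ → I (reg s₁ x) s₁ × reg s₁ x + n ≡ L × reg s₁ lim ≡ L)
      (λ n s₁ (i , q , r) → tri-not (tri-same (pass n s₁ i q r)))
      (subst (_≤ B) (trans (off o₀ lim≢x) rl) (bd lim))
      (subst (λ v → I v s₀) (sym z0) (stable o₀ i₀) , cong (_+ L) z0 , trans (off o₀ lim≢x) rl)
    where
      lim≢x : lim ≢ x
      lim≢x = x≢lim ∘ sym
      pass : ∀ n s₁ → I (reg s₁ x) s₁ → reg s₁ x + n ≡ L → reg s₁ lim ≡ L →
        if not (reg s₁ lim ≡ᵇ reg s₁ x)
        then (Σ ℕ λ m → n ≡ suc m × Tri (seq p (at x inc)) s₁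
                (λ _ s₂ → I (reg s₂ x) s₂ × reg s₂ x + m ≡ L × reg s₂ lim ≡ L))
        else I L s₁
      pass n s₁ i q r with reg s₁ lim ≡ᵇ reg s₁ x | ≡ᵇ-reflects (reg s₁ lim) (reg s₁ x)
      ... | _ | ofʸ e = subst (λ v → I v s₁) (trans (sym e) r) i
      pass zero    s₁ i q r | _ | ofⁿ ¬e = contradiction (trans r (trans (sym q) (+-identityʳ _))) ¬e
      pass (suc n) s₁ i q r | _ | ofⁿ ¬e = n , refl , tri-seq (h (reg s₁ x) s₁ x<L i refl r)
          λ _ s₂ (i₂ , r₂ , l₂) → tri-bounded λ bd → tri-inc
            (subst (λ v → suc v ≤ B) (sym r₂) (≤-trans x<L (subst (_≤ B) l₂ (bd lim))))
            ( subst (λ v → I v (setR s₂ x (suc (reg s₂ x)))) (sym (trans (upd-same (reg s₂) x _) (cong suc r₂))) (stable (only-setR s₂ _) i₂)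
            , trans (cong (_+ n) (trans (upd-same (reg s₂) x _) (cong suc r₂))) (trans (sym (+-suc _ n)) q)
            , trans (upd-other (reg s₂) x _ lim≢x) l₂)
        where
          x<L : reg s₁ x < L
          x<L = ≤-trans (m<m+n (reg s₁ x) (s≤s z≤n)) (≤-reflexive q)

  record Vals {N r} (f : ℕ) (s : Mem) (ts : Vec ℕ r) (ā : Vec (Fin N) r) : Set where
    constructor vals
    field
      val : ∀ i → Vec.lookup ts i < f × reg s (Vec.lookup ts i) ≡ toℕ (Vec.lookup ā i)
  open Vals public

  vals-keep : ∀ {N r f s s′} {ts : Vec ℕ r} {ā : Vec (Fin N) r} → KeepR f s s′ → Vals f s ts ā → Vals f s′ ts ā
  vals-keep k v = vals λ i → proj₁ (val v i) , trans (k _ (proj₁ (val v i))) (proj₂ (val v i))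

  vals-≤ : ∀ {N r f g s} {ts : Vec ℕ r} {ā : Vec (Fin N) r} → f ≤ g → Vals f s ts ā → Vals g s ts ā
  vals-≤ l v = vals λ i → ≤-trans (proj₁ (val v i)) l , proj₂ (val v i)

  module _ {N : ℕ} where

    -- The bound is demanded for all exponents up to r, because over the empty universe powers do
    -- not grow with the exponent: 0 ^ 0 = 1.
    Fits : ℕ → Set
    Fits r = ∀ {r′} → r′ ≤ r → N ^ r′ ≤ B

    tri-enc : ∀ {r f s} (ts : Vec ℕ r) (ā : Vec (Fin N) r) → Fits r → 0 < f → reg s 0 ≡ N → Vals f s ts ā →
              Tri (encP f ts) s (λ _ s′ → reg s′ f ≡ enc ā × Keep f s s′)
    tri-enc {f = f} [] [] fits 0<f r0 v = tri-map (λ (z , o) → z , only⇒keep ≤-refl ≤-refl o) (tri-zero f)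
    tri-enc {suc r} {f} {s} (t ∷ ts) (a ∷ as) fits 0<f r0 v =
      tri-seq (tri-enc ts as (λ l → fits (≤-trans l (n≤1+n r))) (s≤s z≤n) r0 (vals-≤ (n≤1+n f) (vals (val v ∘ suc))))
      λ _ s₁ (e₁ , k₁) → tri-seq (tri-zero f)
      λ _ s₂ (z₂ , o₂) → tri-bounded λ bd → tri-seq
        (tri-while (λ n s₃ → reg s₃ (suc f) ≡ n × reg s₃ f + N * n ≡ N * E × Keep f s s₃)
          (λ n s₃ (q₁ , q₂ , k₃) → tri-dec (λ q → trans (sym (+-identityʳ _)) (trans (cong (reg s₃ f +_) (sym (trans (cong (N *_) (trans (sym q₁) q)) (*-zeroʳ N)))) q₂) , k₃)
            λ m q → m , trans (sym q₁) q ,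
              let s₄ = setR s₃ (suc f) m
                  rf = upd-other (reg s₃) (suc f) m (1+n≢n ∘ sym)
                  r0₃ = trans (upd-other (reg s₃) (suc f) m (λ ())) (trans (keepR k₃ 0 0<f) r0)
                  q₂′ = trans (trans (+-assoc (reg s₃ f) N (N * m)) (cong (reg s₃ f +_) (trans (sym (*-suc N m)) (cong (N *_) (trans (sym q) q₁))))) q₂ in
              tri-map (λ {b} {s₅} (a₁ , o₅) →
                  trans (otherR o₅ 1+n≢n (1+n≢n ∘ sym)) (upd-same (reg s₃) (suc f) m)
                , trans (cong (_+ N * m) (trans a₁ (cong₂ _+_ rf r0₃))) q₂′
                , keep-trans k₃ (keep-trans (only⇒keep {y = suc f} (n≤1+n f) (n≤1+n f) (only-setR s₃ m))
                    (only⇒keep ≤-refl (≤-trans (n≤1+n f) (n≤1+n _)) o₅)))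
                (tri-add {s = s₄} (<⇒≢ 0<f ∘ sym) (<⇒≢ (n≤1+n _)) (λ ())
                  (≤-trans (≤-reflexive (cong₂ _+_ rf r0₃)) (≤-trans (m≤m+n _ (N * m)) (≤-trans (≤-reflexive q₂′) NE≤B)))))
          (≤-trans (<⇒≤ (enc<N^r as)) (fits (n≤1+n r)))
          (trans (off o₂ 1+n≢n) e₁ , cong (_+ N * E) z₂ , keep-trans (keep-≤ (n≤1+n f) k₁) (only⇒keep ≤-refl ≤-refl o₂)))
      λ _ s₃ (q , k₃) →
        let rt = trans (keepR k₃ t t<f) (proj₂ (val v zero)) in
        tri-map (λ (q′ , o) → trans q′ (trans (cong₂ _+_ q rt) (+-comm (N * E) (toℕ a)))
                            , keep-trans k₃ (only⇒keep ≤-refl (≤-trans (n≤1+n f) (n≤1+n _)) o))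
          (tri-add (<⇒≢ t<f ∘ sym) (<⇒≢ (n≤1+n _)) (<⇒≢ (≤-trans t<f (≤-trans (n≤1+n f) (n≤1+n _))))
            (≤-trans (≤-reflexive (trans (cong₂ _+_ q rt) (+-comm (N * E) (toℕ a)))) (≤-trans (<⇒≤ (enc<N^r (a ∷ as))) (fits ≤-refl))))
      where
        E = enc as
        t<f = proj₁ (val v zero)
        NE≤B : N * E ≤ B
        NE≤B = ≤-trans (m≤n+m (N * E) (toℕ a)) (≤-trans (<⇒≤ (enc<N^r (a ∷ as))) (fits ≤-refl))

  regsFrom-< : ∀ f r i → Vec.lookup (regsFrom f r) i < f + r
  regsFrom-< f (suc r) zero    = ≤-reflexive (sym (+-suc f r))
  regsFrom-< f (suc r) (suc i) = ≤-trans (regsFrom-< f r i) (+-monoʳ-≤ f (n≤1+n r))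

  regsFrom-≥ : ∀ f r i → f ≤ Vec.lookup (regsFrom f r) i
  regsFrom-≥ f (suc r) zero    = m≤m+n f r
  regsFrom-≥ f (suc r) (suc i) = regsFrom-≥ f r i

  KeepIn : ℕ → ℕ → Mem → Mem → Set
  KeepIn f h s s′ = ∀ i → f ≤ i → i < h → reg s′ i ≡ reg s i

  -- The outer loops satisfy the invariant k ↦ I (N * k), because one full run of the innermost loop
  -- leads from N * k to N * suc k through the values j + N * k.
  tri-forAll : ∀ {N} lim r f {p s} (I : ℕ → Mem → Set) → lim < f →
    (∀ {k s s′} → Keep f s s′ → I k s → I k s′) → (∀ {k s} → I k s → reg s lim ≡ N) → I 0 s →
    (∀ (ȳ : Vec (Fin N) r) s → I (enc ȳ) s → Vals (f + r) s (regsFrom f r) ȳ →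
       Tri p s (λ _ s′ → I (suc (enc ȳ)) s′ × KeepIn f (f + r) s s′)) →
    Tri (forAllP (regsFrom f r) lim p) s (λ _ → I (N ^ r))
  tri-forAll lim zero f I lim<f stable rl i₀ h = tri-map proj₁ (h [] _ i₀ (vals λ ()))
  tri-forAll {N} lim (suc r) f {p} {s} I lim<f stable rl i₀ h =
    tri-forAll lim r f (λ k → I (N * k)) lim<f stable rl (subst (λ v → I v s) (sym (*-zeroʳ N)) i₀)
      λ ȳ s i v → tri-map
        (λ {_} {s₂} (i′ , k) → subst (λ v → I v s₂) (sym (*-suc N (enc ȳ))) i′ , k)
        (tri-for (λ j s₁ → I (j + N * enc ȳ) s₁ × KeepIn f (f + r) s s₁) (<⇒≢ (≤-trans lim<f (m≤m+n f r)) ∘ sym)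
          (λ {_} {s₁} {s₂} o (i₁ , k₁) → stable (only⇒keep (m≤m+n f r) (m≤m+n f r) o) i₁
                         , λ i l m → trans (off o (<⇒≢ m)) (k₁ i l m))
          (rl i) (i , λ _ _ _ → refl)
          λ j s₁ j<N (i₁ , k₁) rx rl₁ → tri-map
            (λ {_} {s₂} (i₂ , k₂) → (subst (λ v → I (suc (v + N * enc ȳ)) s₂) (Finₚ.toℕ-fromℕ< j<N) i₂
                           , λ i l m → trans (k₂ i l (≤-trans m (+-monoʳ-≤ f (n≤1+n r)))) (k₁ i l m))
                         , trans (k₂ _ (m≤m+n f r) (≤-reflexive (sym (+-suc f r)))) rx
                         , rl i₂)
            (h (fromℕ< j<N ∷ ȳ) s₁ (subst (λ v → I (v + N * enc ȳ) s₁) (sym (Finₚ.toℕ-fromℕ< j<N)) i₁)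
               (vals λ { zero    → ≤-reflexive (sym (+-suc f r)) , trans rx (sym (Finₚ.toℕ-fromℕ< j<N))
                  ; (suc i) → ≤-trans (proj₁ (val v i)) (+-monoʳ-≤ f (n≤1+n r))
                            , trans (k₁ _ (regsFrom-≥ f r i) (proj₁ (val v i))) (proj₂ (val v i)) })))

-- Model checking by programs

lookupP : ∀ {r} → (f a : ℕ) → Vec ℕ r → Prog
lookupP f a ts = seq (encP f ts) (at f (get a))

writeP : ∀ {r} → (f a : ℕ) → Bool → Vec ℕ r → Prog
writeP f a b ts = seq (encP f ts) (at f (put a b))

fillP : (f r a : ℕ) → Prog → Prog
fillP f r a p = forAllP (regsFrom f r) 0
  (ite p (writeP (f + r) a true (regsFrom f r)) (writeP (f + r) a false (regsFrom f r)))

-- The search stops at the first witness, so register f ends below N exactly if a witness exists.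
exP : ℕ → Prog → Prog
exP f p = seq (zeroP f)
  (seq (while (ite (at f (same 0)) (at 0 (say false)) (notP p)) (at f inc)) (notP (at f (same 0))))

-- Register 0 holds the size of the universe; registers from f on and arrays from g on are free.
evalP : ∀ {n Γ} → (f g : ℕ) → Vec ℕ n → All (λ _ → ℕ) Γ → Formula n Γ → Prog
evalP f g vs as (eq i j)     = at (Vec.lookup vs i) (same (Vec.lookup vs j))
evalP f g vs as (lt i j)     = ltP f (Vec.lookup vs i) (Vec.lookup vs j)
evalP f g vs as (P c i)      = at (Vec.lookup vs i) (symb (just c))
evalP f g vs as (rel p ts)   = lookupP f (All.lookup as p) (Vec.map (Vec.lookup vs) ts)
evalP f g vs as (neg φ)      = notP (evalP f g vs as φ)
evalP f g vs as (conj φ ψ)   = ite (evalP f g vs as φ) (evalP f g vs as ψ) (at 0 (say false))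
evalP f g vs as (ex φ)       = exP f (evalP (suc f) g (f ∷ vs) as φ)
evalP f g vs as (ifp r φ ts) =
  seq (fillP f r g (at 0 (say false)))
  (seq (forAllP (regsFrom f r) 0
         (seq (fillP (f + r) r (suc g)
                (ite (lookupP (f + r + r) g ys) (at 0 (say true))
                     (evalP (f + r + r) (suc (suc g)) (ys Vec.++ vs) (g ∷ as) φ)))
              (fillP (f + r) r g (lookupP (f + r + r) (suc g) ys))))
       (lookupP f g (Vec.map (Vec.lookup vs) ts)))
  where ys = regsFrom (f + r) r

arity : ∀ {n Γ} → Formula n Γ → ℕ
arity (rel {r = r} p ts) = r
arity (neg φ)      = arity φ
arity (conj φ ψ)   = arity φ ⊔ arity ψ
arity (ex φ)       = arity φ
arity (ifp r φ ts) = r ⊔ arity φ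
arity _            = 0

anyᶠ-true : ∀ {n} (F : Fin n → Bool) a → F a ≡ true → anyᶠ F ≡ true
anyᶠ-true F zero    p = cong (_∨ anyᶠ (F ∘ suc)) p
anyᶠ-true F (suc a) p = trans (cong (F zero ∨_) (anyᶠ-true (F ∘ suc) a p)) (Boolₚ.∨-zeroʳ (F zero))

anyᶠ-false : ∀ {n} (F : Fin n → Bool) → (∀ a → F a ≡ false) → anyᶠ F ≡ false
anyᶠ-false {zero}  F h = refl
anyᶠ-false {suc n} F h = cong₂ _∨_ (h zero) (anyᶠ-false (F ∘ suc) (h ∘ suc))

record SameBut (f g a : ℕ) (s s′ : Mem) : Set where
  constructor sameBut
  field
    sbR : KeepR f s s′
    sbA : ∀ a′ → a′ < g → a′ ≢ a → ∀ j → arr s′ a′ j ≡ arr s a′ j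
open SameBut public

record Same (f g : ℕ) (s s′ : Mem) : Set where
  constructor mkSame
  field
    sameR : KeepR f s s′
    sameG : ∀ a → a < g → ∀ j → arr s′ a j ≡ arr s a j
open Same public

same-refl : ∀ {f g s} → Same f g s s
same-refl = mkSame (λ _ _ → refl) (λ _ _ _ → refl)

same-trans : ∀ {f g s₁ s₂ s₃} → Same f g s₁ s₂ → Same f g s₂ s₃ → Same f g s₁ s₃
same-trans h k = mkSame (λ i l → trans (sameR k i l) (sameR h i l))
                        (λ a l j → trans (sameG k a l j) (sameG h a l j))

same-≤ : ∀ {f f′ g g′ s s′} → f ≤ f′ → g ≤ g′ → Same f′ g′ s s′ → Same f g s s′
same-≤ l m h = mkSame (λ i p → sameR h i (≤-trans p l)) (λ a p → sameG h a (≤-trans p m))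

keep⇒same : ∀ {f g s s′} → Keep f s s′ → Same f g s s′
keep⇒same h = mkSame (keepR h) (λ a _ → keepA h a)

sameBut-trans : ∀ {f g a s₁ s₂ s₃} → SameBut f g a s₁ s₂ → SameBut f g a s₂ s₃ → SameBut f g a s₁ s₃
sameBut-trans h k = sameBut (λ i l → trans (sbR k i l) (sbR h i l))
                            (λ a l n j → trans (sbA k a l n j) (sbA h a l n j))

same⇒sameBut : ∀ {f f′ g a s s′} → f ≤ f′ → Same f′ g s s′ → SameBut f g a s s′
same⇒sameBut l h = sameBut (λ i p → sameR h i (≤-trans p l)) (λ a p _ → sameG h a p)

-- Correctness of the model checker

module ModelCheck (u : Str) (input : ℕ → Maybe Sym) (B : ℕ)
                  (input-u : ∀ i → input (toℕ i) ≡ just (List.lookup u i)) where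
  open Hoare input B
  open Sem u using (N)
  open Eval u

  vals-++ : ∀ {f s m n} (ts : Vec ℕ m) (vs : Vec ℕ n) {ā : Vec (Fin N) m} {ρ : Vec (Fin N) n} →
            Vals f s ts ā → Vals f s vs ρ → Vals f s (ts Vec.++ vs) (ā Vec.++ ρ)
  vals-++ []       vs {[]}    v w = w
  vals-++ (t ∷ ts) vs {_ ∷ ā} v w = vals λ
    { zero → val v zero ; (suc i) → val (vals-++ ts vs {ā} (vals (val v ∘ suc)) w) i }

  vals-map : ∀ {f s n r} {vs : Vec ℕ n} {ρ : Vec (Fin N) n} (ts : Vec (Fin n) r) → Vals f s vs ρ →
             Vals f s (Vec.map (Vec.lookup vs) ts) (Vec.map (Vec.lookup ρ) ts)
  vals-map []       v = vals λ ()
  vals-map (t ∷ ts) v = vals λ { zero → val v t ; (suc i) → val (vals-map ts v) i }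

  tri-lookup : ∀ {r f a s} (ts : Vec ℕ r) (ā : Vec (Fin N) r) → Fits {N} r → 0 < f → reg s 0 ≡ N → Vals f s ts ā →
               Tri (lookupP f a ts) s (λ b s′ → b ≡ arr s a (enc ā) × Keep f s s′)
  tri-lookup {f = f} {a} {s} ts ā fits 0<f r0 v = tri-seq (tri-enc ts ā fits 0<f r0 v)
    λ _ s₁ (q , k) → tri-get (trans (keepA k a (reg s₁ f)) (cong (arr s a) q) , k)

  tri-write : ∀ {r f a b s} (ts : Vec ℕ r) (ā : Vec (Fin N) r) → Fits {N} r → 0 < f → reg s 0 ≡ N → Vals f s ts ā →
              Tri (writeP f a b ts) s (λ _ s′ → KeepR f s s′ × arr s′ a (enc ā) ≡ b ×
                (∀ a′ j → a′ ≢ a ⊎ j ≢ enc ā → arr s′ a′ j ≡ arr s a′ j))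
  tri-write {f = f} {a} {b} {s} ts ā fits 0<f r0 v = tri-seq (tri-enc ts ā fits 0<f r0 v)
    λ _ s₁ (q , k) → tri-put
      ( keepR k
      , trans (cong (λ h → h (enc ā)) (upd-same (arr s₁) a _)) (trans (cong (λ j → upd (arr s₁ a) j b (enc ā)) q) (upd-same (arr s₁ a) (enc ā) b))
      , λ a′ j ne → trans (elsewhere s₁ q a′ j ne) (keepA k a′ j))
    where
      elsewhere : ∀ s₁ → reg s₁ f ≡ enc ā → ∀ a′ j → a′ ≢ a ⊎ j ≢ enc ā →
                  upd (arr s₁) a (upd (arr s₁ a) (reg s₁ f) b) a′ j ≡ arr s₁ a′ j
      elsewhere s₁ q a′ j (inj₁ ne) = cong (λ h → h j) (upd-other (arr s₁) a _ ne)
      elsewhere s₁ q a′ j (inj₂ ne) with a′ ≡ᵇ a | ≡ᵇ-reflects a′ a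
      ... | _ | ofʸ refl = upd-other (arr s₁ a) (reg s₁ f) b (λ h → ne (trans h q))
      ... | _ | ofⁿ _    = refl

  -- As tuples come in the order of `enc`, the invariant says that all entries with smaller codes
  -- are right; injectivity of `enc` protects them from later writes.
  tri-fill : ∀ {r f g a p s₀} (F : Vec (Fin N) r → Bool) → Fits {N} r → 0 < f → reg s₀ 0 ≡ N →
             (∀ ȳ s → SameBut f g a s₀ s → Vals (f + r) s (regsFrom f r) ȳ →
                Tri p s (λ b s′ → b ≡ F ȳ × Same (f + r) g s s′)) → a < g →
             Tri (fillP f r a p) s₀ (λ _ s′ → SameBut f g a s₀ s′ × (∀ ā → arr s′ a (enc ā) ≡ F ā))
  tri-fill {r} {f} {g} {a} {p} {s₀} F fits 0<f r0 h a<g = tri-map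
    (λ (sb , q) → sb , λ ā → q ā (enc<N^r ā))
    (tri-forAll 0 r f I 0<f
      (λ k (sb , q) → sameBut-trans sb (same⇒sameBut ≤-refl (keep⇒same k)) , λ ā l → trans (keepA k a _) (q ā l))
      (λ (sb , q) → trans (sbR sb 0 0<f) r0)
      (sameBut (λ _ _ → refl) (λ _ _ _ _ → refl) , λ ā ())
      λ ȳ s (sb , q) v →
        tri-ite (h ȳ s sb v) (λ s₁ (e , sm) → write ȳ s s₁ true sb q v e sm)
                             (λ s₁ (e , sm) → write ȳ s s₁ false sb q v e sm))
    where
      I : ℕ → Mem → Set
      I k s = SameBut f g a s₀ s × (∀ ā → enc ā < k → arr s a (enc ā) ≡ F ā)
      write : ∀ ȳ s s₁ b → SameBut f g a s₀ s → (∀ ā → enc ā < enc ȳ → arr s a (enc ā) ≡ F ā) →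
              Vals (f + r) s (regsFrom f r) ȳ → b ≡ F ȳ → Same (f + r) g s s₁ →
              Tri (writeP (f + r) a b (regsFrom f r)) s₁ (λ _ s′ → I (suc (enc ȳ)) s′ × KeepIn f (f + r) s s′)
      write ȳ s s₁ b sb q v e sm = tri-map
        (λ {_} {s′} (kr , here≡ , there≡) →
            ( sameBut-trans sb (sameBut-trans (same⇒sameBut (m≤m+n f r) sm)
                (sameBut (λ i l → kr i (≤-trans l (m≤m+n f r))) (λ a′ _ ne j → there≡ a′ j (inj₁ ne))))
            , λ ā l → filled s′ here≡ there≡ ā l)
            , λ i _ l → trans (kr i l) (sameR sm i l))
        (tri-write (regsFrom f r) ȳ fits (≤-trans 0<f (m≤m+n f r))
          (trans (sameR sm 0 (≤-trans 0<f (m≤m+n f r))) (trans (sbR sb 0 0<f) r0))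
          (vals-keep (sameR sm) v))
        where
          filled : ∀ s′ → arr s′ a (enc ȳ) ≡ b → (∀ a′ j → a′ ≢ a ⊎ j ≢ enc ȳ → arr s′ a′ j ≡ arr s₁ a′ j) →
                   ∀ ā → enc ā < suc (enc ȳ) → arr s′ a (enc ā) ≡ F ā
          filled s′ here≡ there≡ ā l with enc ā ≟ enc ȳ
          ... | yes eq₁ with enc-injective ā ȳ eq₁
          ...   | refl = trans here≡ e
          filled s′ here≡ there≡ ā (s≤s l) | no ne =
            trans (there≡ a (enc ā) (inj₂ ne)) (trans (sameG sm a a<g (enc ā)) (q ā (≤∧≢⇒< l ne)))

  record Ctx {n Γ} (f g : ℕ) (vs : Vec ℕ n) (as : All (λ _ → ℕ) Γ) (ρ : Vec (Fin N) n) (e : EnvB N Γ) (s : Mem) : Set where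
    constructor ctx
    field
      size≡ : reg s 0 ≡ N
      vars≡ : Vals f s vs ρ
      rels≡ : ∀ {r} (p : r ∈ Γ) (ā : Vec (Fin N) r) →
              All.lookup as p < g × arr s (All.lookup as p) (enc ā) ≡ All.lookup e p ā
  open Ctx

  ctx-same : ∀ {n Γ f g s s′ as e} {vs : Vec ℕ n} {ρ} → 0 < f → Same f g s s′ →
             Ctx {n} {Γ} f g vs as ρ e s → Ctx f g vs as ρ e s′
  ctx-same 0<f h c = ctx (trans (sameR h 0 0<f) (size≡ c)) (vals-keep (sameR h) (vars≡ c))
    λ p ā → let (l , q) = rels≡ c p ā in l , trans (sameG h _ l _) q

  tri-ex : ∀ {f g p s} (F : Fin N → Bool) → 0 < f → reg s 0 ≡ N →
           (∀ a s₁ → Same f g s s₁ → reg s₁ f ≡ toℕ a → Tri p s₁ (λ b s′ → b ≡ F a × Same (suc f) g s₁ s′)) →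
           Tri (exP f p) s (λ b s′ → b ≡ anyᶠ F × Same f g s s′)
  tri-ex {f} {g} {p} {s} F 0<f r0 h =
    tri-seq (tri-zero f) λ _ s₀ (z0 , o₀) → tri-bounded λ bd →
    tri-seq (tri-while (λ n s₁ → reg s₁ f + n ≡ N × Same f g s s₁ × (∀ a → toℕ a < reg s₁ f → F a ≡ false)) loop
              (subst (_≤ B) (trans (off o₀ (<⇒≢ 0<f)) r0) (bd 0))
              (cong (_+ N) z0 , keep⇒same (only⇒keep ≤-refl ≤-refl o₀) , λ a l → contradiction (subst (toℕ a <_) z0 l) λ ()))
      λ _ s₁ (sm , out) → tri-not (tri-same (final s₁ sm out , sm))
    where
      Out : Mem → Set
      Out s₁ = (reg s₁ f ≡ N × (∀ a → F a ≡ false)) ⊎ (Σ (Fin N) λ a → reg s₁ f ≡ toℕ a × F a ≡ true)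
      final : ∀ s₁ → Same f g s s₁ → Out s₁ → not (reg s₁ 0 ≡ᵇ reg s₁ f) ≡ anyᶠ F
      final s₁ sm (inj₁ (q , none)) = trans (cong not (reflects-intro (≡ᵇ-reflects _ _) (trans (sameR sm 0 0<f) (trans r0 (sym q)))))
                                            (sym (anyᶠ-false F none))
      final s₁ sm (inj₂ (a , q , yes!)) with reg s₁ 0 ≡ᵇ reg s₁ f | ≡ᵇ-reflects (reg s₁ 0) (reg s₁ f)
      ... | _ | ofʸ e = contradiction (trans (sym q) (trans (sym e) (trans (sameR sm 0 0<f) r0))) (<⇒≢ (Finₚ.toℕ<n a))
      ... | _ | ofⁿ _ = sym (anyᶠ-true F a yes!)
      loop : ∀ n s₁ → reg s₁ f + n ≡ N × Same f g s s₁ × (∀ a → toℕ a < reg s₁ f → F a ≡ false) →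
             Tri (ite (at f (same 0)) (at 0 (say false)) (notP p)) s₁ (λ b s₂ →
               if b then (Σ ℕ λ m → n ≡ suc m × Tri (at f inc) s₂ (λ _ s₃ →
                           reg s₃ f + m ≡ N × Same f g s s₃ × (∀ a → toℕ a < reg s₃ f → F a ≡ false)))
               else (Same f g s s₂ × Out s₂))
      loop n s₁ (q , sm , none) = tri-ite (tri-same {Φ = λ b s₂ → b ≡ (reg s₁ 0 ≡ᵇ reg s₁ f) × s₂ ≡ s₁} (refl , refl))
        (λ { _ (e , refl) → tri-say (sm , inj₁ (atEnd (reflects-true (≡ᵇ-reflects _ _) (sym e)))) })
        (λ { _ (e , refl) → next n q (λ h → contradiction (trans e (reflects-intro (≡ᵇ-reflects _ _) h)) λ ()) })
        where
          r0₁ = trans (sameR sm 0 0<f) r0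
          atEnd : reg s₁ 0 ≡ reg s₁ f → reg s₁ f ≡ N × (∀ a → F a ≡ false)
          atEnd e = trans (sym e) r0₁ , λ a → none a (subst (toℕ a <_) (trans (sym r0₁) e) (Finₚ.toℕ<n a))
          next : ∀ n → reg s₁ f + n ≡ N → reg s₁ 0 ≢ reg s₁ f → Tri (notP p) s₁ (λ b s₂ →
               if b then (Σ ℕ λ m → n ≡ suc m × Tri (at f inc) s₂ (λ _ s₃ →
                           reg s₃ f + m ≡ N × Same f g s s₃ × (∀ a → toℕ a < reg s₃ f → F a ≡ false)))
               else (Same f g s s₂ × Out s₂))
          next zero    q ne = contradiction (trans r0₁ (trans (sym q) (+-identityʳ _))) ne
          next (suc m) q ne = tri-not (tri-map (λ {b} {s₂} (e , sm₂) → branch b s₂ e sm₂)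
                                (h a s₁ sm (sym (Finₚ.toℕ-fromℕ< f<N))))
            where
              f<N : reg s₁ f < N
              f<N = ≤-trans (m<m+n (reg s₁ f) (s≤s z≤n)) (≤-reflexive q)
              a = fromℕ< f<N
              branch : ∀ b s₂ → b ≡ F a → Same (suc f) g s₁ s₂ →
                if not b then (Σ ℕ λ k → suc m ≡ suc k × Tri (at f inc) s₂ (λ _ s₃ →
                                reg s₃ f + k ≡ N × Same f g s s₃ × (∀ a → toℕ a < reg s₃ f → F a ≡ false)))
                else (Same f g s s₂ × Out s₂)
              branch true  s₂ e sm₂ = same-trans sm (same-≤ (n≤1+n f) ≤-refl sm₂) ,
                inj₂ (a , trans (sameR sm₂ f ≤-refl) (sym (Finₚ.toℕ-fromℕ< f<N)) , sym e)
              branch false s₂ e sm₂ = m , refl , tri-bounded λ bd → tri-inc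
                (≤-trans (≤-trans (≤-reflexive (cong suc rf)) f<N) (subst (_≤ B) (trans (sameR sm₂ 0 (s≤s z≤n)) r0₁) (bd 0)))
                ( trans (cong (_+ m) (trans (upd-same (reg s₂) f _) (cong suc rf))) (trans (sym (+-suc _ m)) q)
                , same-trans sm (same-trans (same-≤ (n≤1+n f) ≤-refl sm₂) (keep⇒same (only⇒keep {y = f} ≤-refl ≤-refl (only-setR s₂ _))))
                , λ a′ l → below a′ (subst (toℕ a′ <_) (trans (upd-same (reg s₂) f _) (cong suc rf)) l))
                where
                  rf : reg s₂ f ≡ reg s₁ f
                  rf = sameR sm₂ f ≤-refl
                  below : ∀ a′ → toℕ a′ < suc (reg s₁ f) → F a′ ≡ false
                  below a′ (s≤s l) with toℕ a′ ≟ reg s₁ f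
                  ... | no ne′ = none a′ (≤∧≢⇒< l ne′)
                  ... | yes e′ = trans (cong F (Finₚ.toℕ-injective (trans e′ (sym (Finₚ.toℕ-fromℕ< f<N))))) (sym e)

  tri-eval : ∀ {n Γ} (φ : Formula n Γ) {f g vs as ρ e s} → Fits {N} (arity φ) → 0 < f → Ctx f g vs as ρ e s →
             Tri (evalP f g vs as φ) s (λ b s′ → b ≡ ev φ ρ e × Same f g s s′)
  tri-eval (eq i j) {ρ = ρ} fits 0<f c = tri-same
    ( det (reflects-⇔ (λ q → Finₚ.toℕ-injective (trans (sym (proj₂ (val (vars≡ c) i))) (trans (sym q) (proj₂ (val (vars≡ c) j)))))
                      (λ q → trans (proj₂ (val (vars≡ c) j)) (trans (cong toℕ (sym q)) (sym (proj₂ (val (vars≡ c) i)))))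
                      (≡ᵇ-reflects _ _))
          (proof (Vec.lookup ρ i Fin.≟ Vec.lookup ρ j))
    , same-refl)
  tri-eval (lt i j) fits 0<f c = tri-map
    (λ (q , k) → trans q (cong₂ _<ᵇ_ (proj₂ (val (vars≡ c) i)) (proj₂ (val (vars≡ c) j))) , keep⇒same k)
    (tri-lt (proj₁ (val (vars≡ c) i)) (proj₁ (val (vars≡ c) j)))
  tri-eval (P a i) {ρ = ρ} fits 0<f c = tri-symb
    ( det (reflects-⇔ (λ q → Maybeₚ.just-injective (trans (sym inp) q)) (λ q → trans inp (cong just q)) (proof (_ ≟ᵐ just a)))
          (proof (List.lookup u (Vec.lookup ρ i) ≟ˢ a))
    , same-refl)
    where inp = trans (cong input (proj₂ (val (vars≡ c) i))) (input-u (Vec.lookup ρ i))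
  tri-eval (rel p ts) {vs = vs} {ρ = ρ} fits 0<f c = tri-map
    (λ (q , k) → trans q (proj₂ (rels≡ c p _)) , keep⇒same k)
    (tri-lookup (Vec.map (Vec.lookup vs) ts) (Vec.map (Vec.lookup ρ) ts) fits 0<f (size≡ c) (vals-map ts (vars≡ c)))
  tri-eval (neg φ) fits 0<f c = tri-not (tri-map (λ (q , k) → cong not q , k) (tri-eval φ fits 0<f c))
  tri-eval (conj φ ψ) {ρ = ρ} {e} fits 0<f c = tri-ite (tri-eval φ (λ l → fits (m≤n⇒m≤n⊔o (arity ψ) l)) 0<f c)
    (λ s₁ (q , k) → tri-map (λ (q′ , k′) → trans q′ (cong (_∧ ev ψ ρ e) q) , same-trans k k′)
                      (tri-eval ψ (λ l → fits (m≤n⇒m≤o⊔n (arity φ) l)) 0<f (ctx-same 0<f k c)))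
    (λ s₁ (q , k) → tri-say (cong (_∧ ev ψ ρ e) q , k))
  tri-eval (ex φ) {f} {g} {vs} {as} {ρ} {e} fits 0<f c = tri-ex (λ a → ev φ (a ∷ ρ) e) 0<f (size≡ c)
    λ a s₁ sm q → tri-eval φ fits (s≤s z≤n)
      (let c₁ = ctx-same 0<f sm c in
       ctx (size≡ c₁) (vals λ { zero → ≤-refl , q ; (suc i) → ≤-trans (proj₁ (val (vars≡ c₁) i)) (n≤1+n f) , proj₂ (val (vars≡ c₁) i) }) (rels≡ c₁))
  tri-eval (ifp r φ ts) {f} {g} {vs} {as} {ρ} {e} {s} fits 0<f c =
    tri-seq (tri-fill {g = suc g} (λ _ → false) fits-r 0<f (size≡ c) (λ ȳ s₁ _ _ → tri-say (refl , same-refl)) ≤-refl)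
    -- The loop over r-tuples serves as a clock: when its tuple has code k, array g holds stage k,
    -- and it ends at stage N ^ r.
    λ _ s₁ (sb , q) → tri-seq (tri-forAll 0 r f I 0<f
        (λ k (sm , q) → same-trans sm (keep⇒same k) , λ ā → trans (keepA k g _) (q ā))
        (λ (sm , q) → trans (sameR sm 0 0<f) (size≡ c))
        (mkSame (sbR sb) (λ a l → sbA sb a (≤-trans l (n≤1+n g)) (<⇒≢ l)) , q)
        round)
    λ _ s₂ (sm , q) → let c₂ = ctx-same 0<f sm c in tri-map
        (λ (q′ , k) → trans q′ (q (Vec.map (Vec.lookup ρ) ts)) , same-trans sm (keep⇒same k))
        (tri-lookup (Vec.map (Vec.lookup vs) ts) (Vec.map (Vec.lookup ρ) ts) fits-r 0<f (size≡ c₂) (vals-map ts (vars≡ c₂)))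
    where
      fits-r : Fits {N} r
      fits-r l = fits (m≤n⇒m≤n⊔o (arity φ) l)
      F = stageᵇ r φ ρ e
      I : ℕ → Mem → Set
      I k s₁ = Same f g s s₁ × (∀ ā → arr s₁ g (enc ā) ≡ F k ā)
      f′ = f + r
      f″ = f + r + r
      ys = regsFrom f′ r
      0<f′ : 0 < f′
      0<f′ = ≤-trans 0<f (m≤m+n f r)
      0<f″ : 0 < f″
      0<f″ = ≤-trans 0<f′ (m≤m+n f′ r)
      f≤f″ : f ≤ f″
      f≤f″ = ≤-trans (m≤m+n f r) (m≤m+n f′ r)
      round : ∀ (z̄ : Vec (Fin N) r) s₁ → I (enc z̄) s₁ → Vals f′ s₁ (regsFrom f r) z̄ →
              Tri (seq (fillP f′ r (suc g) (ite (lookupP f″ g ys) (at 0 (say true))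
                                             (evalP f″ (suc (suc g)) (ys Vec.++ vs) (g ∷ as) φ)))
                       (fillP f′ r g (lookupP f″ (suc g) ys))) s₁
                  (λ _ s₂ → I (suc (enc z̄)) s₂ × KeepIn f f′ s₁ s₂)
      round z̄ s₁ (sm , q) _ =
        -- φ must see the whole old stage for every tuple. The new stage is therefore collected in
        -- array `suc g` while g is left alone, and the second fill copies it back.
        tri-seq (tri-fill {g = suc (suc g)} (F (suc k)) fits-r 0<f′ r0₁
          (λ ȳ s₂ sb v →
            let r0₂ = trans (sbR sb 0 0<f′) r0₁
                q₂ : ∀ ā → arr s₂ g (enc ā) ≡ F k ā
                q₂ ā = trans (sbA sb g (s≤s (n≤1+n g)) (<⇒≢ ≤-refl) (enc ā)) (q ā) in
            tri-ite (tri-lookup ys ȳ fits-r 0<f″ r0₂ v)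
              (λ s₃ (b≡ , kp) → tri-say (cong (_∨ ev φ (ȳ Vec.++ ρ) (F k ∷ e)) (trans b≡ (q₂ ȳ)) , keep⇒same kp))
              (λ s₃ (b≡ , kp) → tri-map
                (λ (b′≡ , kp′) → trans b′≡ (cong (_∨ ev φ (ȳ Vec.++ ρ) (F k ∷ e)) (trans b≡ (q₂ ȳ))) , same-trans (keep⇒same kp) kp′)
                (tri-eval φ (λ l → fits (m≤n⇒m≤o⊔n r l)) 0<f″ (inner ȳ s₂ s₃ sb v q₂ (keep⇒same kp)))))
          ≤-refl)
        λ _ s₂ (sb₂ , q₂) → tri-map
          (λ {_} {s₃} (sb₃ , q₃) →
              ( same-trans sm (mkSame
                  (λ i l → trans (sbR sb₃ i (≤-trans l (m≤m+n f r))) (sbR sb₂ i (≤-trans l (m≤m+n f r))))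
                  (λ a l j → trans (sbA sb₃ a (≤-trans l (≤-trans (n≤1+n g) (n≤1+n _))) (<⇒≢ l) j)
                                   (sbA sb₂ a (≤-trans l (≤-trans (n≤1+n g) (n≤1+n _))) (<⇒≢ (≤-trans l (n≤1+n g))) j)))
              , q₃)
              , λ i _ l → trans (sbR sb₃ i l) (sbR sb₂ i l))
          (tri-fill {g = suc (suc g)} (F (suc k)) fits-r 0<f′ (trans (sbR sb₂ 0 0<f′) r0₁)
            (λ ȳ s₃ sb v → tri-map
              (λ (b≡ , kp) → trans b≡ (trans (sbA sb (suc g) ≤-refl 1+n≢n (enc ȳ)) (q₂ ȳ)) , keep⇒same kp)
              (tri-lookup ys ȳ fits-r 0<f″ (trans (sbR sb 0 0<f′) (trans (sbR sb₂ 0 0<f′) r0₁)) v))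
            (s≤s (n≤1+n g)))
        where
          k = enc z̄
          r0₁ = trans (sameR sm 0 0<f) (size≡ c)
          c₁ = ctx-same 0<f sm c
          inner : ∀ ȳ s₂ s₃ → SameBut f′ (suc (suc g)) (suc g) s₁ s₂ → Vals f″ s₂ ys ȳ →
                  (∀ ā → arr s₂ g (enc ā) ≡ F k ā) → Same f″ (suc (suc g)) s₂ s₃ →
                  Ctx f″ (suc (suc g)) (ys Vec.++ vs) (g ∷ as) (ȳ Vec.++ ρ) (F k ∷ e) s₃
          inner ȳ s₂ s₃ sb v q₂ kp = ctx-same 0<f″ kp (ctx (trans (sbR sb 0 0<f′) r0₁)
            (vals-++ ys vs v (vals λ i → ≤-trans (proj₁ (val (vars≡ c₁) i)) f≤f″
              , trans (sbR sb _ (≤-trans (proj₁ (val (vars≡ c₁) i)) (m≤m+n f r))) (proj₂ (val (vars≡ c₁) i))))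
            λ { (here refl) ā → s≤s (n≤1+n g) , q₂ ā
              ; (there p) ā → let (l , h) = rels≡ c₁ p ā in
                  ≤-trans l (≤-trans (n≤1+n g) (n≤1+n _))
                , trans (sbA sb _ (≤-trans l (≤-trans (n≤1+n g) (n≤1+n _))) (<⇒≢ (≤-trans l (n≤1+n g))) _) h })

-- Certificates for log-quantifiers

n≤2^⌈log₂n⌉ : ∀ n → n ≤ 2 ^ ⌈log₂ n ⌉
n≤2^⌈log₂n⌉ n = go n (<-wellFounded n)
  where
    go : ∀ n → Acc _<_ n → n ≤ 2 ^ ⌈log₂ n ⌉
    go zero          _         = z≤n
    go (suc zero)    _         = s≤s z≤n
    go n@(suc (suc m)) (acc rs) = begin
      n                                  ≡⟨ ⌊n/2⌋+⌈n/2⌉≡n n ⟨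
      ⌊ n /2⌋ + ⌈ n /2⌉                  ≤⟨ +-monoˡ-≤ ⌈ n /2⌉ (⌊n/2⌋≤⌈n/2⌉ n) ⟩
      ⌈ n /2⌉ + ⌈ n /2⌉                  ≡⟨ cong (⌈ n /2⌉ +_) (+-identityʳ _) ⟨
      2 * ⌈ n /2⌉                        ≤⟨ *-monoʳ-≤ 2 (go ⌈ n /2⌉ (rs (⌈n/2⌉<n m))) ⟩
      2 ^ suc ⌈log₂ ⌈ n /2⌉ ⌉            ≡⟨ cong (λ k → 2 ^ suc k) (⌈log₂⌈n/2⌉⌉≡⌈log₂n⌉∸1 n) ⟩
      2 ^ suc (⌈log₂ n ⌉ ∸ 1)            ≡⟨ cong (2 ^_) (m+[n∸m]≡n (⌈log₂⌉-mono-≤ {2} {n} (s≤s (s≤s z≤n)))) ⟩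
      2 ^ ⌈log₂ n ⌉                      ∎
      where open ≤-Reasoning

<⌈log₂⌉⇒2^< : ∀ {j} n → j < ⌈log₂ n ⌉ → 2 ^ j < n
<⌈log₂⌉⇒2^< {j} n j<l = ≰⇒> λ n≤2^j → <⇒≱ j<l (≤-trans (⌈log₂⌉-mono-≤ n≤2^j) (≤-reflexive (⌈log₂2^n⌉≡n j)))

n<2^n : ∀ n → n < 2 ^ n
n<2^n zero    = s≤s z≤n
n<2^n (suc n) = ≤-trans (s≤s (n<2^n n))
  (≤-trans (+-mono-≤ (≤-trans (s≤s z≤n) (n<2^n n)) (≤-refl {2 ^ n})) (≤-reflexive (cong (2 ^ n +_) (sym (+-identityʳ _)))))

⌈log₂n⌉≤n : ∀ n → ⌈log₂ n ⌉ ≤ n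
⌈log₂n⌉≤n n = ≤-trans (⌈log₂⌉-mono-≤ (<⇒≤ (n<2^n n))) (≤-reflexive (⌈log₂2^n⌉≡n n))

-- Numbers of ⌈log₂ N⌉ bits are held in registers while a certificate is read, and they may exceed
-- N. Doubling the last power of two below N shows that they stay linear in N.
2^⌈log₂n⌉≤1+2n : ∀ n → 2 ^ ⌈log₂ n ⌉ ≤ suc (2 * n)
2^⌈log₂n⌉≤1+2n n with ⌈log₂ n ⌉ in eq₁
... | zero  = s≤s z≤n
... | suc j = ≤-trans (*-monoʳ-≤ 2 (<⇒≤ (<⌈log₂⌉⇒2^< n (≤-reflexive (sym eq₁))))) (n≤1+n _)

toBit : Bool → ℕ
toBit b = if b then 1 else 0

_∈ᵛ?_ : ∀ {N r} (ā : Vec (Fin N) r) S → Dec (ā ∈ S)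
ā ∈ᵛ? S = Any.any? (Vecₚ.≡-dec Fin._≟_ ā) S

-- Not every number of ⌈log₂ N⌉ bits names an element. A record with a number outside the universe
-- is dropped, so that every bit sequence decodes to a set of tuples.
inRange : ∀ {N r} → Vec ℕ r → Maybe (Vec (Fin N) r)
inRange []           = just []
inRange {N} (x ∷ xs) with x <? N | inRange {N} xs
... | yes x<N | just as = just (fromℕ< x<N ∷ as)
... | yes _   | nothing = nothing
... | no _    | _       = nothing

inRange-just : ∀ {N r} (xs : Vec ℕ r) {ā : Vec (Fin N) r} → inRange xs ≡ just ā →
               ∀ i → Vec.lookup xs i ≡ toℕ (Vec.lookup ā i)
inRange-just {N} (x ∷ xs) h i with x <? N | inRange {N} xs in eq₁
inRange-just (x ∷ xs) refl zero    | yes x<N | just as = sym (Finₚ.toℕ-fromℕ< x<N)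
inRange-just (x ∷ xs) refl (suc i) | yes x<N | just as = inRange-just xs eq₁ i

inRange-toℕ : ∀ {N r} (ā : Vec (Fin N) r) → inRange (Vec.map toℕ ā) ≡ just ā
inRange-toℕ []           = refl
inRange-toℕ {N} (a ∷ as) with toℕ a <? N | inRange {N} (Vec.map toℕ as) | inRange-toℕ as
... | yes p | _ | refl = cong (λ b → just (b ∷ as)) (Finₚ.fromℕ<-toℕ a p)
... | no ¬p | _ | _    = contradiction (Finₚ.toℕ<n a) ¬p

consMaybe : ∀ {A : Set} → Maybe A → List A → List A
consMaybe (just x) xs = x ∷ xs
consMaybe nothing  xs = xs

-- A set of at most lᵏ tuples of arity r is read from lᵏ records of r * l + 1 bits:
-- r numbers of l bits, most significant bit first, and a bit telling whether the record counts.
module Decode (N l : ℕ) (β : ℕ → Bool) where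

  num : ℕ → ℕ → ℕ
  num p zero    = 0
  num p (suc j) = num p j + num p j + toBit (β (p + j))

  nums : ℕ → (r : ℕ) → Vec ℕ r
  nums p zero    = []
  nums p (suc r) = num (p + r * l) l ∷ nums p r

  recordAt : ℕ → (r : ℕ) → Maybe (Vec (Fin N) r)
  recordAt p r = if β (p + r * l) then inRange (nums p r) else nothing

  records : ℕ → (r q : ℕ) → List (Vec (Fin N) r)
  records p r zero    = []
  records p r (suc q) = consMaybe (recordAt (p + q * suc (r * l)) r) (records p r q)

  length-records : ∀ p r q → length (records p r q) ≤ q
  length-records p r zero    = z≤n
  length-records p r (suc q) with recordAt (p + q * suc (r * l)) r
  ... | just _  = s≤s (length-records p r q)
  ... | nothing = ≤-trans (length-records p r q) (n≤1+n q)

  num<2^ : ∀ p j → num p j < 2 ^ j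
  num<2^ p zero    = s≤s z≤n
  num<2^ p (suc j) = begin
    suc (num p j + num p j + toBit (β (p + j))) ≤⟨ s≤s (+-monoʳ-≤ (num p j + num p j) (toBit≤1 (β (p + j)))) ⟩
    suc (num p j + num p j + 1)                 ≡⟨ solve (num p j) ⟩
    2 * suc (num p j)                           ≤⟨ *-monoʳ-≤ 2 (num<2^ p j) ⟩
    2 ^ suc j                                   ∎
    where
      open ≤-Reasoning
      toBit≤1 : ∀ b → toBit b ≤ 1
      toBit≤1 true  = s≤s z≤n
      toBit≤1 false = z≤n
      solve : ∀ x → suc (x + x + 1) ≡ 2 * suc x
      solve = solve-∀

certLength : ∀ {Γ} → ℕ → LogFormula Γ → ℕ
certLength l (body ψ)            = 0
certLength l (logEx k r _ _ φ) = l ^ k * suc (r * l) + certLength l φ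

certLength-zero : ∀ {Γ} (φ : LogFormula Γ) → certLength 0 φ ≡ 0
certLength-zero (body ψ)                 = refl
certLength-zero (logEx (suc k) r _ _ φ) = certLength-zero φ

-- A certificate bound has room for one constant and one exponent only, so those of the successive
-- quantifiers are added up.
certLength-≤ : ∀ {Γ} (φ : LogFormula Γ) → Σ ℕ λ c → Σ ℕ λ k → ∀ l → certLength l φ ≤ c * l ^ k
certLength-≤ (body ψ) = 0 , 0 , λ l → z≤n
certLength-≤ (logEx k r 0<k 0<r φ) with certLength-≤ φ
... | c , k′ , h = suc r + c , suc k + k′ , bound
  where
    bound : ∀ l → certLength l (logEx k r 0<k 0<r φ) ≤ (suc r + c) * l ^ (suc k + k′)
    -- At l = 0 powers do not grow with the exponent, but there the certificate is empty because
    -- every quantifier has a positive k.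
    bound zero      = ≤-trans (≤-reflexive (certLength-zero (logEx k r 0<k 0<r φ))) z≤n
    bound l@(suc _) = begin
      l ^ k * suc (r * l) + certLength l φ             ≤⟨ +-mono-≤ (*-monoʳ-≤ (l ^ k) (+-monoˡ-≤ (r * l) (s≤s z≤n))) (h l) ⟩
      l ^ k * (suc r * l) + c * l ^ k′                 ≡⟨ cong (_+ c * l ^ k′) (solve (l ^ k) r l) ⟩
      suc r * l ^ suc k + c * l ^ k′                   ≤⟨ +-mono-≤ (*-monoʳ-≤ (suc r) (^-monoʳ-≤ l (m≤m+n (suc k) k′)))
                                                                   (*-monoʳ-≤ c (^-monoʳ-≤ l (m≤n+m k′ (suc k)))) ⟩
      suc r * l ^ (suc k + k′) + c * l ^ (suc k + k′)  ≡⟨ *-distribʳ-+ (l ^ (suc k + k′)) (suc r) c ⟨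
      (suc r + c) * l ^ (suc k + k′)                   ∎
      where
        open ≤-Reasoning
        solve : ∀ x r l → x * (suc r * l) ≡ suc r * (l * x)
        solve = solve-∀

record Spells (β : ℕ → Bool) (p : ℕ) (v : List Bool) : Set where
  constructor mkSpells
  field
    spell : ∀ j → j < length v → β (p + j) ≡ nth false v j
open Spells public

nth-++ˡ : ∀ {A : Set} {b : A} xs {ys j} → j < length xs → nth b (xs ++ ys) j ≡ nth b xs j
nth-++ˡ (x ∷ xs) {j = zero}  _       = refl
nth-++ˡ (x ∷ xs) {j = suc j} (s≤s p) = nth-++ˡ xs p

nth-++ʳ : ∀ {A : Set} {b : A} xs {ys} j → nth b (xs ++ ys) (length xs + j) ≡ nth b ys j
nth-++ʳ []       j = refl
nth-++ʳ (x ∷ xs) j = nth-++ʳ xs j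

spells-++ˡ : ∀ {β p} v {v′} → Spells β p (v ++ v′) → Spells β p v
spells-++ˡ v {v′} h = mkSpells λ j l → trans
  (spell h j (≤-trans l (≤-trans (m≤m+n _ _) (≤-reflexive (sym (Listₚ.length-++ v))))))
  (nth-++ˡ v l)

spells-++ʳ : ∀ {β p} v {v′ n} → length v ≡ n → Spells β p (v ++ v′) → Spells β (p + n) v′
spells-++ʳ {β} {p} v {v′} refl h = mkSpells λ j l → trans
  (cong β (+-assoc p (length v) j))
  (trans (spell h (length v + j) (≤-trans (+-monoʳ-< (length v) l) (≤-reflexive (sym (Listₚ.length-++ v)))))
         (nth-++ʳ v j))

module _ {N l : ℕ} where
  private module D = Decode N l

  -- The least significant bit comes last: the induction splits off the parity and codes the half.
  -- The code has to work at any position of any bit sequence that spells it, since its place in the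
  -- certificate is not yet known.
  numCode : ∀ j x → x < 2 ^ j → Σ (List Bool) λ v → length v ≡ j × (∀ β p → Spells β p v → D.num β p j ≡ x)
  numCode zero    zero    _ = [] , refl , λ β p h → refl
  numCode zero    (suc x) (s≤s ())
  numCode (suc j) x x<2^ = append (half x)
    where
      half : ∀ x → Σ ℕ λ y → Σ Bool λ b → x ≡ y + y + toBit b
      half zero = 0 , false , refl
      half (suc x) with half x
      ... | y , false , refl = y , true , trans (cong suc (+-identityʳ _)) (+-comm 1 (y + y))
      ... | y , true , refl = suc y , false , solve y
        where
          solve : ∀ y → suc (y + y + 1) ≡ suc y + suc y + 0
          solve = solve-∀
      append : (Σ ℕ λ y → Σ Bool λ b → x ≡ y + y + toBit b) →
               Σ (List Bool) λ v → length v ≡ suc j × (∀ β p → Spells β p v → D.num β p (suc j) ≡ x)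
      append (y , b , refl) with numCode j y (*-cancelˡ-< 2 y (2 ^ j)
               (≤-trans (s≤s (≤-trans (≤-reflexive (cong (y +_) (+-identityʳ y))) (m≤m+n (y + y) (toBit b)))) x<2^))
      ... | v , len , h = v ++ b ∷ [] , trans (Listₚ.length-++ v) (trans (cong (_+ 1) len) (+-comm j 1)) ,
        λ β p sp → cong₂ (λ n c → n + n + toBit c) (h β p (spells-++ˡ v sp))
          (trans (cong β (sym (+-identityʳ (p + j)))) (spell (spells-++ʳ v len sp) 0 (s≤s z≤n)))

  module _ (N≤2^l : N ≤ 2 ^ l) where

    numsCode : ∀ {r} (ā : Vec (Fin N) r) → Σ (List Bool) λ v → length v ≡ r * l ×
               (∀ β p → Spells β p v → D.nums β p r ≡ Vec.map toℕ ā)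
    numsCode [] = [] , refl , λ β p h → refl
    numsCode {suc r} (a ∷ as) with numsCode as | numCode l (toℕ a) (≤-trans (Finₚ.toℕ<n a) N≤2^l)
    ... | v , len , h | v′ , len′ , h′ = v ++ v′ ,
      trans (Listₚ.length-++ v) (trans (cong₂ _+_ len len′) (+-comm (r * l) l)) ,
      λ β p sp → cong₂ _∷_ (h′ β (p + r * l) (spells-++ʳ v len sp)) (h β p (spells-++ˡ v sp))

    recordCode : ∀ {r} (m : Maybe (Vec (Fin N) r)) → Σ (List Bool) λ v → length v ≡ suc (r * l) ×
                 (∀ β p → Spells β p v → D.recordAt β p r ≡ m)
    recordCode {r} (just ā) with numsCode ā
    ... | v , len , h = v ++ true ∷ [] , trans (Listₚ.length-++ v) (trans (cong (_+ 1) len) (+-comm (r * l) 1)) ,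
      λ β p sp → trans
        (cong (λ b → if b then inRange (D.nums β p r) else nothing)
          (trans (cong β (sym (+-identityʳ _))) (spell (spells-++ʳ v len sp) 0 (s≤s z≤n))))
        (trans (cong inRange (h β p (spells-++ˡ v sp))) (inRange-toℕ ā))
    recordCode {r} nothing = replicate (r * l) false ++ false ∷ [] ,
      trans (Listₚ.length-++ (replicate (r * l) false)) (trans (cong (_+ 1) (Listₚ.length-replicate (r * l))) (+-comm (r * l) 1)) ,
      λ β p sp → cong (λ b → if b then inRange (D.nums β p r) else nothing)
          (trans (cong β (sym (+-identityʳ _))) (spell (spells-++ʳ (replicate (r * l) false) (Listₚ.length-replicate (r * l)) sp) 0 (s≤s z≤n)))

    -- Records with validity bit 0 fill up the list, so fewer than q tuples still occupy exactly q
    -- records and the following quantifier starts at a known position.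
    recordsCode : ∀ {r} q (S : List (Vec (Fin N) r)) → length S ≤ q →
                  Σ (List Bool) λ v → length v ≡ q * suc (r * l) × (∀ β p → Spells β p v → D.records β p r q ≡ S)
    recordsCode zero    []  _ = [] , refl , λ β p h → refl
    recordsCode zero    (_ ∷ _) ()
    recordsCode {r} (suc q) S S≤q = split S S≤q
      where
        combine′ : ∀ m S′ → length S′ ≤ q → Σ (List Bool) λ v → length v ≡ suc q * suc (r * l) ×
                   (∀ β p → Spells β p v → D.records β p r (suc q) ≡ consMaybe m S′)
        combine′ m S′ S′≤q with recordsCode q S′ S′≤q | recordCode m
        ... | v , len , h | v′ , len′ , h′ = v ++ v′ ,
          trans (Listₚ.length-++ v) (trans (cong₂ _+_ len len′) (+-comm (q * suc (r * l)) (suc (r * l)))) ,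
          λ β p sp → cong₂ consMaybe (h′ β _ (spells-++ʳ v len sp)) (h β p (spells-++ˡ v sp))
        split : ∀ S → length S ≤ suc q → Σ (List Bool) λ v → length v ≡ suc q * suc (r * l) ×
                   (∀ β p → Spells β p v → D.records β p r (suc q) ≡ S)
        split []      _       = combine′ nothing [] z≤n
        split (ā ∷ S) (s≤s h) = combine′ (just ā) S h

module CertEval (u : Str) where
  open Sem u using (N)
  open Eval u

  l : ℕ
  l = ⌈log₂ N ⌉

  evL : (ℕ → Bool) → ∀ {Γ} → ℕ → LogFormula Γ → EnvB N Γ → Bool
  evL β p (body ψ)           e = ev ψ [] e
  evL β p (logEx k r _ _ φ) e =
    evL β (p + l ^ k * suc (r * l)) φ ((λ ā → does (ā ∈ᵛ? Decode.records N l β p r (l ^ k))) ∷ e)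

  -- Whatever the bits are, q records decode to at most q tuples, so each decoded set is a
  -- legitimate witness for its quantifier.
  evL-sound : ∀ β {Γ} p (φ : LogFormula Γ) {e b} → ReflectsEnv e b → evL β p φ b ≡ true → satL u φ e
  evL-sound β p (body ψ) h t = reflects-true (ev-reflects ψ [] h) t
  evL-sound β p (logEx k r _ _ φ) h t =
    records p r (l ^ k) , length-records p r (l ^ k) ,
    evL-sound β _ φ (reflectsEnv-∷ (λ ā → proof (ā ∈ᵛ? records p r (l ^ k))) h) t
    where open Decode N l β

  -- The witnessing sets are written out one after the other. Reading them back returns the very
  -- same lists, so the remaining evaluation is the one of the induction hypothesis.
  evL-complete : ∀ {Γ} (φ : LogFormula Γ) {e b} → ReflectsEnv e b → satL u φ e →
                 Σ (List Bool) λ v → length v ≡ certLength l φ × (∀ β p → Spells β p v → evL β p φ b ≡ true)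
  evL-complete (body ψ) h t = [] , refl , λ β p _ → reflects-intro (ev-reflects ψ [] h) t
  evL-complete (logEx k r _ _ φ) h (S , S≤ , t)
    with recordsCode (n≤2^⌈log₂n⌉ N) (l ^ k) S S≤
       | evL-complete φ (reflectsEnv-∷ {Rᵇ = λ ā → does (ā ∈ᵛ? S)} (λ ā → proof (ā ∈ᵛ? S)) h) t
  ... | v , len , g | v′ , len′ , g′ = v ++ v′ , trans (Listₚ.length-++ v) (cong₂ _+_ len len′) ,
    λ β p sp → trans
      (cong (λ S → evL β (p + l ^ k * suc (r * l)) φ ((λ ā → does (ā ∈ᵛ? S)) ∷ _)) (g β p (spells-++ˡ v sp)))
      (g′ β _ (spells-++ʳ v len sp))

-- Programs that read certificates

-- Register 0 holds |u|, register 1 holds ⌈log₂ |u|⌉ and register 2 the next certificate position.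

doubleP : (x y z : ℕ) → Prog
doubleP x y z = seq (zeroP y) (seq (addP y x z) (addP x y z))

numP : ℕ → Prog
numP x = seq (zeroP x) (forP (suc x) 1
  (seq (doubleP x (suc (suc x)) (suc (suc (suc x))))
       (ite (at 2 (symb (just s1))) (seq (at x inc) (at 2 inc)) (at 2 inc))))

numsP : (f r : ℕ) → Prog
numsP f zero    = at 0 (say true)
numsP f (suc r) = seq (numsP f r) (numP (f + r))

inRangeP : (h f r : ℕ) → Prog
inRangeP h f zero    = at 0 (say true)
inRangeP h f (suc r) = ite (ltP h (f + r) 0) (inRangeP h f r) (at 0 (say false))

recordP : (f r g : ℕ) → Prog
recordP f r g = seq (numsP f r) (ite (at 2 (symb (just s1)))
  (seq (at 2 inc) (ite (inRangeP (f + r) f r) (writeP (f + r) g true (regsFrom f r)) (at 0 (say true))))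
  (at 2 inc))

-- The k nested loops up to register 1, that is ⌈log₂ N⌉, count the l ^ k records without this
-- number ever being computed.
setP : (k r g : ℕ) → Prog
setP k r g = seq (fillP 3 r g (at 0 (say false))) (forAllP (regsFrom 3 k) 1 (recordP (3 + k) r g))

prefixP : ∀ {Γ} → ℕ → All (λ _ → ℕ) Γ → LogFormula Γ → Prog
prefixP g as (body ψ)           = evalP 3 g [] as ψ
prefixP g as (logEx k r _ _ φ) = seq (setP k r g) (prefixP (suc g) (g ∷ as) φ)

logP : Prog
logP = seq (zeroP 3) (seq (at 3 inc) (while (ltP 4 3 0) (seq (doubleP 3 4 5) (at 1 inc))))

-- The bits of v contain no separator, so the last `#` of the input ends u even if u contains this
-- symbol itself. Without any separator the backward walk stops at 0 and u counts as empty.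
scanP : Prog
scanP = seq (while (notP (at 2 (symb nothing))) (at 2 inc))
  (seq (while (ite (at 2 (symb (just s#))) (at 0 (say false)) (at 2 dec)) (at 0 (say true)))
  (seq (addP 0 2 3) (at 2 inc)))

checkP : Sentence → Prog
checkP φ = seq scanP (seq logP (prefixP 0 [] φ))

arityL : ∀ {Γ} → LogFormula Γ → ℕ
arityL (body ψ)           = arity ψ
arityL (logEx k r _ _ φ) = r ⊔ arityL φ

is-just-inRange : ∀ {N r} x (xs : Vec ℕ r) → is-just (inRange {N} (x ∷ xs)) ≡ (x <ᵇ N) ∧ is-just (inRange {N} xs)
is-just-inRange {N} x xs with x <ᵇ N | <ᵇ-reflects x N | x <? N | inRange {N} xs
... | _ | ofʸ _   | yes _ | just _  = refl
... | _ | ofʸ _   | yes _ | nothing = refl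
... | _ | ofʸ p   | no ¬p | _       = contradiction p ¬p
... | _ | ofⁿ ¬p | yes p | _       = contradiction p ¬p
... | _ | ofⁿ _   | no _  | _       = refl

-- Register 2 is the reading position in the certificate: it advances during programs that otherwise
-- respect everything below f.
record KeepBut2 (f : ℕ) (s s′ : Mem) : Set where
  constructor keepBut2
  field
    kb2R : ∀ i → i < f → i ≢ 2 → reg s′ i ≡ reg s i
    kb2A : SameArr s s′
open KeepBut2 public

keepBut2-trans : ∀ {f s₁ s₂ s₃} → KeepBut2 f s₁ s₂ → KeepBut2 f s₂ s₃ → KeepBut2 f s₁ s₃
keepBut2-trans h k = keepBut2 (λ i l n → trans (kb2R k i l n) (kb2R h i l n)) (λ a j → trans (kb2A k a j) (kb2A h a j))

keep⇒keepBut2 : ∀ {f s s′} → Keep f s s′ → KeepBut2 f s s′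
keep⇒keepBut2 h = keepBut2 (λ i l _ → keepR h i l) (keepA h)

only2⇒keepBut2 : ∀ {f s s′} → Only 2 s s′ → KeepBut2 f s s′
only2⇒keepBut2 o = keepBut2 (λ i _ n → off o n) (sameA o)

keepBut2-≤ : ∀ {f g s s′} → f ≤ g → KeepBut2 g s s′ → KeepBut2 f s s′
keepBut2-≤ l h = keepBut2 (λ i m → kb2R h i (≤-trans m l)) (kb2A h)

-- Correctness of the programs that read certificates

module CertCheck (u : Str) (input : ℕ → Maybe Sym) (B : ℕ)
                 (input-u : ∀ i → input (toℕ i) ≡ just (List.lookup u i)) where
  open Hoare input B
  open ModelCheck u input B input-u
  open CertEval u
  open Sem u using (N)

  β : ℕ → Bool
  β p = does (input p ≟ᵐ just s1)

  open Decode N l β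

  tri-inc₁ : ∀ {i s} → suc (reg s i) ≤ B → Tri (at i inc) s (λ _ s′ → reg s′ i ≡ suc (reg s i) × Only i s s′)
  tri-inc₁ {i} {s} h = tri-inc h (upd-same (reg s) i _ , only-setR s _)

  tri-double : ∀ {x y z s} → x ≢ y → x ≢ z → y ≢ z → reg s x + reg s x ≤ B →
               Tri (doubleP x y z) s (λ _ s′ → reg s′ x ≡ reg s x + reg s x ×
                 (∀ i → i ≢ x → i ≢ y → i ≢ z → reg s′ i ≡ reg s i) × SameArr s s′)
  tri-double {x} {y} {z} {s} x≢y x≢z y≢z h =
    tri-seq (tri-zero y) λ _ s₁ (z₁ , o₁) →
    let x₁ = off o₁ x≢y in
    tri-seq (tri-add (x≢y ∘ sym) y≢z x≢z (≤-trans (≤-reflexive (cong₂ _+_ z₁ x₁)) (≤-trans (m≤m+n _ _) h))) λ _ s₂ (q₂ , o₂) →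
    let x₂ = trans (otherR o₂ x≢y x≢z) x₁
        xy = cong₂ _+_ x₂ (trans q₂ (cong₂ _+_ z₁ x₁)) in
    tri-map (λ (q₃ , o₃) → trans q₃ xy
              , (λ i i≢x i≢y i≢z → trans (otherR o₃ i≢x i≢z) (trans (otherR o₂ i≢y i≢z) (off o₁ i≢y)))
              , λ a j → trans (sameA o₃ a j) (trans (sameA o₂ a j) (sameA o₁ a j)))
      (tri-add x≢y x≢z y≢z (≤-trans (≤-reflexive xy) h))

  module _ (2^l≤B : 2 ^ l ≤ B) where

    tri-num : ∀ {x p s} → 2 < x → reg s 1 ≡ l → reg s 2 ≡ p → p + l ≤ B →
              Tri (numP x) s (λ _ s′ → reg s′ x ≡ num p l × reg s′ 2 ≡ p + l × KeepBut2 x s s′)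
    tri-num {x} {p} {s} 2<x r1 r2 p≤B =
      tri-seq (tri-zero x) λ _ s₀ (z₀ , o₀) →
      tri-for (λ j s₁ → reg s₁ x ≡ num p j × reg s₁ 2 ≡ p + j × KeepBut2 x s s₁)
        (λ h → <⇒≢ (≤-trans (s≤s z≤n) 2<x) (sym (suc-injective h)))
        (λ {_} {s₁} {s₂} o (q , q2 , k) →
            trans (off o (<⇒≢ ≤-refl)) q
          , trans (off o (<⇒≢ (≤-trans 2<x (n≤1+n x)))) q2
          , keepBut2-trans k (keep⇒keepBut2 (only⇒keep (n≤1+n x) (n≤1+n x) o)))
        (trans (off o₀ (<⇒≢ 1<x)) r1)
        (z₀ , trans (off o₀ (<⇒≢ 2<x)) (trans r2 (sym (+-identityʳ p))) , keep⇒keepBut2 (only⇒keep ≤-refl ≤-refl o₀))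
        readBit
      where
        1<x : 1 < x
        1<x = ≤-trans (s≤s (s≤s z≤n)) 2<x
        x≢3+ : x ≢ suc (suc (suc x))
        x≢3+ = <⇒≢ (s≤s (≤-trans (n≤1+n x) (n≤1+n _)))
        readBit : ∀ j s₁ → j < l → reg s₁ x ≡ num p j × reg s₁ 2 ≡ p + j × KeepBut2 x s s₁ → reg s₁ (suc x) ≡ j → reg s₁ 1 ≡ l →
                  Tri (seq (doubleP x (suc (suc x)) (suc (suc (suc x))))
                        (ite (at 2 (symb (just s1))) (seq (at x inc) (at 2 inc)) (at 2 inc))) s₁
                      (λ _ s′ → (reg s′ x ≡ num p (suc j) × reg s′ 2 ≡ p + suc j × KeepBut2 x s s′) × reg s′ (suc x) ≡ j × reg s′ 1 ≡ l)
        readBit j s₁ j<l (q , q2 , k) rx r1₁ =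
          tri-seq (tri-double {s = s₁} (<⇒≢ (s≤s (n≤1+n x))) x≢3+ (<⇒≢ ≤-refl)
                    (≤-trans (≤-reflexive (cong₂ _+_ q q)) (≤-trans (m≤m+n _ _) num≤B)))
          λ _ s₂ (q₂ , o₂ , a₂) →
          let r2₂ = trans (o₂ 2 (<⇒≢ 2<x) (<⇒≢ (≤-trans 2<x (≤-trans (n≤1+n x) (n≤1+n _)))) (<⇒≢ (≤-trans 2<x (≤-trans (n≤1+n x) (≤-trans (n≤1+n _) (n≤1+n _)))))) q2
              x₂ = trans q₂ (cong₂ _+_ q q)
              k₂ : KeepBut2 x s s₂
              k₂ = keepBut2-trans k (keepBut2 (λ i i<x _ → o₂ i (<⇒≢ i<x) (<⇒≢ (≤-trans i<x (≤-trans (n≤1+n x) (n≤1+n _))))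
                     (<⇒≢ (≤-trans i<x (≤-trans (n≤1+n x) (≤-trans (n≤1+n _) (n≤1+n _)))))) a₂)
              rx₂ = trans (o₂ (suc x) 1+n≢n (<⇒≢ ≤-refl) (<⇒≢ (s≤s (n≤1+n _)))) rx
              r1₂ = trans (kb2R k₂ 1 1<x (λ ())) (trans (sym (kb2R k 1 1<x (λ ()))) r1₁)
              p′≤B : suc (p + j) ≤ B
              p′≤B = ≤-trans (≤-reflexive (sym (+-suc p j))) (≤-trans (+-monoʳ-≤ p j<l) p≤B) in
          tri-ite (tri-symb {Φ = λ b s₃ → b ≡ β (p + j) × s₃ ≡ s₂} (cong β r2₂ , refl))
            (λ { _ (b≡ , refl) →
              let num≡ = trans (cong suc x₂) (trans (+-comm 1 _) (cong (λ b → num p j + num p j + toBit b) b≡)) in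
              tri-seq (tri-inc₁ (≤-trans (≤-reflexive num≡) num≤B))
              λ _ s₃ (q₃ , o₃) →
              let r2₃ = trans (off o₃ (<⇒≢ 2<x)) r2₂ in
              tri-map (λ (q₄ , o₄) →
                  ( trans (off o₄ x≢2) (trans q₃ num≡)
                  , trans q₄ (trans (cong suc r2₃) (sym (+-suc p j)))
                  , keepBut2-trans k₂ (keepBut2-trans (keep⇒keepBut2 (only⇒keep ≤-refl ≤-refl o₃)) (only2⇒keepBut2 o₄)))
                , trans (off o₄ 1+x≢2) (trans (off o₃ 1+n≢n) rx₂)
                , trans (off o₄ (λ ())) (trans (off o₃ (<⇒≢ 1<x)) r1₂))
                (tri-inc₁ (≤-trans (≤-reflexive (cong suc r2₃)) p′≤B)) })
            (λ { _ (b≡ , refl) → tri-map (λ (q₄ , o₄) →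
                  ( trans (off o₄ x≢2) (trans x₂ (trans (sym (+-identityʳ _)) (cong (λ b → num p j + num p j + toBit b) b≡)))
                  , trans q₄ (trans (cong suc r2₂) (sym (+-suc p j)))
                  , keepBut2-trans k₂ (only2⇒keepBut2 o₄))
                , trans (off o₄ 1+x≢2) rx₂
                , trans (off o₄ (λ ())) r1₂)
                (tri-inc₁ (≤-trans (≤-reflexive (cong suc r2₂)) p′≤B)) })
          where
            x≢2 : x ≢ 2
            x≢2 = <⇒≢ 2<x ∘ sym
            1+x≢2 : suc x ≢ 2
            1+x≢2 = <⇒≢ (≤-trans 2<x (n≤1+n x)) ∘ sym
            num≤B : num p (suc j) ≤ B
            num≤B = ≤-trans (<⇒≤ (num<2^ p (suc j))) (≤-trans (^-monoʳ-≤ 2 j<l) 2^l≤B)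

    tri-nums : ∀ {f p s} r → 2 < f → reg s 1 ≡ l → reg s 2 ≡ p → p + r * l ≤ B →
               Tri (numsP f r) s (λ _ s′ → (∀ i → reg s′ (Vec.lookup (regsFrom f r) i) ≡ Vec.lookup (nums p r) i) ×
                 reg s′ 2 ≡ p + r * l × KeepBut2 f s s′)
    tri-nums {f} {p} zero 2<f r1 r2 h = tri-say ((λ ()) , trans r2 (sym (+-identityʳ p)) , keepBut2 (λ _ _ _ → refl) (λ _ _ → refl))
    tri-nums {f} {p} (suc r) 2<f r1 r2 h =
      tri-seq (tri-nums r 2<f r1 r2 (≤-trans (+-monoʳ-≤ p (m≤n+m (r * l) l)) h)) λ _ s₁ (q , q2 , k) →
      tri-map (λ (q′ , q2′ , k′) →
          (λ { zero    → q′
             ; (suc i) → trans (kb2R k′ _ (regsFrom-< f r i) (λ e → <⇒≢ (≤-trans 2<f (regsFrom-≥ f r i)) (sym e))) (q i) })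
        , trans q2′ p′≡
        , keepBut2-trans k (keepBut2-≤ (m≤m+n f r) k′))
        (tri-num (≤-trans 2<f (m≤m+n f r)) (trans (kb2R k 1 (≤-trans (s≤s (s≤s z≤n)) 2<f) (λ ())) r1) q2 (≤-trans (≤-reflexive p′≡) h))
      where
        p′≡ : p + r * l + l ≡ p + (l + r * l)
        p′≡ = trans (+-assoc p (r * l) l) (cong (p +_) (+-comm (r * l) l))

    tri-inRange : ∀ {h f s} r (xs : Vec ℕ r) → f + r ≤ h → 0 < h → reg s 0 ≡ N →
                  (∀ i → reg s (Vec.lookup (regsFrom f r) i) ≡ Vec.lookup xs i) →
                  Tri (inRangeP h f r) s (λ b s′ → b ≡ is-just (inRange {N} xs) × Keep h s s′)
    tri-inRange zero [] _ _ _ _ = tri-say (refl , keep-refl)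
    tri-inRange {h} {f} {s} (suc r) (x ∷ xs) l≤ 0<h r0 q =
      tri-ite (tri-lt (≤-trans (≤-reflexive (sym (+-suc f r))) l≤) 0<h)
        (λ s₁ (b≡ , k) → tri-map (λ (b′≡ , k′) → trans b′≡ (head≡ b≡) , keep-trans k k′)
          (tri-inRange r xs (≤-trans (+-monoʳ-≤ f (n≤1+n r)) l≤) 0<h (trans (keepR k 0 0<h) r0)
            (λ i → trans (keepR k _ (≤-trans (regsFrom-< f r i) (≤-trans (+-monoʳ-≤ f (n≤1+n r)) l≤))) (q (suc i)))))
        (λ s₁ (b≡ , k) → tri-say (head≡ b≡ , k))
      where
        head≡ : ∀ {b} → b ≡ (reg s (f + r) <ᵇ reg s 0) → b ∧ is-just (inRange {N} xs) ≡ is-just (inRange {N} (x ∷ xs))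
        head≡ refl = trans (cong (_∧ is-just (inRange {N} xs)) (cong₂ _<ᵇ_ (q zero) r0)) (sym (is-just-inRange x xs))

    tri-record : ∀ {f g p s} r {S : List (Vec (Fin N) r)} → 2 < f → reg s 0 ≡ N → reg s 1 ≡ l → reg s 2 ≡ p → p + suc (r * l) ≤ B → Fits {N} r →
      (∀ (ā : Vec (Fin N) r) → Reflects (ā ∈ S) (arr s g (enc ā))) →
      Tri (recordP f r g) s (λ _ s′ → (∀ ā → Reflects (ā ∈ consMaybe (recordAt p r) S) (arr s′ g (enc ā))) ×
        reg s′ 2 ≡ p + suc (r * l) × (∀ i → i < f → i ≢ 2 → reg s′ i ≡ reg s i) × (∀ a → a ≢ g → ∀ j → arr s′ a j ≡ arr s a j))
    tri-record {f} {g} {p} {s} r {S} 2<f r0 r1 r2 p≤B fits table =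
      tri-seq (tri-nums r 2<f r1 r2 (≤-trans (+-monoʳ-≤ p (n≤1+n (r * l))) p≤B)) λ _ s₁ (q , q2 , k) →
      let inc≤B : suc (reg s₁ 2) ≤ B
          inc≤B = ≤-trans (≤-reflexive (trans (cong suc q2) (sym (+-suc p (r * l))))) p≤B in
      tri-ite (tri-symb {Φ = λ b s₂ → b ≡ β (p + r * l) × s₂ ≡ s₁} (cong β q2 , refl))
        (λ { _ (b≡ , refl) → tri-seq (tri-inc₁ inc≤B) λ _ s₂ (q₂ , o₂) →
          let r0₂ = trans (off o₂ (λ ())) (trans (kb2R k 0 (≤-trans (s≤s z≤n) 2<f) (λ ())) r0)
              vs = λ i → trans (off o₂ (≢2 i)) (q i)
              r2₂ = trans q₂ (trans (cong suc q2) (sym (+-suc p (r * l)))) in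
          tri-ite (tri-inRange r (nums p r) ≤-refl (≤-trans (s≤s z≤n) (≤-trans 2<f (m≤m+n f r))) r0₂ vs)
            (λ s₃ (j≡ , k₃) → found (inRange (nums p r)) refl s₃ (sym j≡) (sym b≡)
               (trans (keepR k₃ 0 (≤-trans (s≤s z≤n) (≤-trans 2<f (m≤m+n f r)))) r0₂)
               (λ i → trans (keepR k₃ _ (regsFrom-< f r i)) (vs i))
               (trans (keepR k₃ 2 (≤-trans 2<f (m≤m+n f r))) r2₂)
               (λ i i<f i≢2 → trans (keepR k₃ i (≤-trans i<f (m≤m+n f r))) (trans (off o₂ i≢2) (kb2R k i i<f i≢2)))
               (λ a j → trans (keepA k₃ a j) (trans (sameA o₂ a j) (kb2A k a j))))
            (λ s₃ (j≡ , k₃) → tri-say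
              ( unchanged (trans (cong (λ b → if b then inRange (nums p r) else nothing) (sym b≡)) (no-record (sym j≡)))
                  s₃ (λ a j → trans (keepA k₃ a j) (trans (sameA o₂ a j) (kb2A k a j)))
              , trans (keepR k₃ 2 (≤-trans 2<f (m≤m+n f r))) r2₂
              , (λ i i<f i≢2 → trans (keepR k₃ i (≤-trans i<f (m≤m+n f r))) (trans (off o₂ i≢2) (kb2R k i i<f i≢2)))
              , λ a _ j → trans (keepA k₃ a j) (trans (sameA o₂ a j) (kb2A k a j)))) })
        (λ { _ (b≡ , refl) → tri-map (λ {_} {s₂} (q₂ , o₂) →
              unchanged (cong (λ b → if b then inRange (nums p r) else nothing) (sym b≡)) s₂ (λ a j → trans (sameA o₂ a j) (kb2A k a j))
            , trans q₂ (trans (cong suc q2) (sym (+-suc p (r * l))))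
            , (λ i i<f i≢2 → trans (off o₂ i≢2) (kb2R k i i<f i≢2))
            , λ a _ j → trans (sameA o₂ a j) (kb2A k a j)) (tri-inc₁ inc≤B) })
      where
        ≢2 : ∀ i → Vec.lookup (regsFrom f r) i ≢ 2
        ≢2 i e = <⇒≢ (≤-trans 2<f (regsFrom-≥ f r i)) (sym e)
        unchanged : recordAt p r ≡ nothing → ∀ s′ → SameArr s s′ →
                    ∀ ā → Reflects (ā ∈ consMaybe (recordAt p r) S) (arr s′ g (enc ā))
        unchanged e s′ sa ā = subst₂ (λ m b → Reflects (ā ∈ consMaybe m S) b) (sym e) (sym (sa g (enc ā))) (table ā)
        no-record : ∀ {m : Maybe (Vec (Fin N) r)} → is-just m ≡ false → m ≡ nothing
        no-record {nothing} _ = refl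
        found : ∀ m → inRange (nums p r) ≡ m → ∀ s₃ → is-just (inRange {N} (nums p r)) ≡ true → β (p + r * l) ≡ true → reg s₃ 0 ≡ N →
          (∀ i → reg s₃ (Vec.lookup (regsFrom f r) i) ≡ Vec.lookup (nums p r) i) → reg s₃ 2 ≡ p + suc (r * l) →
          (∀ i → i < f → i ≢ 2 → reg s₃ i ≡ reg s i) → SameArr s s₃ →
          Tri (writeP (f + r) g true (regsFrom f r)) s₃ (λ _ s′ →
            (∀ ā → Reflects (ā ∈ consMaybe (recordAt p r) S) (arr s′ g (enc ā))) ×
            reg s′ 2 ≡ p + suc (r * l) × (∀ i → i < f → i ≢ 2 → reg s′ i ≡ reg s i) × (∀ a → a ≢ g → ∀ j → arr s′ a j ≡ arr s a j))
        found nothing e s₃ j≡ = contradiction (trans (sym j≡) (cong is-just e)) λ ()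
        found (just x̄) e s₃ j≡ b≡ r0₃ vs r2₃ kr ka = tri-map
          (λ {_} {s′} (k₄ , here≡ , there≡) →
              (λ ā → subst (λ m → Reflects (ā ∈ consMaybe m S) (arr s′ g (enc ā))) (sym rec≡) (added s′ here≡ there≡ ā))
            , trans (k₄ 2 (≤-trans 2<f (m≤m+n f r))) r2₃
            , (λ i i<f i≢2 → trans (k₄ i (≤-trans i<f (m≤m+n f r))) (kr i i<f i≢2))
            , λ a a≢g j → trans (there≡ a j (inj₁ a≢g)) (ka a j))
          (tri-write (regsFrom f r) x̄ fits (≤-trans (s≤s z≤n) (≤-trans 2<f (m≤m+n f r))) r0₃
            (vals λ i → regsFrom-< f r i , trans (vs i) (inRange-just (nums p r) e i)))
          where
            rec≡ : recordAt p r ≡ just x̄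
            rec≡ = trans (cong (λ b → if b then inRange (nums p r) else nothing) b≡) e
            added : ∀ s′ → arr s′ g (enc x̄) ≡ true → (∀ a′ j → a′ ≢ g ⊎ j ≢ enc x̄ → arr s′ a′ j ≡ arr s₃ a′ j) →
                    ∀ ā → Reflects (ā ∈ x̄ ∷ S) (arr s′ g (enc ā))
            added s′ here≡ there≡ ā with enc ā ≟ enc x̄
            ... | yes q = subst (λ b → Reflects (ā ∈ x̄ ∷ S) b) (sym (trans (cong (arr s′ g) q) here≡)) (ofʸ (here (enc-injective ā x̄ q)))
            ... | no ¬q = reflects-⇔ there (λ { (here e′) → contradiction (cong enc e′) ¬q ; (there m) → m })
                            (subst (Reflects (ā ∈ S)) (sym (trans (there≡ g (enc ā) (inj₂ ¬q)) (ka g (enc ā)))) (table ā))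

    tri-set : ∀ {k r g p s} → reg s 0 ≡ N → reg s 1 ≡ l → reg s 2 ≡ p → p + l ^ k * suc (r * l) ≤ B → Fits {N} r →
      Tri (setP k r g) s (λ _ s′ → reg s′ 0 ≡ N × reg s′ 1 ≡ l × reg s′ 2 ≡ p + l ^ k * suc (r * l) ×
        (∀ a → a < g → ∀ j → arr s′ a j ≡ arr s a j) ×
        (∀ (ā : Vec (Fin N) r) → Reflects (ā ∈ records p r (l ^ k)) (arr s′ g (enc ā))))
    tri-set {k} {r} {g} {p} {s} r0 r1 r2 p≤B fits =
      tri-seq (tri-fill {g = suc g} (λ _ → false) fits (s≤s z≤n) r0 (λ ȳ s₁ _ _ → tri-say (refl , same-refl)) ≤-refl)
      λ _ s₁ (sb , q) → tri-forAll 1 k 3 I (s≤s (s≤s z≤n))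
        (λ kp (i0 , i1 , i2 , ia , it) → trans (keepR kp 0 (s≤s z≤n)) i0 , trans (keepR kp 1 (s≤s (s≤s z≤n))) i1 , trans (keepR kp 2 ≤-refl) i2
          , (λ a l j → trans (keepA kp a j) (ia a l j)) , λ ā → subst (Reflects _) (sym (keepA kp g (enc ā))) (it ā))
        (λ (i0 , i1 , _) → i1)
        ( trans (sbR sb 0 (s≤s z≤n)) r0 , trans (sbR sb 1 (s≤s (s≤s z≤n))) r1 , trans (sbR sb 2 ≤-refl) (trans r2 (sym (+-identityʳ p)))
        , (λ a a<g → sbA sb a (≤-trans a<g (n≤1+n g)) (<⇒≢ a<g)) , λ ā → subst (Reflects _) (sym (q ā)) (ofⁿ λ ()))
        λ ȳ s₂ (i0 , i1 , i2 , ia , it) v → tri-map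
          (λ (t , t2 , tr , ta) →
              ( trans (tr 0 (s≤s z≤n) (λ ())) i0 , trans (tr 1 (s≤s (s≤s z≤n)) (λ ())) i1
              , trans t2 (next (enc ȳ))
              , (λ a a<g j → trans (ta a (<⇒≢ a<g) j) (ia a a<g j)) , t)
            , λ i 3≤i i< → tr i i< (<⇒≢ 3≤i ∘ sym))
          (tri-record r (s≤s (s≤s (s≤s z≤n))) i0 i1 i2
            (≤-trans (≤-reflexive (next (enc ȳ))) (≤-trans (+-monoʳ-≤ p (*-monoˡ-≤ (suc (r * l)) (enc<N^r ȳ))) p≤B)) fits it)
      where
        I : ℕ → Mem → Set
        I q s₁ = reg s₁ 0 ≡ N × reg s₁ 1 ≡ l × reg s₁ 2 ≡ p + q * suc (r * l) ×
          (∀ a → a < g → ∀ j → arr s₁ a j ≡ arr s a j) ×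
          (∀ (ā : Vec (Fin N) r) → Reflects (ā ∈ records p r q) (arr s₁ g (enc ā)))
        next : ∀ q → p + q * suc (r * l) + suc (r * l) ≡ p + suc q * suc (r * l)
        next q = trans (+-assoc p _ _) (cong (p +_) (+-comm (q * suc (r * l)) _))

    tri-prefix : ∀ {Γ g as p s} {e : EnvB N Γ} (φ : LogFormula Γ) → Fits {N} (arityL φ) → p + certLength l φ ≤ B →
                 Ctx 3 g [] as [] e s → reg s 1 ≡ l → reg s 2 ≡ p → Tri (prefixP g as φ) s (λ b _ → b ≡ evL β p φ e)
    tri-prefix (body ψ) fits p≤B c r1 r2 = tri-map proj₁ (tri-eval ψ fits (s≤s z≤n) c)
    tri-prefix {g = g} {p = p} (logEx k r _ _ φ) fits p≤B c r1 r2 =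
      tri-seq (tri-set {k} {r} (Ctx.size≡ c) r1 r2 (≤-trans (+-monoʳ-≤ p (m≤m+n _ _)) p≤B) (λ h → fits (m≤n⇒m≤n⊔o (arityL φ) h)))
      λ _ s₁ (q0 , q1 , q2 , qa , qt) →
      tri-prefix φ (λ h → fits (m≤n⇒m≤o⊔n r h)) (≤-trans (≤-reflexive (+-assoc p _ _)) p≤B)
        (ctx q0 (vals λ ())
          λ { (here refl) ā → ≤-refl , det (qt ā) (proof (ā ∈ᵛ? records p r (l ^ k)))
            ; (there x) ā → let (lt′ , h) = Ctx.rels≡ c x ā in ≤-trans lt′ (n≤1+n g) , trans (qa _ lt′ _) h })
        q1 q2

    -- Repeated doubling in register 3 stops at the right moment: 2 ^ j < N for every j below ⌈log₂
    -- N⌉, and N is at most 2 ^ ⌈log₂ N⌉. Register 1 has counted the doublings.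
    tri-log : ∀ {s} → reg s 0 ≡ N → reg s 1 ≡ 0 → Tri logP s (λ _ s′ → reg s′ 0 ≡ N × reg s′ 1 ≡ l × reg s′ 2 ≡ reg s 2)
    tri-log {s} r0 r1 =
      tri-seq (tri-zero 3) λ _ s₁ (z₁ , o₁) →
      tri-seq (tri-inc₁ (≤-trans (≤-reflexive (cong suc z₁)) (≤-trans (m^n>0 2 l) 2^l≤B))) λ _ s₂ (q₂ , o₂) →
      tri-while (λ n s₃ → reg s₃ 1 + n ≡ l × reg s₃ 3 ≡ 2 ^ reg s₃ 1 × reg s₃ 0 ≡ N × reg s₃ 2 ≡ reg s 2)
        loop
        (≤-trans (<⇒≤ (n<2^n l)) 2^l≤B)
        ( cong (_+ l) (r1₂ o₁ o₂)
        , trans q₂ (trans (cong suc z₁) (cong (2 ^_) (sym (r1₂ o₁ o₂))))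
        , trans (off o₂ (λ ())) (trans (off o₁ (λ ())) r0)
        , trans (off o₂ (λ ())) (off o₁ (λ ())))
      where
        r1₂ : ∀ {s₁ s₂} → Only 3 s s₁ → Only 3 s₁ s₂ → reg s₂ 1 ≡ 0
        r1₂ o₁ o₂ = trans (off o₂ (λ ())) (trans (off o₁ (λ ())) r1)
        I : ℕ → Mem → Set
        I n s₃ = reg s₃ 1 + n ≡ l × reg s₃ 3 ≡ 2 ^ reg s₃ 1 × reg s₃ 0 ≡ N × reg s₃ 2 ≡ reg s 2
        J : Mem → Set
        J s₃ = reg s₃ 0 ≡ N × reg s₃ 1 ≡ l × reg s₃ 2 ≡ reg s 2
        branch : ∀ b n s₄ → b ≡ (2 ^ reg s₄ 1 <ᵇ N) → I n s₄ →
                 if b then (Σ ℕ λ m → n ≡ suc m × Tri (seq (doubleP 3 4 5) (at 1 inc)) s₄ (λ _ → I m)) else J s₄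
        branch true zero s₄ b≡ (i1 , _) = contradiction (reflects-true (<ᵇ-reflects _ N) (sym b≡))
          (≤⇒≯ (≤-trans (n≤2^⌈log₂n⌉ N) (≤-reflexive (cong (2 ^_) (trans (sym i1) (+-identityʳ _))))))
        branch false zero s₄ b≡ (i1 , i3 , i0 , i2) = i0 , trans (sym (+-identityʳ _)) i1 , i2
        branch false (suc m) s₄ b≡ (i1 , _) = contradiction
          (trans b≡ (reflects-intro (<ᵇ-reflects _ N) (<⌈log₂⌉⇒2^< N (≤-trans (m<m+n (reg s₄ 1) (s≤s z≤n)) (≤-reflexive i1))))) λ ()
        branch true (suc m) s₄ b≡ (i1 , i3 , i0 , i2) = m , refl ,
          tri-seq (tri-double {s = s₄} (λ ()) (λ ()) (λ ()) (≤-trans (≤-reflexive double≡) 2^≤B)) λ _ s₅ (q₅ , o₅ , _) →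
          let r1₅ = o₅ 1 (λ ()) (λ ()) (λ ()) in
          tri-map (λ (q₆ , o₆) → let r1₆ = trans q₆ (cong suc r1₅) in
              trans (cong (_+ m) r1₆) (trans (sym (+-suc _ m)) i1)
            , trans (off o₆ (λ ())) (trans q₅ (trans double≡ (cong (2 ^_) (sym r1₆))))
            , trans (off o₆ (λ ())) (trans (o₅ 0 (λ ()) (λ ()) (λ ())) i0)
            , trans (off o₆ (λ ())) (trans (o₅ 2 (λ ()) (λ ()) (λ ())) i2))
            (tri-inc₁ (≤-trans (≤-reflexive (cong suc r1₅)) (≤-trans 1+≤l (≤-trans (<⇒≤ (n<2^n l)) 2^l≤B))))
          where
            1+≤l : suc (reg s₄ 1) ≤ l
            1+≤l = ≤-trans (m<m+n (reg s₄ 1) (s≤s z≤n)) (≤-reflexive i1)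
            double≡ : reg s₄ 3 + reg s₄ 3 ≡ 2 ^ suc (reg s₄ 1)
            double≡ = trans (cong₂ _+_ i3 i3) (cong (2 ^ reg s₄ 1 +_) (sym (+-identityʳ _)))
            2^≤B : 2 ^ suc (reg s₄ 1) ≤ B
            2^≤B = ≤-trans (^-monoʳ-≤ 2 1+≤l) 2^l≤B
        loop : ∀ n s₃ → I n s₃ → Tri (ltP 4 3 0) s₃ (λ b s₄ →
                 if b then (Σ ℕ λ m → n ≡ suc m × Tri (seq (doubleP 3 4 5) (at 1 inc)) s₄ (λ _ → I m)) else J s₄)
        loop n s₃ (i1 , i3 , i0 , i2) = tri-map
          (λ {b} {s₄} (b≡ , k) →
            let r1₄ = keepR k 1 (s≤s (s≤s z≤n)) in
            branch b n s₄ (trans b≡ (cong₂ _<ᵇ_ (trans i3 (cong (2 ^_) (sym r1₄))) i0))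
              ( trans (cong (_+ n) r1₄) i1 , trans (keepR k 3 ≤-refl) (trans i3 (cong (2 ^_) (sym r1₄)))
              , trans (keepR k 0 (s≤s z≤n)) i0 , trans (keepR k 2 (s≤s (s≤s (s≤s z≤n)))) i2))
          (tri-lt {f = 4} {3} {0} ≤-refl (s≤s z≤n))

  tri-scan : ∀ {n s} → n ≤ B → input n ≡ nothing → (∀ i → i < n → input i ≢ nothing) → N ≤ n → suc N ≤ B →
             (∀ i → N < i → input i ≢ just s#) → input N ≡ just s# ⊎ N ≡ 0 →
             reg s 0 ≡ 0 → reg s 1 ≡ 0 → reg s 2 ≡ 0 →
             Tri scanP s (λ _ s′ → reg s′ 0 ≡ N × reg s′ 1 ≡ 0 × reg s′ 2 ≡ suc N)
  tri-scan {n} {s} n≤B end notEnd N≤n N<B notHash hash r0 r1 r2 =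
    tri-seq (tri-while (λ m s₁ → reg s₁ 2 + m ≡ n × Only 2 s s₁)
      (λ m s₁ (q , o) → tri-not (tri-symb (forward m s₁ q o)))
      n≤B (cong (_+ n) r2 , only-refl))
    λ _ s₁ (q₁ , o₁) →
    tri-seq (tri-while (λ m s₂ → reg s₂ 2 ≡ N + m × Only 2 s s₂) backward
      (≤-trans (m∸n≤m n N) n≤B) (trans q₁ (sym (m+[n∸m]≡n N≤n)) , o₁))
    λ _ s₂ (q₂ , o₂) →
    let r0₂ = trans (off o₂ (λ ())) r0 in
    tri-seq (tri-add {s = s₂} (λ ()) (λ ()) (λ ()) (≤-trans (≤-reflexive (cong₂ _+_ r0₂ q₂)) (≤-trans (n≤1+n N) N<B)))
    λ _ s₃ (q₃ , o₃) →
    let r2₃ = trans (otherR o₃ (λ ()) (λ ())) q₂ in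
    tri-map (λ (q₄ , o₄) → trans (off o₄ (λ ())) (trans q₃ (cong₂ _+_ r0₂ q₂))
      , trans (off o₄ (λ ())) (trans (otherR o₃ (λ ()) (λ ())) (trans (off o₂ (λ ())) r1))
      , trans q₄ (cong suc r2₃))
      (tri-inc₁ (≤-trans (≤-reflexive (cong suc r2₃)) N<B))
    where
      forward : ∀ m s₁ → reg s₁ 2 + m ≡ n → Only 2 s s₁ →
        if not (does (input (reg s₁ 2) ≟ᵐ nothing))
        then (Σ ℕ λ m′ → m ≡ suc m′ × Tri (at 2 inc) s₁ (λ _ s₂ → reg s₂ 2 + m′ ≡ n × Only 2 s s₂))
        else (reg s₁ 2 ≡ n × Only 2 s s₁)
      forward m s₁ q o with input (reg s₁ 2) ≟ᵐ nothing
      forward zero    s₁ q o | yes _ = trans (sym (+-identityʳ _)) q , o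
      forward (suc m) s₁ q o | yes e = contradiction e (notEnd _ (≤-trans (m<m+n (reg s₁ 2) (s≤s z≤n)) (≤-reflexive q)))
      forward zero    s₁ q o | no ¬e = contradiction (trans (cong input (trans (sym (+-identityʳ _)) q)) end) ¬e
      forward (suc m) s₁ q o | no ¬e = m , refl , tri-map
        (λ (q₂ , o₂) → trans (cong (_+ m) q₂) (trans (sym (+-suc _ m)) q) , only-trans o o₂)
        (tri-inc₁ (≤-trans (≤-trans (m<m+n (reg s₁ 2) (s≤s z≤n)) (≤-reflexive q)) n≤B))
      J : Mem → Set
      J s₂ = reg s₂ 2 ≡ N × Only 2 s s₂
      backward : ∀ m s₂ → reg s₂ 2 ≡ N + m × Only 2 s s₂ →
        Tri (ite (at 2 (symb (just s#))) (at 0 (say false)) (at 2 dec)) s₂ (λ b s₃ →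
          if b then (Σ ℕ λ m′ → m ≡ suc m′ × Tri (at 0 (say true)) s₃ (λ _ s₄ → reg s₄ 2 ≡ N + m′ × Only 2 s s₄)) else J s₃)
      backward zero s₂ (q , o) with input (reg s₂ 2) ≟ᵐ just s# in e₁
      ... | yes _ = tri-ite (tri-symb {Φ = λ b s₃ → b ≡ true × s₃ ≡ s₂} (cong does e₁ , refl))
          (λ { _ (_ , refl) → tri-say (trans q (+-identityʳ N) , o) }) (λ { _ (() , _) })
      ... | no ¬e = tri-ite (tri-symb {Φ = λ b s₃ → b ≡ false × s₃ ≡ s₂} (cong does e₁ , refl)) (λ { _ (() , _) })
          (λ { _ (_ , refl) → tri-dec (λ _ → trans q (+-identityʳ N) , o)
                 (λ k k≡ → contradiction (trans (sym k≡) (trans q (trans (+-identityʳ N) (N≡0 hash)))) λ ()) })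
        where
          N≡0 : input N ≡ just s# ⊎ N ≡ 0 → N ≡ 0
          N≡0 (inj₁ e) = contradiction (trans (cong input (trans q (+-identityʳ N))) e) ¬e
          N≡0 (inj₂ z) = z
      backward (suc m) s₂ (q , o) with input (reg s₂ 2) ≟ᵐ just s# in e₁
      ... | yes e = contradiction e (notHash _ (≤-trans (m<m+n N (s≤s z≤n)) (≤-reflexive (sym q))))
      ... | no _  = tri-ite (tri-symb {Φ = λ b s₃ → b ≡ false × s₃ ≡ s₂} (cong does e₁ , refl)) (λ { _ (() , _) })
          (λ { _ (_ , refl) → tri-dec (λ z → contradiction (trans (sym z) (trans q (+-suc N m))) λ ())
                 (λ k k≡ → m , refl , tri-say (trans (upd-same (reg s₂) 2 k) (suc-injective (trans (sym k≡) (trans q (+-suc N m))))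
                   , only-trans o (only-setR s₂ k))) })

  tri-check : ∀ {n} (φ : Sentence) → n ≤ B → input n ≡ nothing → (∀ i → i < n → input i ≢ nothing) → N ≤ n →
              (∀ i → N < i → input i ≢ just s#) → input N ≡ just s# ⊎ N ≡ 0 →
              2 ^ l ≤ B → Fits {N} (arityL φ) → suc N + certLength l φ ≤ B →
              Tri (checkP φ) initMem (λ b _ → b ≡ evL β (suc N) φ [])
  tri-check φ n≤B end notEnd N≤n notHash hash 2^l≤B fits p≤B =
    tri-seq (tri-scan n≤B end notEnd N≤n (≤-trans (m≤m+n (suc N) _) p≤B) notHash hash refl refl refl) λ _ s₁ (q0 , q1 , q2) →
    tri-seq (tri-log 2^l≤B q0 q1) λ _ s₂ (z0 , z1 , z2) →
    tri-prefix 2^l≤B φ fits p≤B (ctx z0 (vals λ ()) (λ ())) z1 (trans z2 q2)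

-- From sentences to machines

inputOf-end : ∀ w → inputOf w (length w) ≡ nothing
inputOf-end []      = refl
inputOf-end (x ∷ w) = inputOf-end w

inputOf-inside : ∀ w i → i < length w → inputOf w i ≢ nothing
inputOf-inside (x ∷ w) zero    _       ()
inputOf-inside (x ∷ w) (suc i) (s≤s l) = inputOf-inside w i l

inputOf-++ˡ : ∀ u z i → inputOf (u ++ z) (toℕ i) ≡ just (List.lookup u i)
inputOf-++ˡ (x ∷ u) z zero    = refl
inputOf-++ˡ (x ∷ u) z (suc i) = inputOf-++ˡ u z i

inputOf-++ʳ : ∀ u z j → inputOf (u ++ z) (length u + j) ≡ inputOf z j
inputOf-++ʳ []      z j = refl
inputOf-++ʳ (x ∷ u) z j = inputOf-++ʳ u z j

inputOf-bits : ∀ v j → inputOf (map bitSym v) j ≢ just s#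
inputOf-bits (false ∷ v) zero    ()
inputOf-bits (true  ∷ v) zero    ()
inputOf-bits (_ ∷ v)     (suc j) = inputOf-bits v j

-- The verifier must halt on arbitrary strings. Cutting each one at its last separator, or at the
-- front if there is none, brings it into the shape for which `scanP` is analysed.
splitHash : ∀ w → Σ Str λ u → Σ Str λ z → w ≡ u ++ z ×
            (∀ j → inputOf z (suc j) ≢ just s#) × (inputOf z 0 ≡ just s# ⊎ u ≡ [])
splitHash [] = [] , [] , refl , (λ _ ()) , inj₂ refl
splitHash (x ∷ w) with splitHash w
... | u , z , refl , h , inj₁ e = x ∷ u , z , refl , h , inj₁ e
... | .[] , z , refl , h , inj₂ refl with inputOf z 0 ≟ᵐ just s#
...   | yes e = x ∷ [] , z , refl , h , inj₁ e
...   | no ¬e = [] , x ∷ z , refl , (λ { zero → ¬e ; (suc j) → h j }) , inj₂ refl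

certExponent certFactor : Sentence → ℕ
certFactor   φ = proj₁ (certLength-≤ φ)
certExponent φ = proj₁ (proj₂ (certLength-≤ φ))

-- The summands cover, in this order, the codes of tuples, the powers of two up to 2 ^ ⌈log₂ N⌉, and
-- the last position read, which may lie beyond the input if the certificate is too short. The base
-- n + 2 keeps powers monotone in the exponent.
checkBound : Sentence → ℕ → ℕ
checkBound φ n = (n + 2) ^ arityL φ + (2 * (n + 2) + (suc n + certFactor φ * (n + 2) ^ certExponent φ))

polyBounded-checkBound : ∀ φ → PolyBounded (checkBound φ)
polyBounded-checkBound φ =
  polyBounded-+ (0 , arityL φ , λ n → ≤-refl)
    (polyBounded-+ (polyBounded-* (polyBounded-const 2) linear)
      (polyBounded-+ (polyBounded-≤ (λ n → ≤-trans (s≤s (m≤m+n n 1)) (≤-reflexive (sym (+-suc n 1)))) linear)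
        (polyBounded-* (polyBounded-const (certFactor φ)) (0 , certExponent φ , λ n → ≤-refl))))
  where
    linear : PolyBounded (_+ 2)
    linear = 0 , 1 , λ n → ≤-reflexive (sym (*-identityʳ (n + 2)))

module FromSentence (φ : Sentence) (M : TM) (pc pd : ℕ)
  (M-correct : ∀ w {b s′} → Semantics.Exec (inputOf w) (checkBound φ (length w)) (checkP φ) initMem b s′ →
     stateAfter M (poly pc pd (length w)) w ≡ (if b then TM.acc M else TM.rej M)) where

  private
    c = certFactor φ
    k = certExponent φ

  verdict : (u z : Str) → Bool
  verdict u z = CertEval.evL u (λ p → does (inputOf (u ++ z) p ≟ᵐ just s1)) (suc (length u)) φ []

  M-run : ∀ u z → (∀ j → inputOf z (suc j) ≢ just s#) → (inputOf z 0 ≡ just s# ⊎ u ≡ []) →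
          stateAfter M (poly pc pd (length (u ++ z))) (u ++ z) ≡ (if verdict u z then TM.acc M else TM.rej M)
  M-run u z notHash hash = finish
    (CertCheck.tri-check u (inputOf w) B (inputOf-++ˡ u z) {n} φ n≤B (inputOf-end w) (inputOf-inside w) N≤n notHash′ hash′ 2^l≤B fits p≤B
      (λ _ → z≤n))
    where
      w = u ++ z
      n = length w
      N = length u
      l = ⌈log₂ N ⌉
      B = checkBound φ n
      N≤n : N ≤ n
      N≤n = ≤-trans (m≤m+n N (length z)) (≤-reflexive (sym (Listₚ.length-++ u)))
      N≤n+2 : N ≤ n + 2
      N≤n+2 = ≤-trans N≤n (m≤m+n n 2)
      n≤B : n ≤ B
      n≤B = ≤-trans (≤-trans (≤-trans (n≤1+n n) (m≤m+n (suc n) _)) (m≤n+m _ (2 * (n + 2)))) (m≤n+m _ ((n + 2) ^ arityL φ))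
      2^l≤B : 2 ^ l ≤ B
      2^l≤B = ≤-trans (2^⌈log₂n⌉≤1+2n N) (≤-trans (≤-trans
        (≤-trans (s≤s (*-monoʳ-≤ 2 N≤n)) (≤-trans (m≤n+m (suc (2 * n)) 3) (≤-reflexive (solve n))))
        (m≤m+n (2 * (n + 2)) _)) (m≤n+m _ ((n + 2) ^ arityL φ)))
        where
          solve : ∀ n → 3 + suc (2 * n) ≡ 2 * (n + 2)
          solve = solve-∀
      fits : ∀ {r} → r ≤ arityL φ → N ^ r ≤ B
      fits r≤ = ≤-trans (^-mono {{>-nonZero (≤-trans (s≤s z≤n) (m≤n+m 2 n))}} N≤n+2 r≤) (m≤m+n _ _)
      p≤B : suc N + certLength l φ ≤ B
      p≤B = ≤-trans (≤-trans (+-mono-≤ (s≤s N≤n)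
        (≤-trans (proj₂ (proj₂ (certLength-≤ φ)) l) (*-monoʳ-≤ c (^-monoˡ-≤ k (≤-trans (⌈log₂n⌉≤n N) N≤n+2)))))
        (m≤n+m _ (2 * (n + 2)))) (m≤n+m _ ((n + 2) ^ arityL φ))
      notHash′ : ∀ i → N < i → inputOf w i ≢ just s#
      notHash′ i N<i e = notHash (i ∸ suc N) (trans (sym (inputOf-++ʳ u z (suc (i ∸ suc N))))
        (trans (cong (inputOf w) (trans (+-suc N (i ∸ suc N)) (m+[n∸m]≡n N<i))) e))
      hash′ : inputOf w N ≡ just s# ⊎ N ≡ 0
      hash′ = Sum.map (λ e → trans (trans (cong (inputOf w) (sym (+-identityʳ N))) (inputOf-++ʳ u z 0)) e) (cong length) hash
      finish : (Σ Bool λ b → Σ Mem λ s′ → Semantics.Exec (inputOf w) B (checkP φ) initMem b s′ ×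
                  Hoare.Bounded (inputOf w) B s′ × b ≡ verdict u z) →
               stateAfter M (poly pc pd n) w ≡ (if verdict u z then TM.acc M else TM.rej M)
      finish (b , s′ , run₀ , _ , refl) = M-correct w run₀

  M-halts : ∀ w → Halted M (stateAfter M (poly pc pd (length w)) w)
  M-halts w with splitHash w
  ... | u , z , refl , h , e = subst (Halted M) (sym (M-run u z h e)) (halted-if (verdict u z))
    where
      halted-if : ∀ b → Halted M (if b then TM.acc M else TM.rej M)
      halted-if true  = inj₁ refl
      halted-if false = inj₂ refl

  machine : βPMachine
  machine = record { verifier = M ; k = k ; c = c ; pc = pc ; pd = pd ; halts = M-halts }

  accepts⇔sat : ∀ u → βPMachine.Accepts machine u ⇔ (u ⊨ φ)
  accepts⇔sat u = mk⇔
    (λ (v , _ , a) → CertEval.evL-sound u _ (suc N) φ (λ ()) (acc-true (verdict u (s# ∷ map bitSym v)) (trans (sym (run-# v)) a)))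
    λ t → let (v , len , h) = CertEval.evL-complete u φ (λ ()) t in
      v , ≤-trans (≤-reflexive len) (proj₂ (proj₂ (certLength-≤ φ)) ⌈log₂ N ⌉) ,
      trans (run-# v) (cong (λ b → if b then TM.acc M else TM.rej M) (h _ (suc N) (spelled v)))
    where
      N = length u
      run-# : ∀ v → stateAfter M (poly pc pd (length (u # v))) (u # v) ≡ (if verdict u (s# ∷ map bitSym v) then TM.acc M else TM.rej M)
      run-# v = M-run u (s# ∷ map bitSym v) (inputOf-bits v) (inj₁ refl)
      acc-true : ∀ b → (if b then TM.acc M else TM.rej M) ≡ TM.acc M → b ≡ true
      acc-true true  _ = refl
      acc-true false e = contradiction (sym e) (TM.acc≢rej M)
      bit≡ : ∀ v j → j < length v → does (inputOf (map bitSym v) j ≟ᵐ just s1) ≡ nth false v j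
      bit≡ (true ∷ v)  zero    _       = refl
      bit≡ (false ∷ v) zero    _       = refl
      bit≡ (b ∷ v)     (suc j) (s≤s l) = bit≡ v j l
      spelled : ∀ v → Spells (λ p → does (inputOf (u # v) p ≟ᵐ just s1)) (suc N) v
      spelled v = mkSpells λ j l → trans
        (cong (λ x → does (x ≟ᵐ just s1)) (trans (cong (inputOf (u # v)) (sym (+-suc N j))) (inputOf-++ʳ u (s# ∷ map bitSym v) (suc j))))
        (bit≡ v j l)

sentence⇒machine : (φ : Sentence) → Σ βPMachine λ M → ∀ u → βPMachine.Accepts M u ⇔ (u ⊨ φ)
sentence⇒machine φ = pack (turingMachine (checkP φ) (polyBounded-checkBound φ))
  where
    pack : (Σ TM λ M → Σ ℕ λ pc → Σ ℕ λ pd → ∀ w {b s′} →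
              Semantics.Exec (inputOf w) (checkBound φ (length w)) (checkP φ) initMem b s′ →
              stateAfter M (poly pc pd (length w)) w ≡ (if b then TM.acc M else TM.rej M)) →
           Σ βPMachine λ M → ∀ u → βPMachine.Accepts M u ⇔ (u ⊨ φ)
    pack (M , pc , pd , h) = FromSentence.machine φ M pc pd h , FromSentence.accepts⇔sat φ M pc pd h

-- Definable relations on tuples

-- No element differs from itself, so this is false in every universe, and its negation is true even
-- in the empty one.
ffF : ∀ {n Γ} → Formula n Γ
ffF = ex (neg (eq zero zero))

disj : ∀ {n Γ} → Formula n Γ → Formula n Γ → Formula n Γ
disj φ ψ = neg (conj (neg φ) (neg ψ))

orF : ∀ {n Γ} k → (Fin k → Formula n Γ) → Formula n Γ
orF zero    F = ffF
orF (suc k) F = disj (F zero) (orF k (F ∘ suc))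

-- For conditions on the machine that are settled when the formula is written down, such as a match
-- with an entry of its transition table.
guardF : ∀ {A : Set} {n Γ} → Dec A → Formula n Γ → Formula n Γ
guardF (yes _) φ = φ
guardF (no _)  φ = ffF

exV : ∀ {n Γ} r → Formula (r + n) Γ → Formula n Γ
exV zero    φ = φ
exV (suc r) φ = exV r (ex φ)

new : ∀ {n} r → Vec (Fin (r + n)) r
new {n} r = Vec.tabulate (_↑ˡ n)

old : ∀ {n m} r → Vec (Fin n) m → Vec (Fin (r + n)) m
old r = Vec.map (r ↑ʳ_)

eqV : ∀ {n Γ r} → Vec (Fin n) r → Vec (Fin n) r → Formula n Γ
eqV []       []       = neg ffF
eqV (x ∷ xs) (y ∷ ys) = conj (eq x y) (eqV xs ys)

ltV : ∀ {n Γ r} → Vec (Fin n) r → Vec (Fin n) r → Formula n Γ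
ltV []       []       = ffF
ltV (x ∷ xs) (y ∷ ys) = disj (ltV xs ys) (conj (eqV xs ys) (lt x y))

succV : ∀ {n Γ r} → Vec (Fin n) r → Vec (Fin n) r → Formula n Γ
succV {r = r} xs ys = conj (ltV xs ys) (neg (exV r (conj (ltV (old r xs) (new r)) (ltV (new r) (old r ys)))))

zeroV : ∀ {n Γ r} → Vec (Fin n) r → Formula n Γ
zeroV {r = r} xs = neg (exV r (ltV (new r) (old r xs)))

positive : ∀ {n Γ} → Fin n → Formula n Γ
positive x = ex (lt zero (suc x))

-- A tuple codes the tag i if its first nonzero entry is the i-th one.
tagF : ∀ {n Γ k} → Fin k → Vec (Fin n) k → Formula n Γ
tagF zero    (x ∷ xs) = positive x
tagF (suc i) (x ∷ xs) = conj (neg (positive x)) (tagF i xs)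

Tag : ∀ {N k} → Fin k → Vec (Fin N) k → Set
Tag zero    (a ∷ as) = 0 < toℕ a
Tag (suc i) (a ∷ as) = ¬ (0 < toℕ a) × Tag i as

tag-unique : ∀ {N k} (i j : Fin k) (s̄ : Vec (Fin N) k) → Tag i s̄ → Tag j s̄ → i ≡ j
tag-unique zero    zero    (a ∷ as) p q = refl
tag-unique zero    (suc j) (a ∷ as) p (¬q , _) = contradiction p ¬q
tag-unique (suc i) zero    (a ∷ as) (¬p , _) q = contradiction q ¬p
tag-unique (suc i) (suc j) (a ∷ as) (_ , p) (_ , q) = cong suc (tag-unique i j as p q)

-- The universe may be smaller than the number of states and symbols, so single elements cannot name
-- them. A tuple with one entry per name can, as soon as there is a nonzero element; this is one
-- place where short strings have to be excluded.
tag-exists : ∀ {N k} → 2 ≤ N → (i : Fin k) → Σ (Vec (Fin N) k) (Tag i)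
tag-exists {suc (suc N)} (s≤s (s≤s z≤n)) zero = Vec.replicate _ (suc zero) , s≤s z≤n
tag-exists h@(s≤s (s≤s z≤n)) (suc i) = let (s̄ , t) = tag-exists h i in zero ∷ s̄ , (λ ()) , t

-- `disj` is built by De Morgan's law; it yields an actual choice between A and B because both are
-- decided.
disj-reflects : ∀ {A B : Set} {a b} → Reflects A a → Reflects B b → Reflects (A ⊎ B) (not (not a ∧ not b))
disj-reflects (ofʸ a)  _        = ofʸ (inj₁ a)
disj-reflects (ofⁿ ¬a) (ofʸ b)  = ofʸ (inj₂ b)
disj-reflects (ofⁿ ¬a) (ofⁿ ¬b) = ofⁿ [ ¬a , ¬b ]

-- Meaning of the defined relations on tuples

module Definable (u : Str) where
  open Sem u using (N)
  open Eval u

  Den : ∀ {n r} → Vec (Fin N) n → Vec (Fin n) r → Vec (Fin N) r → Set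
  Den ρ xs ā = Vec.map (Vec.lookup ρ) xs ≡ ā

  den-tabulate : ∀ {n r} {ρ : Vec (Fin N) n} (f : Fin r → Fin n) {ā : Vec (Fin N) r} →
                 (∀ i → Vec.lookup ρ (f i) ≡ Vec.lookup ā i) → Den ρ (Vec.tabulate f) ā
  den-tabulate {ρ = ρ} f {ā} h = trans (sym (Vecₚ.tabulate-∘ (Vec.lookup ρ) f))
    (trans (Vecₚ.tabulate-cong h) (Vecₚ.tabulate∘lookup ā))

  den-new : ∀ {n r} {ρ : Vec (Fin N) n} (ā : Vec (Fin N) r) → Den (ā Vec.++ ρ) (new r) ā
  den-new {ρ = ρ} ā = den-tabulate {ρ = ā Vec.++ ρ} _ (λ i → Vecₚ.lookup-++ˡ ā ρ i)

  den-old : ∀ {n m r} {ρ : Vec (Fin N) n} {xs : Vec (Fin n) m} {b̄ : Vec (Fin N) m} (ā : Vec (Fin N) r) →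
            Den ρ xs b̄ → Den (ā Vec.++ ρ) (old r xs) b̄
  den-old {r = r} {ρ} {xs} ā h = trans (sym (Vecₚ.map-∘ (Vec.lookup (ā Vec.++ ρ)) (r ↑ʳ_) xs))
    (trans (Vecₚ.map-cong (λ i → Vecₚ.lookup-++ʳ ā ρ i) xs) h)

  den-++ : ∀ {n m r} {ρ : Vec (Fin N) n} (xs : Vec (Fin n) m) {ys : Vec (Fin n) r} {ā b̄} →
           Den ρ xs ā → Den ρ ys b̄ → Den ρ (xs Vec.++ ys) (ā Vec.++ b̄)
  den-++ {ρ = ρ} xs {ys} refl refl = Vecₚ.map-++ (Vec.lookup ρ) xs ys

  module _ {n Γ} {ρ : Vec (Fin N) n} {e : EnvB N Γ} where

    ff-reflects : Reflects ⊥ (ev ffF ρ e)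
    ff-reflects = reflects-⇔ (λ (a , h) → h refl) (λ ())
      (anyᶠ-reflects {N} λ a → ¬-reflects (proof (a Fin.≟ a)))

    orF-reflects : ∀ {k} {F : Fin k → Formula n Γ} {A : Fin k → Set} → (∀ i → Reflects (A i) (ev (F i) ρ e)) →
                   Reflects (Σ (Fin k) A) (ev (orF k F) ρ e)
    orF-reflects {zero}  h = reflects-⇔ (λ ()) (λ ()) ff-reflects
    orF-reflects {suc k} {F} {A} h = reflects-⇔
      [ (zero ,_) , (λ (i , a) → suc i , a) ]
      (λ { (zero , a) → inj₁ a ; (suc i , a) → inj₂ (i , a) })
      (disj-reflects (h zero) (orF-reflects {k} {F ∘ suc} {A ∘ suc} (h ∘ suc)))

    guard-reflects : ∀ {A B : Set} (d : Dec A) {φ : Formula n Γ} → Reflects B (ev φ ρ e) →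
                     Reflects (A × B) (ev (guardF d φ) ρ e)
    guard-reflects (yes a) h = reflects-⇔ (a ,_) proj₂ h
    guard-reflects (no ¬a) h = reflects-⇔ (λ ()) (λ (a , _) → ¬a a) ff-reflects

    tt-reflects : Reflects ⊤ (ev (neg ffF) ρ e)
    tt-reflects = reflects-⇔ (λ _ → tt) (λ _ ()) (¬-reflects ff-reflects)

  exV-reflects : ∀ {n Γ} r {φ : Formula (r + n) Γ} {ρ : Vec (Fin N) n} {e} {A : Vec (Fin N) r → Set} →
                 (∀ ā → Reflects (A ā) (ev φ (ā Vec.++ ρ) e)) → Reflects (Σ (Vec (Fin N) r) A) (ev (exV r φ) ρ e)
  exV-reflects zero    h = reflects-⇔ ([] ,_) (λ { ([] , a) → a }) (h [])
  exV-reflects (suc r) h = reflects-⇔ (λ (ā , a , x) → a ∷ ā , x) (λ { (a ∷ ā , x) → ā , a , x })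
    (exV-reflects r λ ā → anyᶠ-reflects λ a → h (a ∷ ā))

  module _ {n Γ} {ρ : Vec (Fin N) n} {e : EnvB N Γ} where

    eqV-reflects : ∀ {r} (xs ys : Vec (Fin n) r) {ā b̄} → Den ρ xs ā → Den ρ ys b̄ → Reflects (ā ≡ b̄) (ev (eqV xs ys) ρ e)
    eqV-reflects []       []       refl refl = reflects-⇔ (λ _ → refl) (λ _ → tt) (tt-reflects {n} {Γ} {ρ} {e})
    eqV-reflects (x ∷ xs) (y ∷ ys) refl refl = reflects-⇔ (λ (p , q) → cong₂ _∷_ p q) Vecₚ.∷-injective
      (proof (Vec.lookup ρ x Fin.≟ Vec.lookup ρ y) ×-reflects eqV-reflects xs ys refl refl)

    ltV-reflects : ∀ {r} (xs ys : Vec (Fin n) r) {ā b̄} → Den ρ xs ā → Den ρ ys b̄ → Reflects (enc ā < enc b̄) (ev (ltV xs ys) ρ e)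
    ltV-reflects []       []       refl refl = reflects-⇔ (λ ()) (λ ()) (ff-reflects {n} {Γ} {ρ} {e})
    ltV-reflects (x ∷ xs) (y ∷ ys) refl refl = reflects-⇔
      (λ { (inj₁ l) → ≤-trans (m+n*o≤n*[1+o] {suc (toℕ a)} (enc ā) (Finₚ.toℕ<n a)) (≤-trans (*-monoʳ-≤ N l) (m≤n+m _ (toℕ b)))
         ; (inj₂ (q , l)) → +-mono-<-≤ l (≤-reflexive (cong (λ z → N * enc z) q)) })
      lex
      (disj-reflects (ltV-reflects xs ys refl refl)
        (eqV-reflects xs ys refl refl ×-reflects <ᵇ-reflects (toℕ a) (toℕ b)))
      where
        a = Vec.lookup ρ x
        b = Vec.lookup ρ y
        ā = Vec.map (Vec.lookup ρ) xs
        b̄ = Vec.map (Vec.lookup ρ) ys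
        lex : toℕ a + N * enc ā < toℕ b + N * enc b̄ → enc ā < enc b̄ ⊎ (ā ≡ b̄ × toℕ a < toℕ b)
        lex l with <-cmp (enc ā) (enc b̄)
        ... | tri< p _ _ = inj₁ p
        ... | tri≈ _ q _ = inj₂ (enc-injective ā b̄ q , +-cancelʳ-< (N * enc ā) (toℕ a) (toℕ b) (subst (λ z → toℕ a + N * enc ā < toℕ b + N * z) (sym q) l))
        ... | tri> _ _ p = contradiction l (≤⇒≯ (≤-trans (≤-trans (≤-trans (n≤1+n _) (m+n*o≤n*[1+o] {suc (toℕ b)} (enc b̄) (Finₚ.toℕ<n b))) (*-monoʳ-≤ N p)) (m≤n+m _ (toℕ a))))

  module _ {n Γ} {ρ : Vec (Fin N) n} {e : EnvB N Γ} where

    -- Every number below N ^ r is the code of a tuple, so the absence of a tuple in between is the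
    -- absence of a number in between. The same argument serves `zeroV` and `isN`.
    succV-reflects : ∀ {r} (xs ys : Vec (Fin n) r) {ā b̄} → Den ρ xs ā → Den ρ ys b̄ →
                     Reflects (suc (enc ā) ≡ enc b̄) (ev (succV xs ys) ρ e)
    succV-reflects {r} xs ys {ā} {b̄} p q = reflects-⇔
      (λ (l , none) → ≤-antisym l (≮⇒≥ λ l′ →
        let (z̄ , h) = enc-surjective r (<-trans l′ (enc<N^r b̄)) in
        none (z̄ , ≤-reflexive (sym h) , ≤-trans (≤-reflexive (cong suc h)) l′)))
      (λ s → ≤-reflexive s , λ (z̄ , l , l′) → <⇒≱ l′ (≤-trans (≤-reflexive (sym s)) l))
      (ltV-reflects xs ys p q ×-reflects ¬-reflects (exV-reflects r λ z̄ →
        ltV-reflects (old r xs) (new r) (den-old z̄ p) (den-new z̄) ×-reflects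
        ltV-reflects (new r) (old r ys) (den-new z̄) (den-old z̄ q)))

    zeroV-reflects : ∀ {r} (xs : Vec (Fin n) r) {ā} → Den ρ xs ā → Reflects (enc ā ≡ 0) (ev (zeroV xs) ρ e)
    zeroV-reflects {r} xs {ā} p = reflects-⇔
      (λ none → n≤0⇒n≡0 (≮⇒≥ λ l →
        let (z̄ , h) = enc-surjective r (<-trans l (enc<N^r ā)) in none (z̄ , ≤-trans (≤-reflexive (cong suc h)) l)))
      (λ z (z̄ , l) → n≮0 (≤-trans l (≤-reflexive z)))
      (¬-reflects (exV-reflects r λ z̄ → ltV-reflects (new r) (old r xs) (den-new z̄) (den-old z̄ p)))

    positive-reflects : ∀ x → Reflects (0 < toℕ (Vec.lookup ρ x)) (ev {n} {Γ} (positive x) ρ e)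
    positive-reflects x = reflects-⇔ (λ (a , l) → ≤-trans (s≤s z≤n) l) (below (Vec.lookup ρ x))
      (anyᶠ-reflects λ a → <ᵇ-reflects (toℕ a) (toℕ (Vec.lookup ρ x)))
      where
        below : ∀ {m} (b : Fin m) → 0 < toℕ b → Σ (Fin m) λ a → toℕ a < toℕ b
        below (suc b) _ = zero , s≤s z≤n

    tagF-reflects : ∀ {k} (i : Fin k) (xs : Vec (Fin n) k) {ā} → Den ρ xs ā → Reflects (Tag i ā) (ev {n} {Γ} (tagF i xs) ρ e)
    tagF-reflects zero    (x ∷ xs) refl = positive-reflects x
    tagF-reflects (suc i) (x ∷ xs) refl = ¬-reflects (positive-reflects x) ×-reflects tagF-reflects i xs refl

-- Describing machine runs

-- A numeral below N consists of its least significant digit alone, and this digit is then the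
-- element of the string at that position.
belowN : ∀ {n Γ r} → Vec (Fin n) (suc r) → Formula n Γ
belowN p = zeroV (Vec.tail p)

isN : ∀ {n Γ r} → Vec (Fin n) (suc r) → Formula n Γ
isN {r = r} p = conj (neg (belowN p))
  (neg (exV (suc r) (conj (neg (belowN (new (suc r)))) (ltV (new (suc r)) (old (suc r) p)))))

moveF : ∀ {n Γ r} → Move → Vec (Fin n) r → Vec (Fin n) r → Formula n Γ
moveF mS p p′ = eqV p p′
moveF mR p p′ = succV p p′
moveF mL p p′ = disj (succV p′ p) (conj (zeroV p) (eqV p p′))

allSyms : Fin 5 → Sym
allSyms = Finite.decode finite-Sym

-- Position p of the tape initially holds symbol number p of u # v.  The bits of v are given
-- by a relation X: X(b,p) for some b ≠ 0 means that position p holds 1; ē is the end of u # v.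
module RunFormula (M : TM) (r′ : ℕ) where
  open TM M using (nQ; nG; start; blank; inp) renaming (acc to qacc)
  open TapeOf M using (δ̂)

  r K D : ℕ
  r = suc r′
  K = nQ + nG
  D = r + (r + K)

  SetF : List ℕ → Set
  SetF Γ = ∀ {n} → Vec (Fin n) (suc r) → Formula n Γ

  bitF : ∀ {n Γ} → SetF Γ → Vec (Fin n) r → Formula n Γ
  bitF X p = exV 1 (conj (positive zero) (X (zero ∷ old 1 p)))

  domF : ∀ {n Γ} → SetF Γ → Vec (Fin n) r → Formula n Γ
  domF X p = exV 1 (X (zero ∷ old 1 p))

  betweenF : ∀ {n Γ} (ē p : Vec (Fin n) r) → Formula n Γ
  betweenF ē p = conj (conj (neg (belowN p)) (neg (isN p))) (ltV p ē)

  symF : ∀ {n Γ} → SetF Γ → (ē p : Vec (Fin n) r) → Sym → Formula n Γ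
  symF X ē p s =
    disj (conj (belowN p) (P s (Vec.head p)))
    (disj (guardF (s# ≟ˢ s) (isN p))
          (conj (betweenF ē p) (disj (guardF (s1 ≟ˢ s) (bitF X p)) (guardF (s0 ≟ˢ s) (neg (bitF X p))))))

  initF : ∀ {n Γ} → SetF Γ → (ē p : Vec (Fin n) r) → Fin nG → Formula n Γ
  initF X ē p g = disj (orF 5 λ i → guardF (inp (allSyms i) Fin.≟ g) (symF X ē p (allSyms i)))
                       (guardF (blank Fin.≟ g) (neg (ltV p ē)))

  -- Many tuples carry the same tag, but a fact is always entered for all of them together, so it is
  -- enough to find one.
  relF : ∀ {n Γ} (t p : Vec (Fin n) r) → Fin nQ ⊎ Fin nG → Formula n (D ∷ Γ)
  relF t p x = exV K (conj (tagF (join nQ nG x) (new K)) (rel (here refl) (old K t Vec.++ (old K p Vec.++ new K))))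

  -- State and head position form one joint fact: a state is recorded only at the position of the
  -- head. The predecessor is found by guessing the previous position together with the table entry
  -- that was applied there.
  headF : ∀ {n Γ} (t p : Vec (Fin n) r) → Fin nQ → Formula n (D ∷ Γ)
  headF t p q = disj (conj (zeroV t) (guardF (start Fin.≟ q) (zeroV p)))
    (exV r (conj (succV (new r) (old r t)) (exV r (orF nQ λ q₀ → orF nG λ g₀ →
      guardF (proj₁ (δ̂ q₀ g₀) Fin.≟ q)
        (conj (conj (relF (old r (new r)) (new r) (inj₁ q₀)) (relF (old r (new r)) (new r) (inj₂ g₀)))
              (moveF (proj₂ (proj₂ (δ̂ q₀ g₀))) (new r) (old r (old r p))))))))

  -- That the head is elsewhere is expressed by naming its position p′, as a fact already in the
  -- relation. Such a cell keeps its symbol, and the cell under the head receives the symbol that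
  -- `δ̂` writes.
  cellF : ∀ {n Γ} → SetF (D ∷ Γ) → (ē t p : Vec (Fin n) r) → Fin nG → Formula n (D ∷ Γ)
  cellF X ē t p g = disj (conj (zeroV t) (initF X ē p g))
    (exV r (conj (succV (new r) (old r t)) (exV r (disj
      (conj (neg (eqV (new r) (old r (old r p))))
            (conj (orF nQ λ q₀ → relF (old r (new r)) (new r) (inj₁ q₀)) (relF (old r (new r)) (old r (old r p)) (inj₂ g))))
      (conj (eqV (new r) (old r (old r p))) (orF nQ λ q₀ → orF nG λ g₀ →
        guardF (proj₁ (proj₂ (δ̂ q₀ g₀)) Fin.≟ g)
          (conj (relF (old r (new r)) (new r) (inj₁ q₀)) (relF (old r (new r)) (new r) (inj₂ g₀)))))))))

  tVars : ∀ n → Vec (Fin (D + n)) r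
  tVars n = Vec.tabulate λ i → (i ↑ˡ (r + K)) ↑ˡ n

  pVars : ∀ n → Vec (Fin (D + n)) r
  pVars n = Vec.tabulate λ i → (r ↑ʳ (i ↑ˡ K)) ↑ˡ n

  sVars : ∀ n → Vec (Fin (D + n)) K
  sVars n = Vec.tabulate λ i → (r ↑ʳ (r ↑ʳ i)) ↑ˡ n

  ruleF : ∀ {n Γ} → SetF (D ∷ Γ) → Vec (Fin n) r → Formula (D + n) (D ∷ Γ)
  ruleF {n} X ē = disj
    (orF nQ λ q → conj (tagF (join nQ nG (inj₁ q)) (sVars n)) (headF (tVars n) (pVars n) q))
    (orF nG λ g → conj (tagF (join nQ nG (inj₂ g)) (sVars n)) (cellF X (old D ē) (tVars n) (pVars n) g))

  acceptF : ∀ {n Γ} → SetF (D ∷ Γ) → Vec (Fin n) r → Formula n Γ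
  acceptF {n} X ē = exV D (conj (tagF (join nQ nG (inj₁ qacc)) (sVars n)) (ifp D (ruleF X (old D ē)) (new D)))

module Positions (u : Str) where
  open Sem u using (N)
  open Eval u
  open Definable u

  den-tail : ∀ {n r} {ρ : Vec (Fin N) n} (xs : Vec (Fin n) (suc r)) {ā} → Den ρ xs ā → Den ρ (Vec.tail xs) (Vec.tail ā)
  den-tail (x ∷ xs) refl = refl

  den-head : ∀ {n r} {ρ : Vec (Fin N) n} (xs : Vec (Fin n) (suc r)) {ā} → Den ρ xs ā → Vec.lookup ρ (Vec.head xs) ≡ Vec.head ā
  den-head (x ∷ xs) refl = refl

  enc-head : ∀ {r} (ā : Vec (Fin N) (suc r)) → enc (Vec.tail ā) ≡ 0 → enc ā ≡ toℕ (Vec.head ā)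
  enc-head (a ∷ as) z = trans (cong (λ x → toℕ a + N * x) z) (trans (cong (toℕ a +_) (*-zeroʳ N)) (+-identityʳ _))

  enc<N⇒tail≡0 : ∀ {r} (ā : Vec (Fin N) (suc r)) → enc ā < N → enc (Vec.tail ā) ≡ 0
  enc<N⇒tail≡0 (a ∷ as) l with enc as
  ... | zero  = refl
  ... | suc x = contradiction l (≤⇒≯ (≤-trans (m≤m+n N (N * x)) (≤-trans (≤-reflexive (sym (*-suc N x))) (m≤n+m _ (toℕ a)))))

  module _ {n Γ} {ρ : Vec (Fin N) n} {e : EnvB N Γ} where

    belowN-reflects : ∀ {r} (xs : Vec (Fin n) (suc r)) {ā} → Den ρ xs ā → Reflects (enc ā < N) (ev {n} {Γ} (belowN xs) ρ e)
    belowN-reflects xs {ā} d = reflects-⇔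
      (λ z → ≤-trans (≤-reflexive (cong suc (enc-head ā z))) (Finₚ.toℕ<n (Vec.head ā)))
      (enc<N⇒tail≡0 ā)
      (zeroV-reflects (Vec.tail xs) (den-tail {ρ = ρ} xs d))

  module _ {n Γ} {ρ : Vec (Fin N) n} {e : EnvB N Γ} where

    isN-reflects : ∀ {r} (xs : Vec (Fin n) (suc r)) {ā} → Den ρ xs ā → Reflects (enc ā ≡ N) (ev {n} {Γ} (isN xs) ρ e)
    isN-reflects {r} xs {ā} d = reflects-⇔
      (λ (¬l , none) → ≤-antisym (≮⇒≥ λ l →
          let (z̄ , h) = enc-surjective (suc r) (<-trans l (enc<N^r ā)) in
          none (z̄ , (λ l′ → <⇒≢ l′ h) , ≤-trans (≤-reflexive (cong suc h)) l))
        (≮⇒≥ ¬l))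
      (λ q → (λ l → <⇒≢ l q) , λ (z̄ , ¬l , l) → ¬l (≤-trans l (≤-reflexive q)))
      (¬-reflects (belowN-reflects xs d) ×-reflects ¬-reflects (exV-reflects (suc r) λ z̄ →
        ¬-reflects (belowN-reflects (new (suc r)) (den-new z̄)) ×-reflects
        ltV-reflects (new (suc r)) (old (suc r) xs) (den-new z̄) (den-old z̄ d)))

    moveF-reflects : ∀ {r} m (xs ys : Vec (Fin n) r) {ā b̄} → Den ρ xs ā → Den ρ ys b̄ →
                     Reflects (moveTo m (enc ā) ≡ enc b̄) (ev {n} {Γ} (moveF m xs ys) ρ e)
    moveF-reflects mS xs ys {ā} {b̄} p q = reflects-⇔ (cong enc) (enc-injective ā b̄) (eqV-reflects xs ys p q)
    moveF-reflects mR xs ys p q = succV-reflects xs ys p q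
    moveF-reflects mL xs ys {ā} {b̄} p q = reflects-⇔
      (λ { (inj₁ s) → cong pred (sym s) ; (inj₂ (z , s)) → trans (cong pred z) (trans (sym z) (cong enc s)) })
      (λ h → split (enc ā) refl h)
      (disj-reflects (succV-reflects ys xs q p)
        (zeroV-reflects xs p ×-reflects eqV-reflects xs ys p q))
      where
        split : ∀ x → enc ā ≡ x → pred (enc ā) ≡ enc b̄ → suc (enc b̄) ≡ enc ā ⊎ (enc ā ≡ 0 × ā ≡ b̄)
        split zero    z h = inj₂ (z , enc-injective ā b̄ (trans z (trans (cong pred (sym z)) h)))
        split (suc x) s h = inj₁ (trans (cong suc (trans (sym h) (cong pred s))) (sym s))

-- The run formula describes the run

module RunCorrect (M : TM) (r′ : ℕ) (u : Str) (2≤N : 2 ≤ length u) (v : List Bool)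
                  (X : List (Vec (Fin (length u)) (suc (suc r′))))
                  (coded : ∀ (p̄ : Vec (Fin (length u)) (suc r′)) j → enc p̄ ≡ suc (length u + j) → j < length v →
                     (Σ (Fin (length u)) λ b → 0 < toℕ b × (b ∷ p̄) ∈ X) ⇔ (nth false v j ≡ true)) where
  open Sem u using (N)
  open Eval u
  open Definable u
  open Positions u
  open RunFormula M r′
  open TM M using (nQ; nG; start; blank; inp) renaming (acc to qacc)
  open TapeOf M

  w : Str
  w = u # v

  end : ℕ
  end = suc (N + length v)

  DefinesX : ∀ {Γ} → SetF Γ → EnvB N Γ → Set
  DefinesX X̂ e = ∀ {n} {ρ : Vec (Fin N) n} (xs : Vec (Fin n) (suc r)) {ā} → Den ρ xs ā → Reflects (ā ∈ X) (ev (X̂ xs) ρ e)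

  input-below : ∀ {pos} → pos < N → (a : Fin N) → pos ≡ toℕ a → inputOf w pos ≡ just (List.lookup u a)
  input-below l a refl = inputOf-++ˡ u (s# ∷ map bitSym v) a

  input-N : inputOf w N ≡ just s#
  input-N = trans (cong (inputOf w) (sym (+-identityʳ N))) (inputOf-++ʳ u (s# ∷ map bitSym v) 0)

  input-bits : ∀ j → inputOf w (suc (N + j)) ≡ inputOf (map bitSym v) j
  input-bits j = trans (cong (inputOf w) (sym (+-suc N j))) (inputOf-++ʳ u (s# ∷ map bitSym v) (suc j))

  bits-inside : ∀ v j → j < length v → inputOf (map bitSym v) j ≡ just (bitSym (nth false v j))
  bits-inside (b ∷ v) zero    _       = refl
  bits-inside (b ∷ v) (suc j) (s≤s l) = bits-inside v j l

  bits-outside : ∀ v j → length v ≤ j → inputOf (map bitSym v) j ≡ nothing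
  bits-outside []      j       _       = refl
  bits-outside (b ∷ v) (suc j) (s≤s l) = bits-outside v j l

  data Position (pos : ℕ) : Set where
    below  : pos < N → Position pos
    hash   : pos ≡ N → Position pos
    inside : ∀ j → pos ≡ suc (N + j) → j < length v → Position pos
    beyond : end ≤ pos → inputOf w pos ≡ nothing → Position pos

  position : ∀ pos → Position pos
  position pos with <-cmp pos N
  ... | tri< l _ _ = below l
  ... | tri≈ _ q _ = hash q
  ... | tri> _ _ g with pos ∸ suc N | m+[n∸m]≡n g
  ...   | j | q with j <? length v
  ...     | yes l = inside j (sym q) l
  ...     | no ¬l = beyond (≤-trans (s≤s (+-monoʳ-≤ N (≮⇒≥ ¬l))) (≤-reflexive q))
                      (trans (cong (inputOf w) (sym q)) (trans (input-bits j) (bits-outside v j (≮⇒≥ ¬l))))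

  module _ {n Γ} {ρ : Vec (Fin N) n} {e : EnvB N Γ} {X̂ : SetF Γ} (hX : DefinesX X̂ e) where

    bitF-reflects : ∀ (xs : Vec (Fin n) r) {p̄} → Den ρ xs p̄ →
                    Reflects (Σ (Fin N) λ b → 0 < toℕ b × (b ∷ p̄) ∈ X) (ev (bitF X̂ xs) ρ e)
    bitF-reflects xs {p̄} d = reflects-⇔ (λ { (b ∷ [] , h) → b , h }) (λ (b , h) → b ∷ [] , h)
      (exV-reflects 1 {φ = conj (positive zero) (X̂ (zero ∷ old 1 xs))} {A = λ b̄ → 0 < toℕ (Vec.head b̄) × (Vec.head b̄ ∷ p̄) ∈ X}
        λ { (b ∷ []) → positive-reflects {Γ = Γ} {ρ = b ∷ ρ} {e} zero ×-reflects hX (zero ∷ old 1 xs) (cong (b ∷_) (den-old (b ∷ []) d)) })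

    domF-reflects : ∀ (xs : Vec (Fin n) r) {p̄} → Den ρ xs p̄ → Reflects (Σ (Fin N) λ b → (b ∷ p̄) ∈ X) (ev (domF X̂ xs) ρ e)
    domF-reflects xs {p̄} d = reflects-⇔ (λ { (b ∷ [] , h) → b , h }) (λ (b , h) → b ∷ [] , h)
      (exV-reflects 1 {φ = X̂ (zero ∷ old 1 xs)} {A = λ b̄ → (Vec.head b̄ ∷ p̄) ∈ X}
        λ { (b ∷ []) → hX (zero ∷ old 1 xs) (cong (b ∷_) (den-old (b ∷ []) d)) })

    betweenF-reflects : ∀ (es xs : Vec (Fin n) r) {ē p̄} → Den ρ es ē → Den ρ xs p̄ →
                        Reflects (N < enc p̄ × enc p̄ < enc ē) (ev {n} {Γ} (betweenF es xs) ρ e)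
    betweenF-reflects es xs de d = reflects-⇔
      (λ ((¬l , ¬q) , l) → ≤∧≢⇒< (≮⇒≥ ¬l) (¬q ∘ sym) , l)
      (λ (g , l) → ((λ l′ → <⇒≱ g (<⇒≤ l′)) , λ q → <⇒≢ g (sym q)) , l)
      ((¬-reflects (belowN-reflects xs d) ×-reflects ¬-reflects (isN-reflects xs d)) ×-reflects ltV-reflects xs es d de)

    symF-reflects : ∀ (es xs : Vec (Fin n) r) {ē p̄} s → Den ρ es ē → Den ρ xs p̄ → enc ē ≡ end →
                    Reflects (inputOf w (enc p̄) ≡ just s) (ev (symF X̂ es xs s) ρ e)
    symF-reflects es xs {ē} {p̄} s de d e≡ = reflects-⇔ to from
      (disj-reflects
        (belowN-reflects xs d ×-reflects subst (λ a → Reflects (List.lookup u (Vec.head p̄) ≡ s) (does (List.lookup u a ≟ˢ s))) (sym (den-head {ρ = ρ} xs d)) (proof (List.lookup u (Vec.head p̄) ≟ˢ s)))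
        (disj-reflects (guard-reflects (s# ≟ˢ s) {isN xs} (isN-reflects xs d))
          (betweenF-reflects es xs de d ×-reflects
            disj-reflects
              (guard-reflects (s1 ≟ˢ s) {bitF X̂ xs} (bitF-reflects xs d))
              (guard-reflects (s0 ≟ˢ s) {neg (bitF X̂ xs)} (¬-reflects (bitF-reflects xs d))))))
      where
        Bit = Σ (Fin N) λ b → 0 < toℕ b × (b ∷ p̄) ∈ X
        Meaning = (enc p̄ < N × List.lookup u (Vec.head p̄) ≡ s) ⊎
                  ((s# ≡ s × enc p̄ ≡ N) ⊎ ((N < enc p̄ × enc p̄ < enc ē) × ((s1 ≡ s × Bit) ⊎ (s0 ≡ s × ¬ Bit))))
        index : N < enc p̄ → enc p̄ < enc ē → Σ ℕ λ j → enc p̄ ≡ suc (N + j) × j < length v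
        index g l = enc p̄ ∸ suc N , sym (m+[n∸m]≡n g) ,
          +-cancelˡ-< (suc N) _ _ (≤-trans (≤-reflexive (cong suc (m+[n∸m]≡n g))) (≤-trans l (≤-reflexive e≡)))
        to : Meaning → inputOf w (enc p̄) ≡ just s
        to (inj₁ (l , q)) = trans (input-below l (Vec.head p̄) (enc-head p̄ (enc<N⇒tail≡0 p̄ l))) (cong just q)
        to (inj₂ (inj₁ (q , l))) = trans (cong (inputOf w) l) (trans input-N (cong just q))
        to (inj₂ (inj₂ ((g , l) , h))) with index g l
        ... | j , q , j< = trans (cong (inputOf w) q) (trans (input-bits j) (trans (bits-inside v j j<) (cong just (sym-of h))))
          where
            sym-of : (s1 ≡ s × Bit) ⊎ (s0 ≡ s × ¬ Bit) → bitSym (nth false v j) ≡ s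
            sym-of (inj₁ (q′ , b)) = trans (cong bitSym (Equivalence.to (coded p̄ j q j<) b)) q′
            sym-of (inj₂ (q′ , ¬b)) = trans (cong bitSym (Boolₚ.¬-not (¬b ∘ Equivalence.from (coded p̄ j q j<)))) q′
        from : inputOf w (enc p̄) ≡ just s → Meaning
        from h with position (enc p̄)
        ... | below l = inj₁ (l , Maybeₚ.just-injective (trans (sym (input-below l (Vec.head p̄) (enc-head p̄ (enc<N⇒tail≡0 p̄ l)))) h))
        ... | hash q = inj₂ (inj₁ (Maybeₚ.just-injective (trans (sym (trans (cong (inputOf w) q) input-N)) h) , q))
        ... | beyond _ q = contradiction (trans (sym q) h) λ ()
        ... | inside j q j< = inj₂ (inj₂ ((≤-trans (s≤s (m≤m+n N j)) (≤-reflexive (sym q)) ,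
                ≤-trans (s≤s (≤-reflexive q)) (≤-trans (s≤s (≤-trans (≤-reflexive (sym (+-suc N j))) (+-monoʳ-≤ N j<))) (≤-reflexive (sym e≡)))) , bits))
          where
            s≡ : bitSym (nth false v j) ≡ s
            s≡ = Maybeₚ.just-injective (trans (sym (trans (cong (inputOf w) q) (trans (input-bits j) (bits-inside v j j<)))) h)
            bits : (s1 ≡ s × Bit) ⊎ (s0 ≡ s × ¬ Bit)
            bits with nth false v j | s≡ | coded p̄ j q j<
            ... | true  | s≡′ | c = inj₁ (s≡′ , Equivalence.from c refl)
            ... | false | s≡′ | c = inj₂ (s≡′ , λ b → contradiction (Equivalence.to c b) λ ())

    initF-reflects : ∀ (es xs : Vec (Fin n) r) {ē p̄} g → Den ρ es ē → Den ρ xs p̄ → enc ē ≡ end →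
                     Reflects (nth blank (map inp w) (enc p̄) ≡ g) (ev (initF X̂ es xs g) ρ e)
    initF-reflects es xs {ē} {p̄} g de d e≡ = reflects-⇔ to from
      (disj-reflects
        (orF-reflects {k = 5} {λ i → guardF (inp (allSyms i) Fin.≟ g) (symF X̂ es xs (allSyms i))} λ i → guard-reflects (inp (allSyms i) Fin.≟ g) {symF X̂ es xs (allSyms i)} (symF-reflects es xs (allSyms i) de d e≡))
        (guard-reflects (blank Fin.≟ g) {neg (ltV xs es)} (¬-reflects (ltV-reflects xs es d de))))
      where
        tape-just : ∀ w pos {s} → inputOf w pos ≡ just s → nth blank (map inp w) pos ≡ inp s
        tape-just (x ∷ w) zero    refl = refl
        tape-just (x ∷ w) (suc pos) h    = tape-just w pos h
        tape-nothing : ∀ w pos → inputOf w pos ≡ nothing → nth blank (map inp w) pos ≡ blank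
        tape-nothing []      pos       h = refl
        tape-nothing (x ∷ w) (suc pos) h = tape-nothing w pos h
        Meaning = (Σ (Fin 5) λ i → inp (allSyms i) ≡ g × inputOf w (enc p̄) ≡ just (allSyms i)) ⊎ (blank ≡ g × ¬ (enc p̄ < enc ē))
        outside : ¬ (enc p̄ < enc ē) → inputOf w (enc p̄) ≡ nothing
        outside ¬l with position (enc p̄)
        ... | beyond _ q = q
        ... | below l = contradiction (≤-trans l (≤-trans (≤-trans (m≤m+n N (length v)) (n≤1+n _)) (≤-reflexive (sym e≡)))) ¬l
        ... | hash q = contradiction (≤-trans (s≤s (≤-trans (≤-reflexive q) (m≤m+n N (length v)))) (≤-reflexive (sym e≡))) ¬l
        ... | inside j q j< = contradiction (≤-trans (s≤s (≤-reflexive q)) (≤-trans (s≤s (≤-trans (≤-reflexive (sym (+-suc N j))) (+-monoʳ-≤ N j<))) (≤-reflexive (sym e≡)))) ¬l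
        to : Meaning → nth blank (map inp w) (enc p̄) ≡ g
        to (inj₁ (i , q , h)) = trans (tape-just w (enc p̄) h) q
        to (inj₂ (q , ¬l)) = trans (tape-nothing w (enc p̄) (outside ¬l)) q
        from : nth blank (map inp w) (enc p̄) ≡ g → Meaning
        from h with inputOf w (enc p̄) in q
        ... | just s  = inj₁ (Finite.code finite-Sym s ,
                          trans (cong inp (Finite.decode-code finite-Sym s)) (trans (sym (tape-just w (enc p̄) q)) h) ,
                          cong just (sym (Finite.decode-code finite-Sym s)))
        ... | nothing = inj₂ (trans (sym (tape-nothing w (enc p̄) q)) h , λ l → inside-just l q)
          where
            inside-just : enc p̄ < enc ē → inputOf w (enc p̄) ≢ nothing
            inside-just l = inputOf-inside w (enc p̄) (≤-trans l (≤-reflexive (trans e≡ (sym length-w))))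
              where
                length-w : length w ≡ suc (N + length v)
                length-w = trans (Listₚ.length-++ u) (trans (+-suc N _) (cong (λ k → suc (N + k)) (Listₚ.length-map bitSym v)))

  C : ℕ → FConf
  C T = frun T (finit w)

  Q : ℕ → Fin nQ
  Q T = proj₁ (C T)

  H : ℕ → ℕ
  H T = proj₁ (proj₂ (C T))

  W : ℕ → ℕ → Fin nG
  W T = proj₂ (proj₂ (C T))

  Δ : ℕ → Fin nQ × Fin nG × Move
  Δ T = δ̂ (Q T) (W T (H T))

  Q-suc : ∀ T → Q (suc T) ≡ proj₁ (Δ T)
  Q-suc T = trans (cong proj₁ (frun-suc T (finit w))) (fstep-state (C T))

  H-suc : ∀ T → H (suc T) ≡ moveTo (proj₂ (proj₂ (Δ T))) (H T)
  H-suc T = trans (cong (proj₁ ∘ proj₂) (frun-suc T (finit w))) (fstep-pos (C T))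

  W-suc : ∀ T j → W (suc T) j ≡ upd (W T) (H T) (proj₁ (proj₂ (Δ T))) j
  W-suc T j = trans (cong (λ c → proj₂ (proj₂ c) j) (frun-suc T (finit w))) (fstep-tape (C T) j)

  -- The head starts at 0 and moves by at most one cell per step. Hence at every time that an
  -- r-tuple can express, the head position is the code of an r-tuple too.
  H≤ : ∀ T → H T ≤ T
  H≤ zero    = z≤n
  H≤ (suc T) = ≤-trans (≤-reflexive (H-suc T)) (≤-trans (moveTo≤ (proj₂ (proj₂ (Δ T))) (H T)) (s≤s (H≤ T)))
    where
      moveTo≤ : ∀ m p → moveTo m p ≤ suc p
      moveTo≤ mL p = ≤-trans (pred[n]≤n {p}) (n≤1+n p)
      moveTo≤ mR p = ≤-refl
      moveTo≤ mS p = n≤1+n p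

  Fact : Fin nQ ⊎ Fin nG → ℕ → ℕ → Set
  Fact (inj₁ q) T pos = Q T ≡ q × H T ≡ pos
  Fact (inj₂ g) T pos = W T pos ≡ g

  Known : ℕ → Fin nQ ⊎ Fin nG → Vec (Fin N) r → Vec (Fin N) r → Set
  Known i x t̄ p̄ = enc t̄ < i × Fact x (enc t̄) (enc p̄)

  StageFact : ℕ → Vec (Fin N) r → Vec (Fin N) r → Vec (Fin N) K → Set
  StageFact i t̄ p̄ s̄ = Σ (Fin nQ ⊎ Fin nG) λ x → Tag (join nQ nG x) s̄ × Known i x t̄ p̄

  StageTable : ℕ → (Vec (Fin N) D → Bool) → Set
  StageTable i R = ∀ t̄ p̄ s̄ → Reflects (StageFact i t̄ p̄ s̄) (R (t̄ Vec.++ (p̄ Vec.++ s̄)))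

  join-injective : ∀ x y → join nQ nG x ≡ join nQ nG y → x ≡ y
  join-injective x y h = trans (sym (Finₚ.splitAt-join nQ nG x)) (trans (cong (splitAt nQ) h) (Finₚ.splitAt-join nQ nG y))

  stageFact-known : ∀ {i t̄ p̄ s̄} x → Tag (join nQ nG x) s̄ → StageFact i t̄ p̄ s̄ → Known i x t̄ p̄
  stageFact-known {i} {t̄} {p̄} {s̄} x tg (y , tg′ , f) =
    subst (λ z → Known i z t̄ p̄) (join-injective y x (tag-unique _ _ s̄ tg′ tg)) f

  HeadStep : ℕ → Fin nQ → Vec (Fin N) r → Vec (Fin N) r → Set
  HeadStep i q t̄ p̄ = (enc t̄ ≡ 0 × start ≡ q × enc p̄ ≡ 0) ⊎
    (Σ (Vec (Fin N) r) λ t̄′ → suc (enc t̄′) ≡ enc t̄ × Σ (Vec (Fin N) r) λ p̄′ → Σ (Fin nQ) λ q₀ → Σ (Fin nG) λ g₀ →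
       proj₁ (δ̂ q₀ g₀) ≡ q × (Known i (inj₁ q₀) t̄′ p̄′ × Known i (inj₂ g₀) t̄′ p̄′) ×
       moveTo (proj₂ (proj₂ (δ̂ q₀ g₀))) (enc p̄′) ≡ enc p̄)

  CellStep : ℕ → Fin nG → Vec (Fin N) r → Vec (Fin N) r → Set
  CellStep i g t̄ p̄ = (enc t̄ ≡ 0 × nth blank (map inp w) (enc p̄) ≡ g) ⊎
    (Σ (Vec (Fin N) r) λ t̄′ → suc (enc t̄′) ≡ enc t̄ × Σ (Vec (Fin N) r) λ p̄′ →
       (¬ (p̄′ ≡ p̄) × (Σ (Fin nQ) λ q₀ → Known i (inj₁ q₀) t̄′ p̄′) × Known i (inj₂ g) t̄′ p̄) ⊎
       (p̄′ ≡ p̄ × Σ (Fin nQ) λ q₀ → Σ (Fin nG) λ g₀ → proj₁ (proj₂ (δ̂ q₀ g₀)) ≡ g ×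
          Known i (inj₁ q₀) t̄′ p̄′ × Known i (inj₂ g₀) t̄′ p̄′))

  headStep-sound : ∀ {i q t̄ p̄} → HeadStep i q t̄ p̄ → Known (suc i) (inj₁ q) t̄ p̄
  headStep-sound {q = q} {t̄} {p̄} (inj₁ (t≡0 , s≡q , p≡0)) = ≤-trans (≤-reflexive (cong suc t≡0)) (s≤s z≤n) ,
    trans (cong Q t≡0) s≡q , trans (cong H t≡0) (sym p≡0)
  headStep-sound {q = q} {t̄} {p̄} (inj₂ (t̄′ , t≡ , p̄′ , q₀ , g₀ , q≡ , ((l , q₀≡ , h≡) , (_ , g₀≡)) , m≡)) =
    ≤-trans (s≤s (≤-reflexive (sym t≡))) (s≤s l) ,
    trans (cong Q (sym t≡)) (trans (Q-suc T) (trans (cong proj₁ Δ≡) q≡)) ,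
    trans (cong H (sym t≡)) (trans (H-suc T) (trans (cong₂ (λ d h → moveTo (proj₂ (proj₂ d)) h) Δ≡ h≡) m≡))
    where
      T = enc t̄′
      Δ≡ : Δ T ≡ δ̂ q₀ g₀
      Δ≡ = cong₂ δ̂ q₀≡ (trans (cong (W T) h≡) g₀≡)

  cellStep-sound : ∀ {i g t̄ p̄} → CellStep i g t̄ p̄ → Known (suc i) (inj₂ g) t̄ p̄
  cellStep-sound {g = g} {t̄} {p̄} (inj₁ (t≡0 , g≡)) =
    ≤-trans (≤-reflexive (cong suc t≡0)) (s≤s z≤n) , trans (cong (λ T → W T (enc p̄)) t≡0) g≡
  cellStep-sound {g = g} {t̄} {p̄} (inj₂ (t̄′ , t≡ , p̄′ , inj₁ (p≢ , (q₀ , (l , q₀≡ , h≡)) , (_ , g≡)))) =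
    ≤-trans (s≤s (≤-reflexive (sym t≡))) (s≤s l) ,
    trans (cong (λ T → W T (enc p̄)) (sym t≡)) (trans (W-suc (enc t̄′) (enc p̄))
      (trans (upd-other (W (enc t̄′)) (H (enc t̄′)) _ (λ e → p≢ (sym (enc-injective p̄ p̄′ (trans e h≡))))) g≡))
  cellStep-sound {g = g} {t̄} {p̄} (inj₂ (t̄′ , t≡ , .p̄ , inj₂ (refl , q₀ , g₀ , w≡ , (l , q₀≡ , h≡) , (_ , g₀≡)))) =
    ≤-trans (s≤s (≤-reflexive (sym t≡))) (s≤s l) ,
    trans (cong (λ T → W T (enc p̄)) (sym t≡)) (trans (W-suc T (enc p̄))
      (trans (trans (cong (upd (W T) (H T) _) (sym h≡)) (upd-same (W T) (H T) _))
        (trans (cong (proj₁ ∘ proj₂) (cong₂ δ̂ q₀≡ (trans (cong (W T) h≡) g₀≡))) w≡)))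
    where T = enc t̄′

  headAt : ∀ (t̄ : Vec (Fin N) r) → Σ (Vec (Fin N) r) λ p̄ → enc p̄ ≡ H (enc t̄)
  headAt t̄ = enc-surjective r (≤-trans (s≤s (H≤ (enc t̄))) (enc<N^r t̄))

  predTime : ∀ (t̄ : Vec (Fin N) r) {T} → enc t̄ ≡ suc T → Σ (Vec (Fin N) r) λ t̄′ → enc t̄′ ≡ T
  predTime t̄ h = enc-surjective r (≤-trans (≤-reflexive (sym h)) (<⇒≤ (enc<N^r t̄)))

  -- The required predecessor is the true configuration one step earlier; its time and head position
  -- are codes of tuples by `predTime` and `headAt`.
  headStep-complete : ∀ {i q} (t̄ p̄ : Vec (Fin N) r) → Known (suc i) (inj₁ q) t̄ p̄ → HeadStep i q t̄ p̄
  headStep-complete {i} {q} t̄ p̄ (l , q≡ , h≡) = go (enc t̄) refl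
    where
      go : ∀ T → enc t̄ ≡ T → HeadStep i q t̄ p̄
      go zero    t≡ = inj₁ (t≡ , trans (cong Q (sym t≡)) q≡ , trans (sym h≡) (cong H t≡))
      go (suc T) t≡ with predTime t̄ t≡
      ... | t̄′ , refl with headAt t̄′
      ...   | p̄′ , p′≡ = inj₂ (t̄′ , sym t≡ , p̄′ , Q T , W T (H T) ,
        trans (sym (Q-suc T)) (trans (cong Q (sym t≡)) q≡) ,
        ((T<i , refl , sym p′≡) , (T<i , cong (W T) p′≡)) ,
        trans (cong (moveTo (proj₂ (proj₂ (Δ T)))) p′≡) (trans (sym (H-suc T)) (trans (cong H (sym t≡)) h≡)))
        where
          T<i : T < i
          T<i = ≤-pred (≤-trans (s≤s (≤-reflexive (sym t≡))) l)

  cellStep-complete : ∀ {i g} (t̄ p̄ : Vec (Fin N) r) → Known (suc i) (inj₂ g) t̄ p̄ → CellStep i g t̄ p̄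
  cellStep-complete {i} {g} t̄ p̄ (l , g≡) = go (enc t̄) refl
    where
      go : ∀ T → enc t̄ ≡ T → CellStep i g t̄ p̄
      go zero    t≡ = inj₁ (t≡ , trans (cong (λ T → W T (enc p̄)) (sym t≡)) g≡)
      go (suc T) t≡ with predTime t̄ t≡
      ... | t̄′ , refl with headAt t̄′
      ...   | p̄′ , p′≡ = inj₂ (t̄′ , sym t≡ , p̄′ , cases (enc p̄′ ≟ enc p̄))
        where
          T<i : T < i
          T<i = ≤-pred (≤-trans (s≤s (≤-reflexive (sym t≡))) l)
          w≡ : upd (W T) (H T) (proj₁ (proj₂ (Δ T))) (enc p̄) ≡ g
          w≡ = trans (sym (W-suc T (enc p̄))) (trans (cong (λ T → W T (enc p̄)) (sym t≡)) g≡)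
          cases : Dec (enc p̄′ ≡ enc p̄) →
            (¬ (p̄′ ≡ p̄) × (Σ (Fin nQ) λ q₀ → Known i (inj₁ q₀) t̄′ p̄′) × Known i (inj₂ g) t̄′ p̄) ⊎
            (p̄′ ≡ p̄ × Σ (Fin nQ) λ q₀ → Σ (Fin nG) λ g₀ → proj₁ (proj₂ (δ̂ q₀ g₀)) ≡ g ×
               Known i (inj₁ q₀) t̄′ p̄′ × Known i (inj₂ g₀) t̄′ p̄′)
          cases (no ¬e) = inj₁ ((λ e → ¬e (cong enc e)) , (Q T , T<i , refl , sym p′≡) ,
            (T<i , trans (sym (upd-other (W T) (H T) _ (λ e → ¬e (trans p′≡ (sym e))))) w≡))
          cases (yes e) = inj₂ (enc-injective p̄′ p̄ e , Q T , W T (H T) ,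
            trans (sym (upd-same (W T) (H T) _)) (trans (cong (upd (W T) (H T) _) (trans (sym p′≡) e)) w≡) ,
            (T<i , refl , sym p′≡) , (T<i , cong (W T) p′≡))

  module _ {Γ} {e : EnvB N Γ} {i} {R : Vec (Fin N) D → Bool} (table : StageTable i R) where

    relF-reflects : ∀ {n} {ρ : Vec (Fin N) n} (ts ps : Vec (Fin n) r) {t̄ p̄} x → Den ρ ts t̄ → Den ρ ps p̄ →
                    Reflects (Known i x t̄ p̄) (ev (relF {Γ = Γ} ts ps x) ρ (R ∷ e))
    relF-reflects {ρ = ρ} ts ps {t̄} {p̄} x dt dp = reflects-⇔
      (λ (s̄ , tg , f) → stageFact-known {t̄ = t̄} {p̄} {s̄} x tg f)
      (λ f → let (s̄ , tg) = tag-exists 2≤N (join nQ nG x) in s̄ , tg , (x , tg , f))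
      (exV-reflects K {φ = conj (tagF (join nQ nG x) (new K)) (rel (here refl) (old K ts Vec.++ (old K ps Vec.++ new K)))}
        λ s̄ → tagF-reflects (join nQ nG x) (new K) (den-new s̄) ×-reflects
          subst (λ z → Reflects (StageFact i t̄ p̄ s̄) (R z))
            (sym (den-++ {ρ = s̄ Vec.++ ρ} (old K ts) (den-old s̄ dt) (den-++ {ρ = s̄ Vec.++ ρ} (old K ps) (den-old s̄ dp) (den-new s̄))))
            (table t̄ p̄ s̄))

    headF-reflects : ∀ {n} {ρ : Vec (Fin N) n} (ts ps : Vec (Fin n) r) {t̄ p̄} q → Den ρ ts t̄ → Den ρ ps p̄ →
                     Reflects (HeadStep i q t̄ p̄) (ev (headF {Γ = Γ} ts ps q) ρ (R ∷ e))
    headF-reflects {ρ = ρ} ts ps q dt dp = disj-reflects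
      (zeroV-reflects ts dt ×-reflects guard-reflects (start Fin.≟ q) {zeroV ps} (zeroV-reflects ps dp))
      (exV-reflects r λ t̄′ → succV-reflects (new r) (old r ts) (den-new t̄′) (den-old t̄′ dt) ×-reflects
        exV-reflects r λ p̄′ →
          let dt′ = den-old p̄′ (den-new {ρ = ρ} t̄′)
              dp″ = den-old p̄′ (den-old t̄′ dp) in
          orF-reflects λ q₀ → orF-reflects λ g₀ → guard-reflects (proj₁ (δ̂ q₀ g₀) Fin.≟ q)
            {conj (conj (relF (old r (new r)) (new r) (inj₁ q₀)) (relF (old r (new r)) (new r) (inj₂ g₀)))
                  (moveF (proj₂ (proj₂ (δ̂ q₀ g₀))) (new r) (old r (old r ps)))}
            ((relF-reflects (old r (new r)) (new r) (inj₁ q₀) dt′ (den-new p̄′) ×-reflects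
              relF-reflects (old r (new r)) (new r) (inj₂ g₀) dt′ (den-new p̄′)) ×-reflects
             moveF-reflects (proj₂ (proj₂ (δ̂ q₀ g₀))) (new r) (old r (old r ps)) (den-new p̄′) dp″))

    cellF-reflects : ∀ {n} {ρ : Vec (Fin N) n} {X̂ : SetF (D ∷ Γ)} → DefinesX X̂ (R ∷ e) →
                     ∀ (es ts ps : Vec (Fin n) r) {ē t̄ p̄} g → Den ρ es ē → Den ρ ts t̄ → Den ρ ps p̄ → enc ē ≡ end →
                     Reflects (CellStep i g t̄ p̄) (ev (cellF X̂ es ts ps g) ρ (R ∷ e))
    cellF-reflects {ρ = ρ} {X̂} hX es ts ps g de dt dp e≡ = disj-reflects
      (zeroV-reflects ts dt ×-reflects initF-reflects {X̂ = X̂} hX es ps g de dp e≡)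
      (exV-reflects r λ t̄′ → succV-reflects (new r) (old r ts) (den-new t̄′) (den-old t̄′ dt) ×-reflects
        exV-reflects r λ p̄′ →
          let dt′ = den-old p̄′ (den-new {ρ = ρ} t̄′)
              dp″ = den-old p̄′ (den-old t̄′ dp) in
          disj-reflects
            (¬-reflects (eqV-reflects (new r) (old r (old r ps)) (den-new p̄′) dp″) ×-reflects
              (orF-reflects λ q₀ → relF-reflects (old r (new r)) (new r) (inj₁ q₀) dt′ (den-new p̄′)) ×-reflects
              relF-reflects (old r (new r)) (old r (old r ps)) (inj₂ g) dt′ dp″)
            (eqV-reflects (new r) (old r (old r ps)) (den-new p̄′) dp″ ×-reflects
              orF-reflects λ q₀ → orF-reflects λ g₀ → guard-reflects (proj₁ (proj₂ (δ̂ q₀ g₀)) Fin.≟ g)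
                {conj (relF (old r (new r)) (new r) (inj₁ q₀)) (relF (old r (new r)) (new r) (inj₂ g₀))}
                (relF-reflects (old r (new r)) (new r) (inj₁ q₀) dt′ (den-new p̄′) ×-reflects
                 relF-reflects (old r (new r)) (new r) (inj₂ g₀) dt′ (den-new p̄′))))

  den-tVars : ∀ {n} {ρ : Vec (Fin N) n} (t̄ p̄ : Vec (Fin N) r) (s̄ : Vec (Fin N) K) → Den ((t̄ Vec.++ (p̄ Vec.++ s̄)) Vec.++ ρ) (tVars n) t̄
  den-tVars {ρ = ρ} t̄ p̄ s̄ = den-tabulate {ρ = (t̄ Vec.++ (p̄ Vec.++ s̄)) Vec.++ ρ} _ λ i →
    trans (Vecₚ.lookup-++ˡ (t̄ Vec.++ (p̄ Vec.++ s̄)) ρ (i ↑ˡ (r + K))) (Vecₚ.lookup-++ˡ t̄ (p̄ Vec.++ s̄) i)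

  den-pVars : ∀ {n} {ρ : Vec (Fin N) n} (t̄ p̄ : Vec (Fin N) r) (s̄ : Vec (Fin N) K) → Den ((t̄ Vec.++ (p̄ Vec.++ s̄)) Vec.++ ρ) (pVars n) p̄
  den-pVars {ρ = ρ} t̄ p̄ s̄ = den-tabulate {ρ = (t̄ Vec.++ (p̄ Vec.++ s̄)) Vec.++ ρ} _ λ i →
    trans (Vecₚ.lookup-++ˡ (t̄ Vec.++ (p̄ Vec.++ s̄)) ρ (r ↑ʳ (i ↑ˡ K)))
      (trans (Vecₚ.lookup-++ʳ t̄ (p̄ Vec.++ s̄) (i ↑ˡ K)) (Vecₚ.lookup-++ˡ p̄ s̄ i))

  den-sVars : ∀ {n} {ρ : Vec (Fin N) n} (t̄ p̄ : Vec (Fin N) r) (s̄ : Vec (Fin N) K) → Den ((t̄ Vec.++ (p̄ Vec.++ s̄)) Vec.++ ρ) (sVars n) s̄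
  den-sVars {ρ = ρ} t̄ p̄ s̄ = den-tabulate {ρ = (t̄ Vec.++ (p̄ Vec.++ s̄)) Vec.++ ρ} _ λ i →
    trans (Vecₚ.lookup-++ˡ (t̄ Vec.++ (p̄ Vec.++ s̄)) ρ (r ↑ʳ (r ↑ʳ i)))
      (trans (Vecₚ.lookup-++ʳ t̄ (p̄ Vec.++ s̄) (r ↑ʳ i)) (Vecₚ.lookup-++ʳ p̄ s̄ i))

  module _ {n Γ} {ρ : Vec (Fin N) n} {e : EnvB N Γ} {X̂ : SetF (D ∷ Γ)}
           (hX : ∀ R → DefinesX X̂ (R ∷ e)) (es : Vec (Fin n) r) {ē} (de : Den ρ es ē) (e≡ : enc ē ≡ end) where

    ruleF-reflects : ∀ {i R} → StageTable i R → ∀ t̄ p̄ s̄ →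
      Reflects (Σ (Fin nQ ⊎ Fin nG) λ x → Tag (join nQ nG x) s̄ × Known (suc i) x t̄ p̄)
               (ev (ruleF X̂ es) ((t̄ Vec.++ (p̄ Vec.++ s̄)) Vec.++ ρ) (R ∷ e))
    ruleF-reflects {i} {R} table t̄ p̄ s̄ = reflects-⇔
      (λ { (inj₁ (q , tg , h)) → inj₁ q , tg , headStep-sound {t̄ = t̄} {p̄} h ; (inj₂ (g , tg , h)) → inj₂ g , tg , cellStep-sound {t̄ = t̄} {p̄} h })
      (λ { (inj₁ q , tg , h) → inj₁ (q , tg , headStep-complete t̄ p̄ h) ; (inj₂ g , tg , h) → inj₂ (g , tg , cellStep-complete t̄ p̄ h) })
      (disj-reflects
        (orF-reflects λ q → tagF-reflects (join nQ nG (inj₁ q)) (sVars n) (den-sVars t̄ p̄ s̄) ×-reflects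
          headF-reflects table (tVars n) (pVars n) q (den-tVars t̄ p̄ s̄) (den-pVars t̄ p̄ s̄))
        (orF-reflects λ g → tagF-reflects (join nQ nG (inj₂ g)) (sVars n) (den-sVars t̄ p̄ s̄) ×-reflects
          cellF-reflects table {X̂ = X̂} (hX R) (old D es) (tVars n) (pVars n) g (den-old (t̄ Vec.++ (p̄ Vec.++ s̄)) de) (den-tVars t̄ p̄ s̄) (den-pVars t̄ p̄ s̄) e≡))

    -- All facts at time T + 1 follow from facts at time T, so one application of the rule moves the
    -- horizon by exactly one unit of time.
    stages : ∀ i → StageTable i (stageᵇ D (ruleF X̂ es) ρ e i)
    stages zero    t̄ p̄ s̄ = ofⁿ λ { (_ , _ , () , _) }
    stages (suc i) t̄ p̄ s̄ = reflects-⇔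
      [ (λ (x , tg , l , f) → x , tg , ≤-trans l (n≤1+n i) , f) , id ] inj₂
      (stages i t̄ p̄ s̄ ⊎-reflects ruleF-reflects (stages i) t̄ p̄ s̄)

  acceptF-reflects : ∀ {n Γ} {ρ : Vec (Fin N) n} {e : EnvB N Γ} {X̂ : SetF (D ∷ Γ)} →
    (∀ R → DefinesX X̂ (R ∷ e)) → ∀ (es : Vec (Fin n) r) {ē} → Den ρ es ē → enc ē ≡ end →
    Reflects (Σ ℕ λ T → T < N ^ r × Q T ≡ qacc) (ev (acceptF X̂ es) ρ e)
  acceptF-reflects {n} {ρ = ρ} {e} {X̂} hX es de e≡ = reflects-⇔
    (λ (ā , f) → let (t̄ , q) = unpack ā f in enc t̄ , enc<N^r t̄ , q)
    (λ (T , l , q) → pack T l q)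
    (exV-reflects D {φ = conj (tagF acct (sVars n)) (ifp D (ruleF X̂ (old D es)) (new D))} {A = λ ā → Good ā} good)
    where
      acct : Fin K
      acct = join nQ nG (inj₁ qacc)
      Good : Vec (Fin N) D → Set
      Good ā = Σ (Vec (Fin N) r) λ t̄ → Σ (Vec (Fin N) r) λ p̄ → Σ (Vec (Fin N) K) λ s̄ →
        ā ≡ t̄ Vec.++ (p̄ Vec.++ s̄) × Tag acct s̄ × StageFact (N ^ D) t̄ p̄ s̄
      unpack : ∀ ā → Good ā → Σ (Vec (Fin N) r) λ t̄ → Q (enc t̄) ≡ qacc
      unpack ā (t̄ , p̄ , s̄ , _ , tg , f) = t̄ , proj₁ (proj₂ (stageFact-known {t̄ = t̄} {p̄} {s̄} (inj₁ qacc) tg f))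
      packAt : ∀ t̄ → Q (enc t̄) ≡ qacc → Σ (Vec (Fin N) D) Good
      packAt t̄ q = let (p̄ , p≡) = headAt t̄ ; (s̄ , tg) = tag-exists 2≤N acct in
        t̄ Vec.++ (p̄ Vec.++ s̄) , t̄ , p̄ , s̄ , refl , tg , (inj₁ qacc , tg ,
        -- The last stage has number N ^ D with D at least r, so it lies beyond every time that an
        -- r-tuple expresses.
        ≤-trans (enc<N^r t̄) (^-monoʳ-≤ N {{>-nonZero (≤-trans (s≤s z≤n) 2≤N)}} (m≤m+n r (r + K))) , q , sym p≡)
      pack : ∀ T → T < N ^ r → Q T ≡ qacc → Σ (Vec (Fin N) D) Good
      pack T l q = let (t̄ , t≡) = enc-surjective r l in packAt t̄ (trans (cong Q t≡) q)
      split : ∀ (ā : Vec (Fin N) D) → Σ (Vec (Fin N) r) λ t̄ → Σ (Vec (Fin N) r) λ p̄ → Σ (Vec (Fin N) K) λ s̄ → ā ≡ t̄ Vec.++ (p̄ Vec.++ s̄)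
      split ā with Vec.splitAt r ā
      ... | t̄ , rest , refl with Vec.splitAt r rest
      ...   | p̄ , s̄ , refl = t̄ , p̄ , s̄ , refl
      good : ∀ ā → Reflects (Good ā) (ev (conj (tagF acct (sVars n)) (ifp D (ruleF X̂ (old D es)) (new D))) (ā Vec.++ ρ) e)
      good ā with split ā
      ... | t̄ , p̄ , s̄ , refl = reflects-⇔
        (λ (tg , f) → t̄ , p̄ , s̄ , refl , tg , f)
        (λ (t̄′ , p̄′ , s̄′ , ā≡ , tg , f) → coincide t̄′ p̄′ s̄′ ā≡ tg f)
        (tagF-reflects acct (sVars n) (den-sVars t̄ p̄ s̄) ×-reflects
          subst (λ z → Reflects (StageFact (N ^ D) t̄ p̄ s̄) (stageᵇ D (ruleF X̂ (old D es)) (ā′ Vec.++ ρ) e (N ^ D) z))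
            (sym (den-new {ρ = ρ} ā′))
            (stages {X̂ = X̂} hX (old D es) (den-old ā′ de) e≡ (N ^ D) t̄ p̄ s̄))
        where
          ā′ = t̄ Vec.++ (p̄ Vec.++ s̄)
          coincide : ∀ t̄′ p̄′ s̄′ → ā′ ≡ t̄′ Vec.++ (p̄′ Vec.++ s̄′) → Tag acct s̄′ → StageFact (N ^ D) t̄′ p̄′ s̄′ → Tag acct s̄ × StageFact (N ^ D) t̄ p̄ s̄
          coincide t̄′ p̄′ s̄′ ā≡ tg f with Vecₚ.++-injective t̄ t̄′ ā≡
          ... | refl , rest≡ with Vecₚ.++-injective p̄ p̄′ rest≡
          ...   | refl , refl = tg , f

-- From certificates to sentences

polyBounded-id : PolyBounded id
polyBounded-id = 0 , 1 , λ n → ≤-trans (m≤m+n n 2) (≤-reflexive (sym (*-identityʳ (n + 2))))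

polyBounded-^ : ∀ {f} d → PolyBounded f → PolyBounded (λ n → f n ^ d)
polyBounded-^ zero    h = polyBounded-const 1
polyBounded-^ (suc d) h = polyBounded-* h (polyBounded-^ d h)

n+m≤n^[1+m] : ∀ {n} → 2 ≤ n → ∀ m → n + m ≤ n ^ suc m
n+m≤n^[1+m] {n} 2≤n zero    = ≤-reflexive (trans (+-identityʳ n) (sym (*-identityʳ n)))
n+m≤n^[1+m] {n} 2≤n (suc m) = begin
  n + suc m                   ≡⟨ +-suc n m ⟩
  suc (n + m)                 ≤⟨ +-mono-≤ (m^n>0 n (suc m)) (n+m≤n^[1+m] 2≤n m) ⟩
  n ^ suc m + n ^ suc m       ≡⟨ cong (n ^ suc m +_) (+-identityʳ _) ⟨
  2 * n ^ suc m               ≤⟨ *-monoˡ-≤ (n ^ suc m) 2≤n ⟩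
  n ^ suc (suc m)             ∎
  where
    open ≤-Reasoning
    instance
      n≢0 : NonZero n
      n≢0 = >-nonZero (≤-trans (s≤s z≤n) 2≤n)

-- Tuples over n elements count up to a pure power of n. For n at least 2 the constant added to n in
-- the base is absorbed by the exponent.
polyBounded⇒<^ : ∀ {f} → PolyBounded f → Σ ℕ λ r → ∀ n → 2 ≤ n → f n < n ^ suc r
polyBounded⇒<^ {f} (c , d , h) = r , λ n 2≤n → begin-strict
  f n                         ≤⟨ h n ⟩
  (n + suc (suc c)) ^ d       ≤⟨ ^-monoˡ-≤ d (n+m≤n^[1+m] 2≤n (suc (suc c))) ⟩
  (n ^ suc (suc (suc c))) ^ d ≡⟨ ^-*-assoc n (suc (suc (suc c))) d ⟩
  n ^ r                       <⟨ ^-monoʳ-< n 2≤n {r} {suc r} (n<1+n r) ⟩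
  n ^ suc r                   ∎
  where
    open ≤-Reasoning
    r = suc (suc (suc c)) * d

-- The meaning of the second conjunct may depend on the first: the run is analysed only for strings
-- of length at least 2 and for an end tuple beyond N.
×-reflects-lazy : ∀ {A B : Set} {a b} → Reflects A a → (A → Reflects B b) → Reflects (A × B) (a ∧ b)
×-reflects-lazy (ofʸ a)  h = reflects-⇔ (a ,_) proj₂ (h a)
×-reflects-lazy (ofⁿ ¬a) h = ofⁿ (¬a ∘ proj₁)

-- A log-quantifier allows no constant factor in its bound, so the guessed set is the union of c
-- quantified sets.
inX : ∀ {n Γ a} c → (∀ {x} → x ∈ replicate c a → x ∈ Γ) → Vec (Fin n) a → Formula n Γ
inX zero    ι xs = ffF
inX (suc c) ι xs = disj (rel (ι (here refl)) xs) (inX c (ι ∘ there) xs)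

concatV : ∀ {A : Set} {c} → Vec (List A) c → List A
concatV []       = []
concatV (X ∷ Xs) = X ++ concatV Xs

setEnv : ∀ {N a c} → Vec (List (Vec (Fin N) a)) c → Env N (replicate c a)
setEnv []       = []
setEnv (X ∷ Xs) = (λ ā → ā ∈ X) ∷ setEnv Xs

setEnvᵇ : ∀ {N a c} → Vec (List (Vec (Fin N) a)) c → EnvB N (replicate c a)
setEnvᵇ []       = []
setEnvᵇ (X ∷ Xs) = (λ ā → does (ā ∈ᵛ? X)) ∷ setEnvᵇ Xs

setEnv-reflects : ∀ {N a c} (Xs : Vec (List (Vec (Fin N) a)) c) → ReflectsEnv (setEnv Xs) (setEnvᵇ Xs)
setEnv-reflects (X ∷ Xs) = reflectsEnv-∷ (λ ā → proof (ā ∈ᵛ? X)) (setEnv-reflects Xs)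

AllShort : ∀ {A : Set} {c} → ℕ → Vec (List A) c → Set
AllShort m []       = ⊤
AllShort m (X ∷ Xs) = length X ≤ m × AllShort m Xs

length-concatV : ∀ {A : Set} {c m} (Xs : Vec (List A) c) → AllShort m Xs → length (concatV Xs) ≤ c * m
length-concatV []       _       = z≤n
length-concatV (X ∷ Xs) (h , hs) = ≤-trans (≤-reflexive (Listₚ.length-++ X)) (+-mono-≤ h (length-concatV Xs hs))

chunks : ∀ {A : Set} c m (X : List A) → length X ≤ c * m → Σ (Vec (List A) c) λ Xs → concatV Xs ≡ X × AllShort m Xs
chunks zero    m []      h = [] , refl , tt
chunks zero    m (_ ∷ _) ()
chunks (suc c) m X h with chunks c m (List.drop m X)
  (≤-trans (≤-reflexive (Listₚ.length-drop m X)) (≤-trans (∸-monoˡ-≤ m h) (≤-reflexive (m+n∸m≡n m (c * m)))))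
... | Xs , q , hs = List.take m X ∷ Xs , trans (cong (List.take m X ++_) q) (Listₚ.take++drop≡id m X) ,
  ≤-trans (≤-reflexive (Listₚ.length-take m X)) (m⊓n≤m m (length X)) , hs

emptySets : ∀ {A : Set} c → Vec (List A) c
emptySets c = Vec.replicate c []

emptySets-short : ∀ {A : Set} c m → AllShort {A} m (emptySets c)
emptySets-short zero    m = tt
emptySets-short (suc c) m = z≤n , emptySets-short c m

-- replicate (suc c ⊕ j) a is replicate (c ⊕ suc j) a, as needed for stripping log-quantifiers.
_⊕_ : ℕ → ℕ → ℕ
zero  ⊕ j = j
suc c ⊕ j = c ⊕ suc j

⊕≡+ : ∀ c j → c ⊕ j ≡ c + j
⊕≡+ zero    j = refl
⊕≡+ (suc c) j = trans (⊕≡+ c (suc j)) (+-suc c j)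

module Prefix (k a : ℕ) (0<k : 0 < k) (0<a : 0 < a) where

  logPrefix : ∀ c j → Formula 0 (replicate (c ⊕ j) a) → LogFormula (replicate j a)
  logPrefix zero    j φ = body φ
  logPrefix (suc c) j φ = logEx k a 0<k 0<a (logPrefix c (suc j) φ)

  module _ (u : Str) where
    open Sem u using (N; sat)

    short : ℕ
    short = logᵏ k N

    prefix-sound : ∀ c j {φ} (Ys : Vec (List (Vec (Fin N) a)) j) → AllShort short Ys →
                   satL u (logPrefix c j φ) (setEnv Ys) →
                   Σ (Vec (List (Vec (Fin N) a)) (c ⊕ j)) λ Xs → AllShort short Xs × sat φ [] (setEnv Xs)
    prefix-sound zero    j Ys h t           = Ys , h , t
    prefix-sound (suc c) j Ys h (S , l , t) = prefix-sound c (suc j) (S ∷ Ys) (l , h) t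

    prefix-complete : ∀ c j {φ} (Xs : Vec (List (Vec (Fin N) a)) (c ⊕ j)) → AllShort short Xs → sat φ [] (setEnv Xs) →
                      Σ (Vec (List (Vec (Fin N) a)) j) λ Ys → AllShort short Ys × satL u (logPrefix c j φ) (setEnv Ys)
    prefix-complete zero    j Xs h t = Xs , h , t
    prefix-complete (suc c) j Xs h t with prefix-complete c (suc j) Xs h t
    ... | S ∷ Ys , (l , h′) , t′ = Ys , h′ , S , l , t′

decBounded : ∀ n {A : List Bool → Set} → (∀ v → Dec (A v)) → Dec (Σ (List Bool) λ v → length v ≤ n × A v)
decBounded zero    d = map′ (λ x → [] , z≤n , x) (λ { ([] , _ , x) → x }) (d [])
decBounded (suc n) d = map′
  (λ { (inj₁ x) → [] , z≤n , x
     ; (inj₂ (inj₁ (v , l , x))) → true ∷ v , s≤s l , x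
     ; (inj₂ (inj₂ (v , l , x))) → false ∷ v , s≤s l , x })
  (λ { ([] , _ , x) → inj₁ x
     ; (true ∷ v , s≤s l , x) → inj₂ (inj₁ (v , l , x))
     ; (false ∷ v , s≤s l , x) → inj₂ (inj₂ (v , l , x)) })
  (d [] ⊎-dec (decBounded n (d ∘ (true ∷_)) ⊎-dec decBounded n (d ∘ (false ∷_))))

nth-applyUpTo : ∀ (f : ℕ → Bool) n j → j < n → nth false (List.applyUpTo f n) j ≡ f j
nth-applyUpTo f (suc n) zero    _       = refl
nth-applyUpTo f (suc n) (suc j) (s≤s l) = nth-applyUpTo (f ∘ suc) n j l

applyUpTo-nth : ∀ (f : ℕ → Bool) v → (∀ j → j < length v → f j ≡ nth false v j) → List.applyUpTo f (length v) ≡ v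
applyUpTo-nth f []      h = refl
applyUpTo-nth f (b ∷ v) h = cong₂ _∷_ (h 0 (s≤s z≤n)) (applyUpTo-nth (f ∘ suc) v (λ j l → h (suc j) (s≤s l)))

leF : ∀ {n Γ r} → ℕ → Vec (Fin n) (suc r) → Formula n Γ
leF zero    xs = disj (belowN xs) (isN xs)
leF {r = r} (suc j) xs = disj (leF j xs) (exV (suc r) (conj (leF j (new (suc r))) (succV (new (suc r)) (old (suc r) xs))))

module _ (u : Str) where
  open Sem u using (N)
  open Eval u
  open Definable u
  open Positions u

  leF-reflects : ∀ {n Γ r} {ρ : Vec (Fin N) n} {e : EnvB N Γ} j (xs : Vec (Fin n) (suc r)) {ā} → Den ρ xs ā →
                 Reflects (enc ā ≤ N + j) (ev {n} {Γ} (leF j xs) ρ e)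
  leF-reflects zero xs d = reflects-⇔
    [ (λ l → ≤-trans (<⇒≤ l) (≤-reflexive (sym (+-identityʳ N)))) , (λ q → ≤-reflexive (trans q (sym (+-identityʳ N)))) ]
    (λ l → Sum.map id id (m≤n⇒m<n∨m≡n (≤-trans l (≤-reflexive (+-identityʳ N)))))
    (disj-reflects (belowN-reflects xs d) (isN-reflects xs d))
  leF-reflects {r = r} (suc j) xs {ā} d = reflects-⇔
    (λ { (inj₁ l) → ≤-trans l (+-monoʳ-≤ N (n≤1+n j))
       ; (inj₂ (z̄ , l , s)) → ≤-trans (≤-reflexive (sym s)) (≤-trans (s≤s l) (≤-reflexive (sym (+-suc N j)))) })
    (λ l → step₁ (enc ā) refl l)
    (disj-reflects (leF-reflects j xs d) (exV-reflects (suc r) λ z̄ →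
      leF-reflects j (new (suc r)) (den-new z̄) ×-reflects succV-reflects (new (suc r)) (old (suc r) xs) (den-new z̄) (den-old z̄ d)))
    where
      step₁ : ∀ x → enc ā ≡ x → enc ā ≤ N + suc j →
              enc ā ≤ N + j ⊎ (Σ (Vec (Fin N) (suc r)) λ z̄ → enc z̄ ≤ N + j × suc (enc z̄) ≡ enc ā)
      step₁ zero    q l = inj₁ (≤-trans (≤-reflexive q) z≤n)
      step₁ (suc x) q l =
        let (z̄ , z≡) = enc-surjective (suc r) (≤-trans (≤-reflexive (sym q)) (<⇒≤ (enc<N^r ā))) in
        inj₂ (z̄ , ≤-trans (≤-reflexive z≡) (≤-pred (≤-trans (≤-reflexive (sym q)) (≤-trans l (≤-reflexive (+-suc N j))))) ,
              trans (cong suc z≡) (sym q))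

twoF : ∀ {n Γ} → Formula n Γ
twoF = ex (ex (lt zero (suc zero)))

lengthBound : (k c n : ℕ) → ℕ
lengthBound k c n = suc (n + c * n ^ k)

-- The sum dominates both the running time on `u # v` and the length of this string, so one exponent
-- serves for times and positions. `lengthBound` has n in place of the logarithm to be polynomial.
sizeBound : (pc pd k c n : ℕ) → ℕ
sizeBound pc pd k c n = poly pc pd (lengthBound k c n) + lengthBound k c n

exponent : ∀ pc pd k c → Σ ℕ λ r → ∀ n → 2 ≤ n → sizeBound pc pd k c n < n ^ suc r
exponent pc pd k c = polyBounded⇒<^ (polyBounded-+
  (polyBounded-+ (polyBounded-* (polyBounded-const pc) (polyBounded-^ pd linear)) (polyBounded-const pc)) linear)
  where
    linear : PolyBounded (lengthBound k c)
    linear = polyBounded-+ (polyBounded-const 1)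
      (polyBounded-+ polyBounded-id (polyBounded-* (polyBounded-const c) (polyBounded-^ k polyBounded-id)))

-- The sentence for a given verifier

module FromMachine (M : TM) (pc pd k c : ℕ) (L : Language)
  (M-halts : ∀ u → Halted M (stateAfter M (poly pc pd (length u)) u))
  (L-iff : ∀ u → L u ⇔ (Σ (List Bool) λ v → length v ≤ c * logᵏ k (length u) ×
             stateAfter M (poly pc pd (length (u # v))) (u # v) ≡ TM.acc M))
  (r′ : ℕ) (sizeBound-< : ∀ n → 2 ≤ n → sizeBound pc pd k c n < n ^ suc r′) where

  Accepts : Str → List Bool → Set
  Accepts u v = stateAfter M (poly pc pd (length (u # v))) (u # v) ≡ TM.acc M

  -- All certificates within the bound can be tried. The decision is needed when the sentence is
  -- written, since the answers for the strings of length at most 1 are put into it literally.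
  L? : ∀ u → Dec (L u)
  L? u = map′ (Equivalence.from (L-iff u)) (Equivalence.to (L-iff u))
    (decBounded (c * logᵏ k (length u)) λ v → stateAfter M (poly pc pd (length (u # v))) (u # v) Fin.≟ TM.acc M)

  open RunFormula M r′

  sets : ℕ
  sets = c ⊕ 0

  Γ : List ℕ
  Γ = replicate sets (suc r)

  X₀ : SetF Γ
  X₀ = inX sets id

  X₁ : SetF (D ∷ Γ)
  X₁ = inX sets there

  -- log⁰ is not available as a quantifier bound, so for k = 0 the length of v is bounded explicitly.
  lengthF : ∀ {n} → ℕ → Vec (Fin n) r → Formula n Γ
  lengthF zero    xs = leF (suc c) xs
  lengthF (suc _) xs = neg ffF

  -- The outer quantifier guesses the end of `u # v`, beyond the separator at position N. That every
  -- position in between has a pair in the guessed set is what turns the size of this set into a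
  -- bound on |v|.
  coreF : Formula 0 Γ
  coreF = exV r (conj (conj (conj (neg (belowN (new r))) (neg (isN (new r)))) (lengthF k (new r)))
    (conj (neg (exV r (conj (betweenF (old r (new r)) (new r)) (neg (domF X₀ (new r))))))
          (acceptF X₁ (new r))))

  smallF : Formula 0 Γ
  smallF = disj (guardF (L? []) (neg (ex (eq zero zero))))
                (orF 5 λ i → guardF (L? (allSyms i ∷ [])) (ex (P (allSyms i) zero)))

  mainF : Formula 0 Γ
  mainF = disj (conj twoF coreF) (conj (neg twoF) smallF)

  -- For k = 0 the exponent 1 is used. The sets are then still large enough, because ⌈log₂ N⌉ is at
  -- least 1 for N at least 2.
  k₊ : ℕ
  k₊ = suc (pred k)

  open Prefix k₊ (suc r) (s≤s z≤n) (s≤s z≤n)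

  sentence : Sentence
  sentence = logPrefix c 0 mainF

  module _ (u : Str) where
    open Sem u using (N; sat)
    open Eval u
    open Definable u
    open Positions u

    Tuple : Set
    Tuple = Vec (Fin N) (suc r)

    inX-reflects : ∀ {n Γ′ m} {ρ : Vec (Fin N) n} {e : EnvB N Γ′} (Xs : Vec (List Tuple) m)
      (ι : ∀ {x} → x ∈ replicate m (suc r) → x ∈ Γ′) → (∀ {x} (p : x ∈ replicate m (suc r)) → All.lookup e (ι p) ≡ All.lookup (setEnvᵇ Xs) p) →
      ∀ xs {ā} → Den ρ xs ā → Reflects (ā ∈ concatV Xs) (ev (inX m ι xs) ρ e)
    inX-reflects {ρ = ρ} {e} [] ι h xs d = reflects-⇔ (λ ()) (λ ()) (ff-reflects {ρ = ρ} {e})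
    inX-reflects {ρ = ρ} {e} (X ∷ Xs) ι h xs {ā} d = reflects-⇔
      [ ∈ₚ.∈-++⁺ˡ , ∈ₚ.∈-++⁺ʳ X ] (∈ₚ.∈-++⁻ X)
      (disj-reflects
        (subst (Reflects (ā ∈ X)) (sym (trans (cong (All.lookup e (ι (here refl))) d) (cong (λ f → f ā) (h (here refl))))) (proof (ā ∈ᵛ? X)))
        (inX-reflects {ρ = ρ} {e} Xs (ι ∘ there) (h ∘ there) xs d))

    lengthOK : ℕ → ℕ → Set
    lengthOK zero    x = x ≤ N + suc c
    lengthOK (suc _) x = ⊤

    lengthF-reflects : ∀ {n} {ρ : Vec (Fin N) n} {e} k (xs : Vec (Fin n) r) {ā} → Den ρ xs ā →
                       Reflects (lengthOK k (enc ā)) (ev (lengthF k xs) ρ e)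
    lengthF-reflects zero    xs d = leF-reflects u (suc c) xs d
    lengthF-reflects {ρ = ρ} {e} (suc k) xs d = tt-reflects {ρ = ρ} {e}

    module _ (X : List Tuple) where

      BitAt : ℕ → Tuple → Set
      BitAt j x = enc (Vec.tail x) ≡ suc (N + j) × 0 < toℕ (Vec.head x)

      bitAt? : ∀ j → Dec (Any.Any (BitAt j) X)
      bitAt? j = Any.any? (λ x → (enc (Vec.tail x) ≟ suc (N + j)) ×-dec (0 <? toℕ (Vec.head x))) X

      -- Several pairs may share a position; as in `bitF`, one with a nonzero first entry makes the
      -- bit 1. Every X thus decodes to some v of the prescribed length.
      bitsOf : ℕ → List Bool
      bitsOf m = List.applyUpTo (λ j → does (bitAt? j)) m

      bitAt-⇔ : ∀ (p̄ : Vec (Fin N) r) j → enc p̄ ≡ suc (N + j) → (Σ (Fin N) λ b → 0 < toℕ b × (b ∷ p̄) ∈ X) ⇔ (does (bitAt? j) ≡ true)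
      bitAt-⇔ p̄ j q = mk⇔
        (λ (b , 0<b , m) → reflects-intro (proof (bitAt? j)) (Any.map (λ { refl → q , 0<b }) m))
        (λ h → found (find (reflects-true (proof (bitAt? j)) h)))
        where
          found : (Σ Tuple λ x → x ∈ X × BitAt j x) → Σ (Fin N) λ b → 0 < toℕ b × (b ∷ p̄) ∈ X
          found (b ∷ q̄ , m , q′ , 0<b) = b , 0<b , subst (λ z → (b ∷ z) ∈ X) (enc-injective q̄ p̄ (trans q′ (sym q))) m

      coded : ∀ m (p̄ : Vec (Fin N) r) j → enc p̄ ≡ suc (N + j) → j < length (bitsOf m) →
              (Σ (Fin N) λ b → 0 < toℕ b × (b ∷ p̄) ∈ X) ⇔ (nth false (bitsOf m) j ≡ true)
      coded m p̄ j q l = subst (λ b → (Σ (Fin N) λ b → 0 < toℕ b × (b ∷ p̄) ∈ X) ⇔ (b ≡ true))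
        (sym (nth-applyUpTo _ m j (≤-trans l (≤-reflexive (Listₚ.length-applyUpTo _ m))))) (bitAt-⇔ p̄ j q)

      Reached : List Bool → ℕ → Set
      Reached v t = proj₁ (TapeOf.frun M t (TapeOf.finit M (u # v))) ≡ TM.acc M

      Covered : ℕ → Set
      Covered x = ¬ (Σ (Vec (Fin N) r) λ p̄ → (N < enc p̄ × enc p̄ < x) × ¬ (Σ (Fin N) λ b → (b ∷ p̄) ∈ X))

      Core : Set
      Core = Σ (Vec (Fin N) r) λ ē → (N < enc ē × lengthOK k (enc ē)) ×
        Covered (enc ē) × (Σ ℕ λ t → t < N ^ r × Reached (bitsOf (enc ē ∸ suc N)) t)

    lookup-setEnvᵇ : ∀ {m} (Xs : Vec (List Tuple) m) {d} (R : Vec (Fin N) d → Bool) {x} (p : x ∈ replicate m (suc r)) →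
                     All.lookup {P = λ r → Vec (Fin N) r → Bool} (R ∷ setEnvᵇ Xs) (there p) ≡ All.lookup (setEnvᵇ Xs) p
    lookup-setEnvᵇ Xs R p = refl

    coreF-reflects : 2 ≤ N → (Xs : Vec (List Tuple) sets) → Reflects (Core (concatV Xs)) (ev coreF [] (setEnvᵇ Xs))
    coreF-reflects 2≤N Xs = exV-reflects r λ ē →
      ×-reflects-lazy
        (reflects-⇔ (λ (¬l , ¬q) → ≤∧≢⇒< (≮⇒≥ ¬l) (¬q ∘ sym)) (λ g → (λ l → <⇒≱ g (<⇒≤ l)) , λ q → <⇒≢ g (sym q))
          (¬-reflects (belowN-reflects (new r) (den-new ē)) ×-reflects ¬-reflects (isN-reflects (new r) (den-new ē)))
         ×-reflects lengthF-reflects k (new r) (den-new ē))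
        λ (N<e , _) → inner ē N<e
      where
        X = concatV Xs
        inner : ∀ ē → N < enc ē →
          Reflects (Covered X (enc ē) × (Σ ℕ λ t → t < N ^ r × Reached X (bitsOf X (enc ē ∸ suc N)) t))
                   (ev (conj (neg (exV r (conj (betweenF (old r (new r)) (new r)) (neg (domF X₀ (new r)))))) (acceptF X₁ (new r)))
                       (ē Vec.++ []) (setEnvᵇ Xs))
        inner ē N<e = ¬-reflects (exV-reflects r λ p̄ →
            RC.betweenF-reflects {X̂ = X₀} defX₀ (old r (new r)) (new r) (den-old p̄ (den-new {ρ = []} ē)) (den-new p̄) ×-reflects
            ¬-reflects (RC.domF-reflects {X̂ = X₀} defX₀ (new r) (den-new p̄)))
          ×-reflects RC.acceptF-reflects {X̂ = X₁} (λ R → inX-reflects Xs there (lookup-setEnvᵇ Xs R)) (new r) (den-new ē) end≡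
          where
            m = enc ē ∸ suc N
            module RC = RunCorrect M r′ u 2≤N (bitsOf X m) X (coded X m)
            defX₀ : RC.DefinesX X₀ (setEnvᵇ Xs)
            defX₀ = inX-reflects Xs id (λ p → refl)
            end≡ : enc ē ≡ suc (N + length (bitsOf X m))
            end≡ = trans (sym (m+[n∸m]≡n N<e)) (cong (λ x → suc (N + x)) (sym (Listₚ.length-applyUpTo _ m)))

    -- The sentence looks at N ^ r steps, which need not end at the time bound of the verifier. As
    -- the machine has halted by then, the states at the two times agree if one of them is
    -- accepting.
    reached⇒accepts : ∀ v t → proj₁ (TapeOf.frun M t (TapeOf.finit M (u # v))) ≡ TM.acc M → Accepts u v
    reached⇒accepts v t q with ≤-total t (poly pc pd (length (u # v)))
    ... | inj₁ l = trans (stateAfter-mono {t} (u # v) l (subst (Halted M) (sym q) (inj₁ refl))) q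
      where open TapeOf M
    ... | inj₂ l = trans (stateAfter-frun t* (u # v))
        (trans (sym (stateAfter-mono {t*} (u # v) l (subst (Halted M) (stateAfter-frun t* (u # v)) (M-halts (u # v)))))
               (trans (stateAfter-frun t (u # v)) q))
      where
        open TapeOf M
        t* = poly pc pd (length (u # v))

    -- Pigeonhole: distinct positions between N and the end have pairs at distinct indices of X.
    covered-length : ∀ X (ē : Vec (Fin N) r) → Covered X (enc ē) → enc ē ∸ suc N ≤ length X
    covered-length X ē cov = Finₚ.injective⇒≤ {f = f} f-injective
      where
        m = enc ē ∸ suc N
        inside< : ∀ (j : Fin m) → suc (N + toℕ j) < enc ē
        inside< j = ≤-trans (≤-reflexive (cong suc (+-comm (suc N) (toℕ j)))) (m<n∸o⇒m+o<n (toℕ j) (suc N) (Finₚ.toℕ<n j))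
          where
            m<n∸o⇒m+o<n : ∀ m o {n} → m < n ∸ o → m + o < n
            m<n∸o⇒m+o<n m o {n} l = ≰⇒> λ n≤ → <⇒≱ l (≤-trans (∸-monoˡ-≤ o n≤) (≤-reflexive (m+n∸n≡m m o)))
        pos : ∀ (j : Fin m) → Σ (Vec (Fin N) r) λ p̄ → enc p̄ ≡ suc (N + toℕ j)
        pos j = enc-surjective r (<-trans (inside< j) (enc<N^r ē))
        entry? : ∀ (j : Fin m) → Dec (Σ (Fin N) λ b → (b ∷ proj₁ (pos j)) ∈ X)
        entry? j = Finₚ.any? (λ b → (b ∷ proj₁ (pos j)) ∈ᵛ? X)
        entryOf : ∀ (j : Fin m) → Σ (Fin N) λ b → (b ∷ proj₁ (pos j)) ∈ X
        -- The formula says only that a missing pair is impossible; the pair itself is obtained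
        -- because the search for it is decidable.
        entryOf j = decidable-stable (entry? j) λ none → cov (proj₁ (pos j) ,
          ( ≤-trans (s≤s (m≤m+n N (toℕ j))) (≤-reflexive (sym (proj₂ (pos j))))
          , ≤-trans (≤-reflexive (cong suc (proj₂ (pos j)))) (inside< j)) , none)
        f : Fin m → Fin (length X)
        f j = Any.index (proj₂ (entryOf j))
        f-injective : ∀ {i j} → f i ≡ f j → i ≡ j
        f-injective {i} {j} q = Finₚ.toℕ-injective (+-cancelˡ-≡ (suc N) _ _
          (trans (sym (proj₂ (pos i))) (trans (cong enc (Vecₚ.∷-injectiveʳ
            (trans (Anyₚ.lookup-index (proj₂ (entryOf i))) (trans (cong (List.lookup X) q) (sym (Anyₚ.lookup-index (proj₂ (entryOf j)))))))) (proj₂ (pos j)))))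

    sets≡c : sets ≡ c
    sets≡c = trans (⊕≡+ c 0) (+-identityʳ c)

    core-sound : ∀ (Xs : Vec (List Tuple) sets) → AllShort (logᵏ k₊ N) Xs → Core (concatV Xs) → L u
    core-sound Xs short (ē , (N<e , ok) , cov , t , _ , q) = Equivalence.from (L-iff u)
      (bitsOf X m , ≤-trans (≤-reflexive (Listₚ.length-applyUpTo _ m)) (bounded k ok (≤-trans (covered-length X ē cov)
          (≤-trans (length-concatV Xs short) (≤-reflexive (cong (_* logᵏ k₊ N) sets≡c))))) ,
       reached⇒accepts (bitsOf X m) t q)
      where
        X = concatV Xs
        m = enc ē ∸ suc N
        -- For k = 0 the quantifiers would admit c times ⌈log₂ N⌉ bits. The explicit bound on the
        -- end, N + c + 1, leaves c bits after position N.
        bounded : ∀ k → lengthOK k (enc ē) → m ≤ c * logᵏ (suc (pred k)) N → m ≤ c * logᵏ k N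
        bounded zero    l _ = ≤-trans (≤-trans (∸-monoˡ-≤ (suc N) l)
          (≤-reflexive (trans (cong (_∸ suc N) (+-suc N c)) (m+n∸m≡n (suc N) c)))) (≤-reflexive (sym (*-identityʳ c)))
        bounded (suc k) _ h = h

    core-complete : 2 ≤ N → L u → Σ (Vec (List Tuple) sets) λ Xs → AllShort (logᵏ k₊ N) Xs × Core (concatV Xs)
    core-complete 2≤N h = pack (Equivalence.to (L-iff u) h)
      where
        logᵏ≤ : logᵏ k N ≤ N ^ k
        logᵏ≤ = ^-monoˡ-≤ k (⌈log₂n⌉≤n N)
        capacity : ∀ k → c * logᵏ k N ≤ sets * logᵏ (suc (pred k)) N
        capacity zero    = ≤-trans (*-monoʳ-≤ c (≤-trans (⌈log₂⌉-mono-≤ {2} 2≤N) (≤-reflexive (sym (*-identityʳ _)))))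
                                   (≤-reflexive (cong (_* logᵏ 1 N) (sym sets≡c)))
        capacity (suc k) = ≤-reflexive (cong (_* logᵏ (suc k) N) (sym sets≡c))
        pack : (Σ (List Bool) λ v → length v ≤ c * logᵏ k N × Accepts u v) →
               Σ (Vec (List Tuple) sets) λ Xs → AllShort (logᵏ k₊ N) Xs × Core (concatV Xs)
        pack (v , v≤ , a) = fromChunks (chunks sets (logᵏ k₊ N) X
            (≤-trans (≤-reflexive (Listₚ.length-tabulate entryAt)) (≤-trans v≤ (capacity k))))
          where
            end≤ : suc (N + length v) ≤ lengthBound k c N
            end≤ = s≤s (+-monoʳ-≤ N (≤-trans v≤ (*-monoʳ-≤ c logᵏ≤)))
            size< : sizeBound pc pd k c N < N ^ r
            size< = sizeBound-< N 2≤N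
            end< : suc (N + length v) < N ^ r
            end< = ≤-trans (s≤s (≤-trans end≤ (m≤n+m _ (poly pc pd (lengthBound k c N))))) size<
            time< : poly pc pd (length (u # v)) < N ^ r
            time< = ≤-trans (s≤s (≤-trans (+-monoˡ-≤ pc (*-monoʳ-≤ pc (^-monoˡ-≤ pd (≤-trans (≤-reflexive length-#) end≤))))
                      (m≤m+n _ (lengthBound k c N)))) size<
              where
                length-# : length (u # v) ≡ suc (N + length v)
                length-# = trans (Listₚ.length-++ u) (trans (+-suc N _) (cong (λ k → suc (N + k)) (Listₚ.length-map bitSym v)))
            digit : Bool → Fin N
            digit b = fromℕ< {toBit b} (≤-trans (digit< b) 2≤N)
              where
                digit< : ∀ b → suc (toBit b) ≤ 2
                digit< true  = ≤-refl
                digit< false = s≤s z≤n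
            pos : ∀ (j : Fin (length v)) → Σ (Vec (Fin N) r) λ p̄ → enc p̄ ≡ suc (N + toℕ j)
            pos j = enc-surjective r (≤-trans (s≤s (s≤s (+-monoʳ-≤ N (<⇒≤ (Finₚ.toℕ<n j))))) end<)
            -- Zeros get a pair as well, since every position of v has to be covered; the digit for
            -- a one exists because N is at least 2.
            entryAt : Fin (length v) → Tuple
            entryAt j = digit (nth false v (toℕ j)) ∷ proj₁ (pos j)
            X : List Tuple
            X = List.tabulate entryAt
            bit≡ : ∀ j → j < length v → does (bitAt? X j) ≡ nth false v j
            bit≡ j l = det (reflects-⇔ to from (proof (bitAt? X j))) (true-reflects (nth false v j))
              where
                true-reflects : ∀ b → Reflects (b ≡ true) b
                true-reflects true  = ofʸ refl
                true-reflects false = ofⁿ λ ()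
                at-j : ∀ i → enc (Vec.tail (entryAt i)) ≡ suc (N + j) → toℕ i ≡ j
                at-j i q = +-cancelˡ-≡ (suc N) _ _ (trans (sym (proj₂ (pos i))) q)
                positive⇒ : ∀ b → 0 < toℕ (digit b) → b ≡ true
                positive⇒ true  _ = refl
                positive⇒ false p = contradiction (≤-trans p (≤-reflexive (Finₚ.toℕ-fromℕ< _))) λ ()
                to : Any.Any (BitAt X j) X → nth false v j ≡ true
                to p with find p
                ... | x , m , q , 0<b with ∈ₚ.∈-tabulate⁻ m
                ...   | i , refl = trans (cong (nth false v) (sym (at-j i q))) (positive⇒ _ 0<b)
                from : nth false v j ≡ true → Any.Any (BitAt X j) X
                from h = Any.map (λ { refl → trans (proj₂ (pos j′)) (cong (λ x → suc (N + x)) toj) ,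
                                     ≤-reflexive (sym (trans (Finₚ.toℕ-fromℕ< _) (cong toBit (trans (cong (nth false v) toj) h)))) })
                                 (∈ₚ.∈-tabulate⁺ {f = entryAt} j′)
                  where
                    j′ = fromℕ< l
                    toj : toℕ j′ ≡ j
                    toj = Finₚ.toℕ-fromℕ< l
            end : Σ (Vec (Fin N) r) λ ē → enc ē ≡ suc (N + length v)
            end = enc-surjective r end<
            ok : ∀ k → length v ≤ c * logᵏ k N → lengthOK k (enc (proj₁ end))
            ok zero    l = ≤-trans (≤-reflexive (trans (proj₂ end) (sym (+-suc N _)))) (+-monoʳ-≤ N (s≤s (≤-trans l (≤-reflexive (*-identityʳ c)))))
            ok (suc k) l = tt
            covered : Covered X (enc (proj₁ end))
            covered (p̄ , (N<p , p<e) , none) = none (digit (nth false v (toℕ j)) ,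
                subst (λ z → (digit (nth false v (toℕ j)) ∷ z) ∈ X)
                  (enc-injective _ p̄ (trans (proj₂ (pos j)) (trans (cong (λ x → suc (N + x)) (Finₚ.toℕ-fromℕ< j<)) (m+[n∸m]≡n N<p))))
                  (∈ₚ.∈-tabulate⁺ {f = entryAt} j))
              where
                j< : enc p̄ ∸ suc N < length v
                j< = +-cancelˡ-< (suc N) _ _ (≤-trans (≤-reflexive (cong suc (m+[n∸m]≡n N<p))) (≤-trans p<e (≤-reflexive (proj₂ end))))
                j = fromℕ< j<
            bits≡ : bitsOf X (enc (proj₁ end) ∸ suc N) ≡ v
            bits≡ = trans (cong (bitsOf X) (trans (cong (_∸ suc N) (proj₂ end)) (m+n∸m≡n (suc N) (length v))))
                          (applyUpTo-nth _ v bit≡)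
            core : Core X
            core = proj₁ end , (≤-trans (s≤s (m≤m+n N (length v))) (≤-reflexive (sym (proj₂ end))) , ok k v≤) , covered ,
              poly pc pd (length (u # v)) , time< ,
              subst (λ z → Reached X z (poly pc pd (length (u # v)))) (sym bits≡) (trans (sym (TapeOf.stateAfter-frun M (poly pc pd (length (u # v))) (u # v))) a)
            fromChunks : (Σ (Vec (List Tuple) sets) λ Xs → concatV Xs ≡ X × AllShort (logᵏ k₊ N) Xs) →
                         Σ (Vec (List Tuple) sets) λ Xs → AllShort (logᵏ k₊ N) Xs × Core (concatV Xs)
            fromChunks (Xs , q , short) = Xs , short , subst Core (sym q) core

  Small : Str → Set
  Small u = (L [] × ¬ (Σ (Fin (length u)) λ a → a ≡ a)) ⊎
            (Σ (Fin 5) λ i → L (allSyms i ∷ []) × Σ (Fin (length u)) λ a → List.lookup u a ≡ allSyms i)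

  small-⇔ : ∀ u → ¬ (2 ≤ length u) → Small u ⇔ L u
  small-⇔ [] _ = mk⇔ (λ { (inj₁ (h , _)) → h ; (inj₂ (_ , _ , () , _)) }) (λ h → inj₁ (h , λ ()))
  small-⇔ (s ∷ []) _ = mk⇔
    (λ { (inj₁ (_ , none)) → contradiction (zero , refl) none
       ; (inj₂ (i , h , zero , refl)) → h })
    (λ h → inj₂ (Finite.code finite-Sym s , subst (λ x → L (x ∷ [])) (sym (Finite.decode-code finite-Sym s)) h ,
                 zero , sym (Finite.decode-code finite-Sym s)))
  small-⇔ (_ ∷ _ ∷ _) ¬2≤ = contradiction (s≤s (s≤s z≤n)) ¬2≤

  module _ (u : Str) where
    open Sem u using (N; sat)
    open Eval u
    open Definable u

    twoF-reflects : ∀ {Γ e} → Reflects (2 ≤ N) (ev {0} {Γ} twoF [] e)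
    twoF-reflects = reflects-⇔
      (λ (b , a , l) → ≤-trans (s≤s (≤-trans (s≤s z≤n) l)) (Finₚ.toℕ<n b))
      (two N)
      (anyᶠ-reflects λ b → anyᶠ-reflects λ a → <ᵇ-reflects (toℕ a) (toℕ b))
      where
        two : ∀ n → 2 ≤ n → Σ (Fin n) λ b → Σ (Fin n) λ a → toℕ a < toℕ b
        two (suc zero) (s≤s ())
        two (suc (suc n)) _ = suc zero , zero , s≤s z≤n

    smallF-reflects : ∀ {e} → Reflects (Small u) (ev smallF [] e)
    smallF-reflects {e} = disj-reflects
      (guard-reflects {ρ = []} {e} (L? []) {neg (ex (eq zero zero))} (¬-reflects (anyᶠ-reflects {N} λ a → proof (a Fin.≟ a))))
      (orF-reflects {ρ = []} {e} {F = λ i → guardF (L? (allSyms i ∷ [])) (ex (P (allSyms i) zero))} λ i → guard-reflects {ρ = []} {e} (L? (allSyms i ∷ [])) {ex (P (allSyms i) zero)}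
        (anyᶠ-reflects λ a → proof (List.lookup u a ≟ˢ allSyms i)))

    mainF-reflects : ∀ Xs → Reflects ((2 ≤ N × Core u (concatV Xs)) ⊎ (¬ (2 ≤ N) × Small u)) (ev mainF [] (setEnvᵇ Xs))
    mainF-reflects Xs = disj-reflects
      (×-reflects-lazy (twoF-reflects {e = setEnvᵇ Xs}) (λ 2≤N → coreF-reflects u 2≤N Xs))
      (¬-reflects (twoF-reflects {e = setEnvᵇ Xs}) ×-reflects smallF-reflects {setEnvᵇ Xs})

    mainF-sat : ∀ Xs → (2 ≤ N × Core u (concatV Xs)) ⊎ (¬ (2 ≤ N) × Small u) → sat mainF [] (setEnv Xs)
    mainF-sat Xs h = reflects-true (ev-reflects mainF [] (setEnv-reflects Xs)) (reflects-intro (mainF-reflects Xs) h)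

    sentence-⇔ : (u ⊨ sentence) ⇔ L u
    sentence-⇔ = mk⇔
      (λ t → sound (prefix-sound u c 0 {mainF} [] tt t))
      (λ h → complete h (2 ≤? N))
      where
        sound : (Σ (Vec (List (Tuple u)) sets) λ Xs → AllShort (logᵏ k₊ N) Xs × sat mainF [] (setEnv Xs)) → L u
        sound (Xs , short , t) =
          meaning (reflects-true (mainF-reflects Xs) (reflects-intro (ev-reflects mainF [] (setEnv-reflects Xs)) t))
          where
            meaning : (2 ≤ N × Core u (concatV Xs)) ⊎ (¬ (2 ≤ N) × Small u) → L u
            meaning (inj₁ (_ , core)) = core-sound u Xs short core
            meaning (inj₂ (¬2≤ , sm)) = Equivalence.to (small-⇔ u ¬2≤) sm
        conclude : (Σ (Vec (List (Tuple u)) 0) λ Ys → AllShort (logᵏ k₊ N) Ys × satL u sentence (setEnv Ys)) → u ⊨ sentence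
        conclude ([] , _ , t) = t
        complete : L u → Dec (2 ≤ N) → u ⊨ sentence
        complete h (yes 2≤N) = let (Xs , short , core) = core-complete u 2≤N h in
          conclude (prefix-complete u c 0 {mainF} Xs short (mainF-sat Xs (inj₁ (2≤N , core))))
        -- The empty sets respect the bounds of the quantifiers even where the logarithm is 0.
        complete h (no ¬2≤N) = conclude (prefix-complete u c 0 {mainF} (emptySets sets) (emptySets-short sets _)
          (mainF-sat (emptySets sets) (inj₂ (¬2≤N , Equivalence.from (small-⇔ u ¬2≤N) h))))

language⇒sentence : (L : Language) → InβP L → Σ Sentence λ φ → ∀ u → (u ⊨ φ) ⇔ L u
language⇒sentence L (k , L′ , (M , pc , pd , decides) , c , _ , iff) = pack (exponent pc pd k c)
  where
    halts : ∀ w → Halted M (stateAfter M (poly pc pd (length w)) w)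
    halts w = proj₁ (decides w)
    accepted : ∀ u → L u ⇔ (Σ (List Bool) λ v → length v ≤ c * logᵏ k (length u) ×
                 stateAfter M (poly pc pd (length (u # v))) (u # v) ≡ TM.acc M)
    accepted u = mk⇔
      (λ h → let (v , l , x) = Equivalence.to (iff u) h in v , l , Equivalence.from (proj₂ (decides (u # v))) x)
      (λ (v , l , x) → Equivalence.from (iff u) (v , l , Equivalence.to (proj₂ (decides (u # v))) x))
    pack : (Σ ℕ λ r → ∀ n → 2 ≤ n → sizeBound pc pd k c n < n ^ suc r) → Σ Sentence λ φ → ∀ u → (u ⊨ φ) ⇔ L u
    pack (r′ , size<) = sentence , sentence-⇔
      where open FromMachine M pc pd k c L halts accepted r′ size<

theorem3p3 :
    ((φ : Sentence) → Σ βPMachine λ M → ∀ u → βPMachine.Accepts M u ⇔ (u ⊨ φ))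
    × ((L : Language) → InβP L → Σ Sentence λ φ → ∀ u → (u ⊨ φ) ⇔ L u)
theorem3p3 = sentence⇒machine , language⇒sentence
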